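{- Let $\mu,k,r,s,t$ be positive integers with $s,t,\mu\geq 2$. There exist positive constants $C$ and $C'$ depending on $\mu,k,r,s,t$ such that the following holds. Let $G$ be a $\mu$-almost-biregular $K_{s,t}^{(2k)}(r)$-free bipartite graph with an ordered bipartition $(M,N)$ where $|M|\leq |N|$. Then \[e(G)\leq C\left(|M|^{\frac{1}{2}+\frac{1}{2k}}|N|^{\frac{1}{2}}+|M|+|N|\right).\] Furthermore, if $G$ is a $\mu$-almost-biregular $K_{s,t}^{(2k)}$-free bipartite graph with ordered bipartition $(M,N)$, $|M|\le |N|$, then \[e(G)\leq C'\left(|M|^{\frac{1}{2}+\frac{1}{2k}-\frac{1}{2ks}}|N|^{\frac{1}{2}}+|M|+|N|\right).\]
   Context: A bipartite graph with bipartition $(A,B)$ is $\mu$-almost-biregular if $\Delta_A\leq \mu\delta_A$ and $\Delta_B\leq\mu\delta_B$, where $\Delta_A,\delta_A$ (resp. $\Delta_B,\delta_B$) are the maximum and minimum degrees of vertices in $A$ (resp. $B$). For a graph $H$ and positive integers $k,r$, $H^{(k)}(r)$ is obtained from $H$ by replacing each edge $uv$ by $r$ paths of length $k$ from $u$ to $v$, all $r\,e(H)$ paths pairwise internally vertex-disjoint; $H^{(k)}=H^{(k)}(1)$. -}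

module Defs where

open import Data.Nat using (ℕ; zero; suc; _+_; _*_; _∸_; _^_; _≤_; _<_)
open import Data.Nat.Properties using (_<?_)
open import Data.Fin using (Fin; fromℕ<)
open import Data.Bool using (Bool; true; false; if_then_else_)
open import Data.List using (List; map; allFin)
open import Data.Nat.ListAction using (sum)
open import Data.Sum using (_⊎_; inj₁; inj₂)
open import Data.Product using (_×_; _,_)
open import Data.Empty using (⊥)
open import Relation.Nullary using (yes; no)
open import Relation.Binary.PropositionalEquality using (_≡_)
open import Function.Definitions using (Injective)

BipGraph : ℕ → ℕ → Set
BipGraph m n = Fin m → Fin n → Bool

V : ℕ → ℕ → Set
V m n = Fin m ⊎ Fin n

Adj : ∀ {m n} → BipGraph m n → V m n → V m n → Set
Adj G (inj₁ a) (inj₂ b) = G a b ≡ true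
Adj G (inj₂ b) (inj₁ a) = G a b ≡ true
Adj G (inj₁ _) (inj₁ _) = ⊥
Adj G (inj₂ _) (inj₂ _) = ⊥

indicator : Bool → ℕ
indicator b = if b then 1 else 0

degM : ∀ {m n} → BipGraph m n → Fin m → ℕ
degM {n = n} G a = sum (map (λ b → indicator (G a b)) (allFin n))

degN : ∀ {m n} → BipGraph m n → Fin n → ℕ
degN {m = m} G b = sum (map (λ a → indicator (G a b)) (allFin m))

edges : ∀ {m n} → BipGraph m n → ℕ
edges {m = m} G = sum (map (degM G) (allFin m))

-- μ-almost-biregular: Δ_M ≤ μ δ_M and Δ_N ≤ μ δ_N
-- (equivalently: every degree on a side is ≤ μ times every degree on that side)
AlmostBiregular : ∀ {m n} → ℕ → BipGraph m n → Set
AlmostBiregular μ G =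
  (∀ a a' → degM G a ≤ μ * degM G a') × (∀ b b' → degN G b ≤ μ * degN G b')

-- Vertex set of H = K_{s,t}^{(2k)}(r):
-- branch vertices Fin s ⊎ Fin t, and for every pair (i , j) and every
-- l < r, the 2k-1 internal vertices of the l-th path from i to j.
HVert : ℕ → ℕ → ℕ → ℕ → Set
HVert s t k r = Fin s ⊎ Fin t ⊎ (Fin s × Fin t × Fin r × Fin (2 * k ∸ 1))

-- x-th vertex (0 ≤ x ≤ 2k) of the l-th path from branch vertex i to j in H
pathVert : ∀ {s t k r} → Fin s → Fin t → Fin r → ℕ → HVert s t k r
pathVert i j l zero = inj₁ i
pathVert {k = k} i j l (suc x) with x <? (2 * k ∸ 1)
... | yes p = inj₂ (inj₂ (i , j , l , fromℕ< p))
... | no _  = inj₂ (inj₁ j)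

-- G contains a copy (not necessarily induced) of K_{s,t}^{(2k)}(r):
-- an injective map of V(H) into V(G) sending every edge of H
-- (consecutive vertices on one of the paths) to an edge of G.
record ContainsSubdiv {m n} (G : BipGraph m n) (s t k r : ℕ) : Set where
  field
    φ        : HVert s t k r → V m n
    φ-inj    : Injective _≡_ _≡_ φ
    φ-edges  : ∀ i j l x → x < 2 * k →
               Adj G (φ (pathVert {s} {t} {k} {r} i j l x))
                     (φ (pathVert {s} {t} {k} {r} i j l (suc x)))

{-# OPTIONS --safe #-}
module Submission where

open import Defs
open import Data.Nat using (ℕ; zero; suc; _+_; _*_; _∸_; _^_; _≤_; _<_; z≤n; s≤s; _≤?_; _<?_; >-nonZero)
open import Data.Product using (Σ; ∃; _×_; _,_; proj₁; proj₂)
open import Relation.Nullary using (¬_; Dec; does; yes; no)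
open import Data.Bool using (Bool; true; false; not; _∧_; _∨_; if_then_else_)
open import Data.Bool.ListAction using (any)
open import Data.Bool.Properties using (not-involutive)
open import Data.Empty using (⊥; ⊥-elim)
open import Data.Fin using (Fin; zero; suc; toℕ)
import Data.Fin as Fin
open import Data.Fin.Properties using (toℕ-fromℕ<; toℕ<n; toℕ-injective; remQuot-combine)
open import Data.List using (List; []; _∷_; _++_; map; length; filterᵇ; concatMap; allFin; drop; upTo)
open import Data.List.Membership.Propositional using (_∈_; _∉_; find)
open import Data.List.Membership.Propositional.Properties using (∈-map⁺; ∈-map⁻; ∈-concatMap⁻; ∈-++⁻; ∈-++⁺ˡ; ∈-++⁺ʳ; ∈-upTo⁺; ∈-upTo⁻; ∈-allFin)
open import Data.List.Properties using (length-++; length-map; length-upTo; length-tabulate)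
open import Data.List.Relation.Unary.All using ([]; _∷_)
import Data.List.Relation.Unary.All as All
import Data.List.Relation.Unary.AllPairs as AllPairs
open import Data.List.Relation.Unary.Any using (here; there)
open import Data.List.Relation.Unary.Unique.Propositional using (Unique)
import Data.List.Relation.Unary.Unique.Propositional.Properties as Uniq
open import Data.Nat.ListAction using (sum)
open import Data.Nat.Properties hiding (_≟_)
open import Algebra.Properties.CommutativeSemigroup *-commutativeSemigroup using (interchange; x∙yz≈y∙xz)
open import Data.Nat.Tactic.RingSolver using (solve-∀)
open import Data.Sum using (_⊎_; inj₁; inj₂)
import Data.Sum.Properties as Sum
open import Data.Vec using (Vec; []; _∷_; lookup; updateAt; _[_]≔_)
import Data.Vec as Vec
import Data.Vec.Properties as Vec
open import Function using (_∘_; id)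
open import Relation.Binary.Definitions using (DecidableEquality)
open import Relation.Binary.PropositionalEquality hiding ([_])

-- A star is a center with s walks ("legs") leaving it; its roots are the far ends of the legs, and
-- it is rich if at least c stars of its shape share its roots.  The key claim is that, when H is
-- absent and the degrees are large, only a small fraction of the stars of each shape is rich.  By
-- induction on the total length one may discard the stars with a rich sub-leg or a rich truncation;
-- for the remaining ones few stars on given roots pass through a given vertex, so that any bounded
-- set of vertices can be avoided.  If rich stars had positive density, then after several rounds of
-- deleting stars with few companions each survivor could be re-rooted: its root moves to the next
-- vertex of the leg and back, each move making the avoiding stars on these roots one edge longer.
-- In this way every leg is brought to length 2k.  For two legs of lengths 1 and i (walks of length
-- i + 1), an argument of Kővári–Sós–Turán type finds s + t roots joined by robust families of paths
-- of length 2k; for s legs, t disjoint stars on one root tuple suffice.  Either way H appears.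
-- Since few walks of length 2k (stars with s legs of length 2k) are rich, their number is O(m²)
-- (O(mˢ)), and comparing with the product of the degrees bounds the number of edges.

-- The constants are chosen in a fixed order. To leave only a small share of stars with a rich part,
-- the shorter shapes must be sparse at a larger `E₁`, so the induction treats all densities at
-- once. It returns a threshold `c′`; this fixes the number `a₀` of companions needed to avoid a
-- bounded set, then the threshold `c` that lets something survive the deletions, and last the
-- degree bound `Q`. Avoidance rests on cutting: a star on given roots through a given vertex splits
-- there into a shorter star and a walk, with at most `c′` choices for each. A step inwards uses
-- stars that differ in one root only, a step back uses companions. Companions share the roots but
-- not the second vertices, so a step back is possible only while all other roots are in place.
-- Hence the legs grow by two, one after the other, and the single steps that parity demands come
-- last. For legs 1 and `i` the first is left alone and the second grows to 2k - 1; with the center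
-- fixed, the survivors form a dense bipartite graph between its neighbours and the walks of length
-- `i`.

∑ : {A : Set} → List A → (A → ℕ) → ℕ
∑ []       f = 0
∑ (x ∷ xs) f = f x + ∑ xs f

⟦_⟧ : Bool → ℕ
⟦_⟧ = indicator

module _ {A : Set} where

  ∑-mono∈ : (xs : List A) {f g : A → ℕ} → (∀ x → x ∈ xs → f x ≤ g x) → ∑ xs f ≤ ∑ xs g
  ∑-mono∈ []       h = z≤n
  ∑-mono∈ (x ∷ xs) h = +-mono-≤ (h x (here refl)) (∑-mono∈ xs λ y y∈ → h y (there y∈))

  ∑-mono : (xs : List A) {f g : A → ℕ} → (∀ x → f x ≤ g x) → ∑ xs f ≤ ∑ xs g
  ∑-mono xs h = ∑-mono∈ xs λ x _ → h x

  ∑-cong∈ : (xs : List A) {f g : A → ℕ} → (∀ x → x ∈ xs → f x ≡ g x) → ∑ xs f ≡ ∑ xs g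
  ∑-cong∈ []       h = refl
  ∑-cong∈ (x ∷ xs) h = cong₂ _+_ (h x (here refl)) (∑-cong∈ xs λ y y∈ → h y (there y∈))

  ∑-cong : (xs : List A) {f g : A → ℕ} → (∀ x → f x ≡ g x) → ∑ xs f ≡ ∑ xs g
  ∑-cong xs h = ∑-cong∈ xs λ x _ → h x

  ∑-+ : (xs : List A) (f g : A → ℕ) → ∑ xs (λ x → f x + g x) ≡ ∑ xs f + ∑ xs g
  ∑-+ []       f g = refl
  ∑-+ (x ∷ xs) f g = trans (cong (f x + g x +_) (∑-+ xs f g)) (lem (f x) (g x) (∑ xs f) (∑ xs g))
    where
    lem : ∀ a b c d → a + b + (c + d) ≡ a + c + (b + d)
    lem = solve-∀

  ∑-*ˡ : (xs : List A) (c : ℕ) (f : A → ℕ) → ∑ xs (λ x → c * f x) ≡ c * ∑ xs f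
  ∑-*ˡ []       c f = sym (*-zeroʳ c)
  ∑-*ˡ (x ∷ xs) c f = trans (cong (c * f x +_) (∑-*ˡ xs c f)) (sym (*-distribˡ-+ c (f x) (∑ xs f)))

  ∑-*ʳ : (xs : List A) (c : ℕ) (f : A → ℕ) → ∑ xs (λ x → f x * c) ≡ ∑ xs f * c
  ∑-*ʳ xs c f = trans (∑-cong xs λ x → *-comm (f x) c) (trans (∑-*ˡ xs c f) (*-comm c _))

  ∑-const : (xs : List A) (c : ℕ) → ∑ xs (λ _ → c) ≡ length xs * c
  ∑-const []       c = refl
  ∑-const (x ∷ xs) c = cong (c +_) (∑-const xs c)

  ∑-zero : (xs : List A) → ∑ xs (λ _ → 0) ≡ 0
  ∑-zero xs = trans (∑-const xs 0) (*-zeroʳ (length xs))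

  ∑-bound : (xs : List A) {f : A → ℕ} (c : ℕ) → (∀ x → x ∈ xs → f x ≤ c) → ∑ xs f ≤ length xs * c
  ∑-bound xs c h = ≤-trans (∑-mono∈ xs h) (≤-reflexive (∑-const xs c))

  ∑-pick : {xs : List A} (f : A → ℕ) {x : A} → x ∈ xs → f x ≤ ∑ xs f
  ∑-pick {x ∷ xs} f (here refl) = m≤m+n (f x) _
  ∑-pick {x ∷ xs} f (there y∈)  = ≤-trans (∑-pick f y∈) (m≤n+m _ (f x))

  pigeonhole : (xs : List A) (f g : A → ℕ) → ∑ xs g < ∑ xs f → ∃ λ x → x ∈ xs × g x < f x
  pigeonhole (x ∷ xs) f g lt with suc (g x) ≤? f x
  ... | yes p = x , here refl , p
  ... | no ¬p with pigeonhole xs f g (+-cancelˡ-< (g x) _ _ (<-≤-trans lt (+-monoˡ-≤ (∑ xs f) (≮⇒≥ ¬p))))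
  ... | y , y∈ , q = y , there y∈ , q

  ∑-positive : (xs : List A) (f : A → ℕ) → 0 < ∑ xs f → ∃ λ x → x ∈ xs × 0 < f x
  ∑-positive xs f lt = pigeonhole xs f (λ _ → 0) (subst (_< ∑ xs f) (sym (∑-zero xs)) lt)

  ∑-++ : (xs ys : List A) (f : A → ℕ) → ∑ (xs ++ ys) f ≡ ∑ xs f + ∑ ys f
  ∑-++ []       ys f = refl
  ∑-++ (x ∷ xs) ys f = trans (cong (f x +_) (∑-++ xs ys f)) (sym (+-assoc (f x) _ _))

  ∑-filterᵇ : (p : A → Bool) (xs : List A) (f : A → ℕ) → ∑ (filterᵇ p xs) f ≡ ∑ xs (λ x → ⟦ p x ⟧ * f x)
  ∑-filterᵇ p []       f = refl
  ∑-filterᵇ p (x ∷ xs) f with p x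
  ... | true  = cong₂ _+_ (sym (+-identityʳ (f x))) (∑-filterᵇ p xs f)
  ... | false = ∑-filterᵇ p xs f

module _ {A B : Set} where

  ∑-swap : (xs : List A) (ys : List B) (f : A → B → ℕ) →
           ∑ xs (λ x → ∑ ys (f x)) ≡ ∑ ys (λ y → ∑ xs (λ x → f x y))
  ∑-swap []       ys f = sym (∑-zero ys)
  ∑-swap (x ∷ xs) ys f = trans (cong (∑ ys (f x) +_) (∑-swap xs ys f)) (sym (∑-+ ys (f x) _))

  ∑-map : (g : A → B) (xs : List A) (f : B → ℕ) → ∑ (map g xs) f ≡ ∑ xs (f ∘ g)
  ∑-map g []       f = refl
  ∑-map g (x ∷ xs) f = cong (f (g x) +_) (∑-map g xs f)

  ∑-concatMap : (g : A → List B) (xs : List A) (f : B → ℕ) → ∑ (concatMap g xs) f ≡ ∑ xs (λ x → ∑ (g x) f)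
  ∑-concatMap g []       f = refl
  ∑-concatMap g (x ∷ xs) f = trans (∑-++ (g x) (concatMap g xs) f) (cong (∑ (g x) f +_) (∑-concatMap g xs f))

∑1 : {A : Set} (xs : List A) → ∑ xs (λ _ → 1) ≡ length xs
∑1 xs = trans (∑-const xs 1) (*-identityʳ _)

⟦⟧≤1 : ∀ p → ⟦ p ⟧ ≤ 1
⟦⟧≤1 true  = ≤-refl
⟦⟧≤1 false = z≤n

⟦∧⟧ : ∀ p q → ⟦ p ∧ q ⟧ ≡ ⟦ p ⟧ * ⟦ q ⟧
⟦∧⟧ true  q = sym (+-identityʳ _)
⟦∧⟧ false q = refl

⟦⟧-positive : ∀ p → 0 < ⟦ p ⟧ → p ≡ true
⟦⟧-positive true _ = refl

⟦⟧-mono : ∀ {p q} → (p ≡ true → q ≡ true) → ⟦ p ⟧ ≤ ⟦ q ⟧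
⟦⟧-mono {false} h = z≤n
⟦⟧-mono {true} {q} h rewrite h refl = ≤-refl

does-true : {P : Set} (d : Dec P) → does d ≡ true → P
does-true (yes p) _ = p

true-does : {P : Set} (d : Dec P) → P → does d ≡ true
true-does (yes _) p = refl
true-does (no ¬p) p = ⊥-elim (¬p p)

does-false : {P : Set} (d : Dec P) → does d ≡ false → ¬ P
does-false (no ¬p) _ = ¬p

false-does : {P : Set} (d : Dec P) → ¬ P → does d ≡ false
false-does (yes p) ¬p = ⊥-elim (¬p p)
false-does (no _) ¬p = refl

∧-true : ∀ {p q} → p ∧ q ≡ true → p ≡ true × q ≡ true
∧-true {true} {true} _ = refl , refl

true-∧ : ∀ {p q} → p ≡ true → q ≡ true → p ∧ q ≡ true
true-∧ refl refl = refl

not-true : ∀ {p} → not p ≡ true → p ≡ false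
not-true {false} _ = refl

-- The side reached after `i` steps from side `b`; the degree products below alternate along it.
flip : ℕ → Bool → Bool
flip zero    b = b
flip (suc i) b = not (flip i b)

flip-+ : ∀ j i b → flip (j + i) b ≡ flip j (flip i b)
flip-+ zero    i b = refl
flip-+ (suc j) i b = cong not (flip-+ j i b)

-- Walks, stars and the cutting of a leg in two.

module Graph {m n : ℕ} (G : BipGraph m n) where

  Vx : Set
  Vx = V m n

  _≟_ : DecidableEquality Vx
  _≟_ = Sum.≡-dec Fin._≟_ Fin._≟_

  adj : Vx → Vx → Bool
  adj (inj₁ a) (inj₂ b) = G a b
  adj (inj₂ b) (inj₁ a) = G a b
  adj (inj₁ _) (inj₁ _) = false
  adj (inj₂ _) (inj₂ _) = false

  adj-sym : ∀ u v → adj u v ≡ adj v u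
  adj-sym (inj₁ _) (inj₁ _) = refl
  adj-sym (inj₁ _) (inj₂ _) = refl
  adj-sym (inj₂ _) (inj₁ _) = refl
  adj-sym (inj₂ _) (inj₂ _) = refl

  adj⇒Adj : ∀ u v → adj u v ≡ true → Adj G u v
  adj⇒Adj (inj₁ _) (inj₂ _) e = e
  adj⇒Adj (inj₂ _) (inj₁ _) e = e

  -- true is the side M, false the side N.
  sd : Vx → Bool
  sd (inj₁ _) = true
  sd (inj₂ _) = false

  sideL : Bool → List Vx
  sideL true  = map inj₁ (allFin m)
  sideL false = map inj₂ (allFin n)

  sz : Bool → ℕ
  sz b = length (sideL b)

  ∈sideL⇒sd : ∀ b {v} → v ∈ sideL b → sd v ≡ b
  ∈sideL⇒sd true  v∈ with ∈-map⁻ inj₁ v∈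
  ... | _ , _ , refl = refl
  ∈sideL⇒sd false v∈ with ∈-map⁻ inj₂ v∈
  ... | _ , _ , refl = refl

  ∈sideL : ∀ v → v ∈ sideL (sd v)
  ∈sideL (inj₁ a) = ∈-map⁺ inj₁ (∈-allFin a)
  ∈sideL (inj₂ a) = ∈-map⁺ inj₂ (∈-allFin a)

  nb : Vx → List Vx
  nb u = filterᵇ (λ v → adj v u) (sideL (not (sd u)))

  filterᵇ-∈ : (p : Vx → Bool) (xs : List Vx) {v : Vx} → v ∈ filterᵇ p xs → v ∈ xs × p v ≡ true
  filterᵇ-∈ p (x ∷ xs) v∈ with p x in eq
  filterᵇ-∈ p (x ∷ xs) (here refl) | true = here refl , eq
  filterᵇ-∈ p (x ∷ xs) (there v∈)  | true = let q , r = filterᵇ-∈ p xs v∈ in there q , r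
  filterᵇ-∈ p (x ∷ xs) v∈ | false = let q , r = filterᵇ-∈ p xs v∈ in there q , r

  nb-adj : ∀ {u v} → v ∈ nb u → adj v u ≡ true
  nb-adj {u} v∈ = proj₂ (filterᵇ-∈ _ (sideL (not (sd u))) v∈)

  nb-sd : ∀ {u v} → v ∈ nb u → sd v ≡ not (sd u)
  nb-sd {u} v∈ = ∈sideL⇒sd _ (proj₁ (filterᵇ-∈ _ (sideL (not (sd u))) v∈))

  -- Double counting: both sides run once over all edges, grouped by either end.
  nb-swap : ∀ b (F : Vx → Vx → ℕ) →
            ∑ (sideL b) (λ u → ∑ (nb u) (F u)) ≡ ∑ (sideL (not b)) (λ v → ∑ (nb v) (λ u → F u v))
  nb-swap b F = begin
    ∑ (sideL b) (λ u → ∑ (nb u) (F u))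
      ≡⟨ ∑-cong∈ (sideL b) (λ u u∈ → one b u (F u) (∈sideL⇒sd b u∈)) ⟩
    ∑ (sideL b) (λ u → ∑ (sideL (not b)) (λ v → ⟦ adj v u ⟧ * F u v))
      ≡⟨ ∑-swap (sideL b) (sideL (not b)) _ ⟩
    ∑ (sideL (not b)) (λ v → ∑ (sideL b) (λ u → ⟦ adj v u ⟧ * F u v))
      ≡⟨ ∑-cong∈ (sideL (not b)) (λ v v∈ → sym (trans (one (not b) v (λ u → F u v) (∈sideL⇒sd (not b) v∈))
           (trans (cong (λ c → ∑ (sideL c) _) (not-involutive b)) (∑-cong (sideL b) λ u → cong (λ c → ⟦ c ⟧ * F u v) (adj-sym u v))))) ⟩
    ∑ (sideL (not b)) (λ v → ∑ (nb v) (λ u → F u v)) ∎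
    where
    open ≡-Reasoning
    one : ∀ b u (f : Vx → ℕ) → sd u ≡ b → ∑ (nb u) f ≡ ∑ (sideL (not b)) (λ v → ⟦ adj v u ⟧ * f v)
    one b u f refl = ∑-filterᵇ (λ v → adj v u) (sideL (not b)) f

  hd : Vx → List Vx → Vx
  hd z []      = z
  hd z (v ∷ _) = v

  hd-++ : ∀ z f g → hd z (f ++ g) ≡ hd (hd z g) f
  hd-++ z []      g = refl
  hd-++ z (x ∷ f) g = refl

  -- Legs are listed from the far end: the head is the root, the last entry is adjacent to z.
  data Leg (z : Vx) : ℕ → List Vx → Set where
    []  : Leg z 0 []
    _∷_ : ∀ {j v f} → v ∈ nb (hd z f) → Leg z j f → Leg z (suc j) (v ∷ f)

  legL : Vx → ℕ → List (List Vx)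
  legL z zero    = [] ∷ []
  legL z (suc j) = concatMap (λ f → map (_∷ f) (nb (hd z f))) (legL z j)

  legL-sound : ∀ {z} j {f} → f ∈ legL z j → Leg z j f
  legL-sound zero (here refl) = []
  legL-sound {z} (suc j) f∈ with decompose (legL z j) f∈
    where
    decompose : ∀ (gs : List (List Vx)) {f} → f ∈ concatMap (λ f → map (_∷ f) (nb (hd z f))) gs →
           ∃ λ g → ∃ λ v → g ∈ gs × v ∈ nb (hd z g) × f ≡ v ∷ g
    decompose gs f∈ with find (∈-concatMap⁻ (λ f → map (_∷ f) (nb (hd z f))) {xs = gs} f∈)
    ... | g , g∈ , q with ∈-map⁻ (_∷ g) q
    ... | v , v∈ , eq = g , v , g∈ , v∈ , eq
  ... | g , v , g∈ , v∈ , refl = v∈ ∷ legL-sound j g∈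

  Leg-length : ∀ {z j f} → Leg z j f → length f ≡ j
  Leg-length []      = refl
  Leg-length (_ ∷ l) = cong suc (Leg-length l)

  Leg-sd : ∀ {z j f} → Leg z j f → sd (hd z f) ≡ flip j (sd z)
  Leg-sd []       = refl
  Leg-sd (v∈ ∷ l) = trans (nb-sd v∈) (cong not (Leg-sd l))

  ∑-legL-suc : ∀ z j (F : List Vx → ℕ) →
               ∑ (legL z (suc j)) F ≡ ∑ (legL z j) (λ f → ∑ (nb (hd z f)) (λ v → F (v ∷ f)))
  ∑-legL-suc z j F = trans (∑-concatMap _ (legL z j) F) (∑-cong (legL z j) λ f → ∑-map (_∷ f) (nb (hd z f)) F)

  -- The leg is cut at distance `i` from its center: `g` is the part next to `z`, and the rest `f`
  -- is again a leg, with the head of `g` as its center.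
  ∑-legL-+ : ∀ z j i (F : List Vx → ℕ) →
             ∑ (legL z (j + i)) F ≡ ∑ (legL z i) (λ g → ∑ (legL (hd z g) j) (λ f → F (f ++ g)))
  ∑-legL-+ z zero    i F = ∑-cong (legL z i) λ g → sym (+-identityʳ (F g))
  ∑-legL-+ z (suc j) i F = begin
    ∑ (legL z (suc j + i)) F
      ≡⟨ ∑-legL-suc z (j + i) F ⟩
    ∑ (legL z (j + i)) (λ f → ∑ (nb (hd z f)) (λ v → F (v ∷ f)))
      ≡⟨ ∑-legL-+ z j i _ ⟩
    ∑ (legL z i) (λ g → ∑ (legL (hd z g) j) (λ f → ∑ (nb (hd z (f ++ g))) (λ v → F (v ∷ f ++ g))))
      ≡⟨ ∑-cong (legL z i) (λ g → trans
           (∑-cong (legL (hd z g) j) λ f → cong (λ u → ∑ (nb u) (λ v → F (v ∷ f ++ g))) (hd-++ z f g))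
           (sym (∑-legL-suc (hd z g) j _))) ⟩
    ∑ (legL z i) (λ g → ∑ (legL (hd z g) (suc j)) (λ f → F (f ++ g))) ∎
    where open ≡-Reasoning

  Star : ℕ → Set
  Star s = Vx × Vec (List Vx) s

  legT : ∀ {s} → Vx → Vec ℕ s → List (Vec (List Vx) s)
  legT y []       = [] ∷ []
  legT y (i ∷ is) = concatMap (λ a → map (a ∷_) (legT y is)) (legL y i)

  ∑-legT-∷ : ∀ {s} y i (is : Vec ℕ s) (F : Vec (List Vx) (suc s) → ℕ) →
             ∑ (legT y (i ∷ is)) F ≡ ∑ (legL y i) (λ a → ∑ (legT y is) (λ as → F (a ∷ as)))
  ∑-legT-∷ y i is F = trans (∑-concatMap _ (legL y i) F) (∑-cong (legL y i) λ a → ∑-map (a ∷_) (legT y is) F)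

  starL : ∀ {s} → Bool → Vec ℕ s → List (Star s)
  starL b is = concatMap (λ y → map (y ,_) (legT y is)) (sideL b)

  ∑-starL : ∀ {s} b (is : Vec ℕ s) (F : Star s → ℕ) →
            ∑ (starL b is) F ≡ ∑ (sideL b) (λ y → ∑ (legT y is) (λ ls → F (y , ls)))
  ∑-starL b is F = trans (∑-concatMap _ (sideL b) F) (∑-cong (sideL b) λ y → ∑-map (y ,_) (legT y is) F)

  IsStar : ∀ {s} → Vec ℕ s → Star s → Set
  IsStar is (y , ls) = ∀ l → Leg y (lookup is l) (lookup ls l)

  legT-sound : ∀ {s y} (is : Vec ℕ s) {ls} → ls ∈ legT y is → IsStar is (y , ls)
  legT-sound {y = y} (i ∷ is) ls∈ with find (∈-concatMap⁻ (λ a → map (a ∷_) (legT y is)) {xs = legL y i} ls∈)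
  ... | a , a∈ , q with ∈-map⁻ (a ∷_) q
  ... | as , as∈ , refl = λ { zero → legL-sound i a∈ ; (suc l) → legT-sound is as∈ l }

  starL-sound : ∀ {s} b (is : Vec ℕ s) {σ} → σ ∈ starL b is → sd (proj₁ σ) ≡ b × IsStar is σ
  starL-sound b is σ∈ with find (∈-concatMap⁻ (λ y → map (y ,_) (legT y is)) {xs = sideL b} σ∈)
  ... | y , y∈ , q with ∈-map⁻ (y ,_) q
  ... | ls , ls∈ , refl = ∈sideL⇒sd b y∈ , legT-sound is ls∈

  heads : ∀ {s} → Star s → Vec Vx s
  heads (y , ls) = Vec.map (hd y) ls

  ext : ∀ {s} → Fin s → List Vx → Star s → Star s
  ext l f (y , ls) = y , updateAt ls l (f ++_)

  at : ∀ {s} → Star s → Fin s → Vx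
  at (y , ls) l = hd y (lookup ls l)

  ∑-legT-split : ∀ {s} y (is : Vec ℕ s) l j (F : Vec (List Vx) s → ℕ) →
    ∑ (legT y (updateAt is l (j +_))) F ≡
    ∑ (legT y is) (λ ls → ∑ (legL (hd y (lookup ls l)) j) (λ f → F (updateAt ls l (f ++_))))
  ∑-legT-split y (i ∷ is) zero j F = begin
    ∑ (legT y ((j + i) ∷ is)) F
      ≡⟨ ∑-legT-∷ y (j + i) is F ⟩
    ∑ (legL y (j + i)) (λ a → ∑ (legT y is) (λ as → F (a ∷ as)))
      ≡⟨ ∑-legL-+ y j i _ ⟩
    ∑ (legL y i) (λ g → ∑ (legL (hd y g) j) (λ f → ∑ (legT y is) (λ as → F ((f ++ g) ∷ as))))
      ≡⟨ ∑-cong (legL y i) (λ g → ∑-swap (legL (hd y g) j) (legT y is) _) ⟩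
    ∑ (legL y i) (λ g → ∑ (legT y is) (λ as → ∑ (legL (hd y g) j) (λ f → F ((f ++ g) ∷ as))))
      ≡⟨ sym (∑-legT-∷ y i is _) ⟩
    _ ∎
    where open ≡-Reasoning
  ∑-legT-split y (i ∷ is) (suc l) j F = begin
    ∑ (legT y (i ∷ updateAt is l (j +_))) F
      ≡⟨ ∑-legT-∷ y i (updateAt is l (j +_)) F ⟩
    ∑ (legL y i) (λ a → ∑ (legT y (updateAt is l (j +_))) (λ as → F (a ∷ as)))
      ≡⟨ ∑-cong (legL y i) (λ a → ∑-legT-split y is l j _) ⟩
    ∑ (legL y i) (λ a → ∑ (legT y is) (λ as → ∑ (legL (hd y (lookup as l)) j) (λ f → F (a ∷ updateAt as l (f ++_)))))
      ≡⟨ sym (∑-legT-∷ y i is _) ⟩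
    _ ∎
    where open ≡-Reasoning

  -- The tool that reduces counts to shorter shapes: a star is its truncation together with the `j`
  -- outermost vertices of leg `l`.
  ∑-split : ∀ {s} b (is : Vec ℕ s) l j (F : Star s → ℕ) →
    ∑ (starL b (updateAt is l (j +_))) F ≡
    ∑ (starL b is) (λ σ → ∑ (legL (at σ l) j) (λ f → F (ext l f σ)))
  ∑-split b is l j F = begin
    ∑ (starL b (updateAt is l (j +_))) F
      ≡⟨ ∑-starL b (updateAt is l (j +_)) F ⟩
    ∑ (sideL b) (λ y → ∑ (legT y (updateAt is l (j +_))) (λ ls → F (y , ls)))
      ≡⟨ ∑-cong (sideL b) (λ y → ∑-legT-split y is l j _) ⟩
    ∑ (sideL b) (λ y → ∑ (legT y is) (λ ls → ∑ (legL (hd y (lookup ls l)) j) (λ f → F (y , updateAt ls l (f ++_)))))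
      ≡⟨ sym (∑-starL b is _) ⟩
    _ ∎
    where open ≡-Reasoning

  _≟ᵛ_ : ∀ {s} → DecidableEquality (Vec Vx s)
  _≟ᵛ_ = Vec.≡-dec _≟_

  #roots : ∀ {s} → Bool → Vec ℕ s → Vec Vx s → ℕ
  #roots b is v̄ = ∑ (starL b is) (λ σ → ⟦ does (heads σ ≟ᵛ v̄) ⟧)

  #walks : ℕ → Vx → Vx → ℕ
  #walks j z x = ∑ (legL z j) (λ f → ⟦ does (hd z f ≟ x) ⟧)

  -- Degree products as budgets for walks and stars.

  module Degrees (D : Bool → ℕ) (deg≤ : ∀ u → length (nb u) ≤ D (sd u)) where

    -- The number of walks of length `i` from side `b` if all degrees were equal to `D`. Densities
    -- are measured against these products instead of the true counts, because the products multiply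
    -- exactly when legs are cut.
    P : Bool → ℕ → ℕ
    P b zero    = 1
    P b (suc i) = P b i * D (flip i b)

    P-+ : ∀ b j i → P b (j + i) ≡ P b i * P (flip i b) j
    P-+ b zero    i = sym (*-identityʳ _)
    P-+ b (suc j) i = trans (cong₂ _*_ (P-+ b j i) (cong D (flip-+ j i b))) (*-assoc (P b i) _ _)

    Pr : ∀ {s} → Bool → Vec ℕ s → ℕ
    Pr b []       = 1
    Pr b (i ∷ is) = P b i * Pr b is

    Pr-split : ∀ {s} b (is : Vec ℕ s) l j →
               Pr b (updateAt is l (j +_)) ≡ Pr b is * P (flip (lookup is l) b) j
    Pr-split b (i ∷ is) zero    j = trans (cong (_* Pr b is) (P-+ b j i)) (lem (P b i) _ _)
      where
      lem : ∀ x y z → x * y * z ≡ x * z * y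
      lem = solve-∀
    Pr-split b (i ∷ is) (suc l) j = trans (cong (P b i *_) (Pr-split b is l j)) (sym (*-assoc (P b i) _ _))

    legL-length : ∀ z j → length (legL z j) ≤ P (sd z) j
    legL-length z zero    = ≤-refl
    legL-length z (suc j) = begin
      length (legL z (suc j))              ≡⟨ sym (∑1 (legL z (suc j))) ⟩
      ∑ (legL z (suc j)) (λ _ → 1)          ≡⟨ ∑-legL-suc z j _ ⟩
      ∑ (legL z j) (λ f → ∑ (nb (hd z f)) (λ _ → 1))
        ≤⟨ ∑-bound (legL z j) (D (flip j (sd z))) (λ f f∈ → ≤-trans (≤-reflexive (∑1 (nb (hd z f))))
             (≤-trans (deg≤ (hd z f)) (≤-reflexive (cong D (Leg-sd (legL-sound j f∈)))))) ⟩
      length (legL z j) * D (flip j (sd z)) ≤⟨ *-monoˡ-≤ (D (flip j (sd z))) (legL-length z j) ⟩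
      P (sd z) (suc j) ∎
      where open ≤-Reasoning

    legT-length : ∀ {s} y (is : Vec ℕ s) → length (legT y is) ≤ Pr (sd y) is
    legT-length y []       = ≤-refl
    legT-length y (i ∷ is) = begin
      length (legT y (i ∷ is))          ≡⟨ sym (∑1 (legT y (i ∷ is))) ⟩
      ∑ (legT y (i ∷ is)) (λ _ → 1)     ≡⟨ ∑-legT-∷ y i is _ ⟩
      ∑ (legL y i) (λ _ → ∑ (legT y is) (λ _ → 1))
        ≤⟨ ∑-bound (legL y i) (Pr (sd y) is) (λ a _ → ≤-trans (≤-reflexive (∑1 (legT y is))) (legT-length y is)) ⟩
      length (legL y i) * Pr (sd y) is  ≤⟨ *-monoˡ-≤ (Pr (sd y) is) (legL-length y i) ⟩
      Pr (sd y) (i ∷ is) ∎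
      where open ≤-Reasoning

    total : ∀ {s} → Bool → Vec ℕ s → ℕ
    total b is = sz b * Pr b is

    ∑-center : ∀ {s} b (is : Vec ℕ s) (h : Vx → ℕ) →
               ∑ (starL b is) (λ σ → h (proj₁ σ)) ≤ ∑ (sideL b) h * Pr b is
    ∑-center b is h = begin
      ∑ (starL b is) (λ σ → h (proj₁ σ)) ≡⟨ ∑-starL b is _ ⟩
      ∑ (sideL b) (λ y → ∑ (legT y is) (λ _ → h y))
        ≤⟨ ∑-mono∈ (sideL b) (λ y y∈ → ≤-trans (≤-reflexive (trans (∑-const (legT y is) (h y)) (*-comm _ (h y))))
             (*-monoʳ-≤ (h y) (≤-trans (legT-length y is) (≤-reflexive (cong (λ c → Pr c is) (∈sideL⇒sd b y∈)))))) ⟩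
      ∑ (sideL b) (λ y → h y * Pr b is)  ≡⟨ ∑-*ʳ (sideL b) (Pr b is) h ⟩
      ∑ (sideL b) h * Pr b is ∎
      where open ≤-Reasoning

    starL-length : ∀ {s} b (is : Vec ℕ s) → length (starL b is) ≤ total b is
    starL-length b is = begin
      length (starL b is)          ≡⟨ sym (∑1 (starL b is)) ⟩
      ∑ (starL b is) (λ _ → 1)     ≤⟨ ∑-center b is (λ _ → 1) ⟩
      ∑ (sideL b) (λ _ → 1) * Pr b is ≡⟨ cong (_* Pr b is) (∑1 (sideL b)) ⟩
      total b is ∎
      where open ≤-Reasoning

    -- The degree product of the same walk read from its far end: a bound for the legs of length
    -- `i`, with center on side `b`, that end in a given vertex.
    R : Bool → ℕ → ℕ
    R b zero    = 1
    R b (suc i) = R b i * D (flip (suc i) b)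

    P-R : ∀ b i → P b (suc i) ≡ D b * R b i
    P-R b zero    = *-comm 1 (D b)
    P-R b (suc i) = trans (cong (_* D (flip (suc i) b)) (P-R b i)) (*-assoc (D b) _ _)

    -- Counting the legs by their far end instead of by their center.
    ∑-reverse : ∀ b i (φ : Vx → ℕ) →
                ∑ (sideL b) (λ y → ∑ (legL y i) (λ g → φ (hd y g))) ≤ R b i * ∑ (sideL (flip i b)) φ
    ∑-reverse b zero φ = ≤-reflexive (trans (∑-cong (sideL b) λ y → +-identityʳ (φ y)) (sym (+-identityʳ _)))
    ∑-reverse b (suc i) φ = begin
      ∑ (sideL b) (λ y → ∑ (legL y (suc i)) (λ g → φ (hd y g)))
        ≡⟨ ∑-cong (sideL b) (λ y → ∑-legL-suc y i _) ⟩
      ∑ (sideL b) (λ y → ∑ (legL y i) (λ g → ∑ (nb (hd y g)) φ))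
        ≤⟨ ∑-reverse b i (λ u → ∑ (nb u) φ) ⟩
      R b i * ∑ (sideL (flip i b)) (λ u → ∑ (nb u) φ)
        ≡⟨ cong (R b i *_) (nb-swap (flip i b) (λ _ v → φ v)) ⟩
      R b i * ∑ (sideL (flip (suc i) b)) (λ v → ∑ (nb v) (λ _ → φ v))
        ≤⟨ *-monoʳ-≤ (R b i) (∑-mono∈ (sideL (flip (suc i) b)) λ v v∈ → ≤-trans (≤-reflexive (∑-const (nb v) (φ v)))
             (*-monoˡ-≤ (φ v) (≤-trans (deg≤ v) (≤-reflexive (cong D (∈sideL⇒sd (flip (suc i) b) v∈)))))) ⟩
      R b i * ∑ (sideL (flip (suc i) b)) (λ v → D (flip (suc i) b) * φ v)
        ≡⟨ cong (R b i *_) (∑-*ˡ (sideL (flip (suc i) b)) (D (flip (suc i) b)) φ) ⟩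
      R b i * (D (flip (suc i) b) * ∑ (sideL (flip (suc i) b)) φ)
        ≡⟨ sym (*-assoc (R b i) _ _) ⟩
      R b (suc i) * ∑ (sideL (flip (suc i) b)) φ ∎
      where open ≤-Reasoning

-- Counting the rich and the degenerate configurations.

∑-any : {A : Set} (p : A → Bool) (xs : List A) → ⟦ any p xs ⟧ ≤ ∑ xs (⟦_⟧ ∘ p)
∑-any p []       = z≤n
∑-any p (x ∷ xs) with p x
... | true  = s≤s z≤n
... | false = ∑-any p xs

any-false : {A : Set} (p : A → Bool) (xs : List A) → any p xs ≡ false → ∀ {x} → x ∈ xs → p x ≡ false
any-false p (y ∷ xs) e (here refl) with p y
... | false = refl
any-false p (y ∷ xs) e (there x∈) with p y
... | false = any-false p xs e x∈

∨-false : ∀ {p q} → p ∨ q ≡ false → p ≡ false × q ≡ false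
∨-false {false} {false} _ = refl , refl

⟦∨⟧≤ : ∀ p q → ⟦ p ∨ q ⟧ ≤ ⟦ p ⟧ + ⟦ q ⟧
⟦∨⟧≤ true  q = s≤s z≤n
⟦∨⟧≤ false q = ≤-refl

drop-++ : {A : Set} (f g : List A) → drop (length f) (f ++ g) ≡ g
drop-++ []      g = refl
drop-++ (x ∷ f) g = drop-++ f g

updateAt-∸+ : ∀ {s} (is : Vec ℕ s) l j → j ≤ lookup is l → updateAt (updateAt is l (_∸ j)) l (j +_) ≡ is
updateAt-∸+ is l j j≤ = trans (Vec.updateAt-updateAt l is) (Vec.updateAt-id-local l is (m+[n∸m]≡n j≤))

-- Absorbs an error factor `k` into a constant prepared for it: the constants of the form
-- `e * suc k` below are chosen for this step. The successor keeps the cancelled factor positive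
-- when `k` is 0.
dilute : ∀ e k t T → (e * suc k) * t ≤ k * T → e * t ≤ T
dilute e k t T h = *-cancelˡ-≤ (suc k) (begin
  suc k * (e * t)   ≡⟨ lem e (suc k) t ⟩
  (e * suc k) * t   ≤⟨ h ⟩
  k * T             ≤⟨ *-monoˡ-≤ T (n≤1+n k) ⟩
  suc k * T         ∎)
  where
  open ≤-Reasoning
  lem : ∀ e k t → k * (e * t) ≡ (e * k) * t
  lem = solve-∀

module GraphCounts {m n : ℕ} (G : BipGraph m n) where
  open Graph G

  -- Legs begin with the root, so `drop j` removes the `j` outermost vertices and leaves the part at
  -- the center.
  cut : ∀ {s} → Fin s → ℕ → Star s → Star s
  cut l j (y , ls) = y , updateAt ls l (drop j)

  at-ext : ∀ {s} l f (σ : Star s) → at (ext l f σ) l ≡ hd (at σ l) f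
  at-ext l f (y , ls) = trans (cong (hd y) (Vec.lookup∘updateAt l ls)) (hd-++ y f (lookup ls l))

  cut-ext : ∀ {s} l j {f} (σ : Star s) → length f ≡ j → cut l j (ext l f σ) ≡ σ
  cut-ext l j {f} (y , ls) refl = cong (y ,_)
    (trans (Vec.updateAt-updateAt l ls) (Vec.updateAt-id-local l ls (drop-++ f (lookup ls l))))

  at-heads : ∀ {s} (σ : Star s) l → lookup (heads σ) l ≡ at σ l
  at-heads (y , ls) l = Vec.lookup-map l (hd y) ls

  heads-ext : ∀ {s} l f (σ : Star s) → heads (ext l f σ) ≡ heads σ [ l ]≔ hd (at σ l) f
  heads-ext l f (y , ls) = go ls l
    where
    go : ∀ {s} (ls : Vec (List Vx) s) l →
         Vec.map (hd y) (updateAt ls l (f ++_)) ≡ Vec.map (hd y) ls [ l ]≔ hd (hd y (lookup ls l)) f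
    go (a ∷ ls) zero    = cong (_∷ Vec.map (hd y) ls) (hd-++ y f a)
    go (a ∷ ls) (suc l) = cong (hd y a ∷_) (go ls l)

  ∑-Unique : {xs : List Vx} → Unique xs → ∀ x → ∑ xs (λ v → ⟦ does (v ≟ x) ⟧) ≤ 1
  ∑-Unique AllPairs.[] x = z≤n
  ∑-Unique {v ∷ xs} (v∉ AllPairs.∷ u) x with v ≟ x
  ... | no _     = ∑-Unique u x
  ... | yes refl = ≤-reflexive (cong suc (trans (∑-cong∈ xs λ w w∈ → cong ⟦_⟧ (false-does (w ≟ v) (λ e → All.lookup v∉ w∈ (sym e))))
                     (∑-zero xs)))

  sideL-Unique : ∀ b → Unique (sideL b)
  sideL-Unique true  = Uniq.map⁺ Sum.inj₁-injective (Uniq.allFin⁺ m)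
  sideL-Unique false = Uniq.map⁺ Sum.inj₂-injective (Uniq.allFin⁺ n)

  ∑-sideL≟ : ∀ b x → ∑ (sideL b) (λ v → ⟦ does (v ≟ x) ⟧) ≤ 1
  ∑-sideL≟ b = ∑-Unique (sideL-Unique b)

  ∑-nb≟ : ∀ u x → ∑ (nb u) (λ v → ⟦ does (v ≟ x) ⟧) ≤ 1
  ∑-nb≟ u x = ≤-trans (≤-reflexive (∑-filterᵇ _ (sideL (not (sd u))) _))
    (≤-trans (∑-mono (sideL (not (sd u))) λ v → ≤-trans (*-monoˡ-≤ _ (⟦⟧≤1 (adj v u))) (≤-reflexive (+-identityʳ _)))
             (∑-sideL≟ (not (sd u)) x))

  _∈ᵇ_ : Vx → List Vx → Bool
  v ∈ᵇ X = any (λ x → does (v ≟ x)) X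

  ∈ᵇ-false : ∀ {v} X → v ∈ᵇ X ≡ false → v ∉ X
  ∈ᵇ-false {v} X e v∈ = does-false (v ≟ v) (any-false _ X e v∈) refl

  ∑-nb∈ : ∀ u X → ∑ (nb u) (λ v → ⟦ v ∈ᵇ X ⟧) ≤ length X
  ∑-nb∈ u X = begin
    ∑ (nb u) (λ v → ⟦ v ∈ᵇ X ⟧)                        ≤⟨ ∑-mono (nb u) (λ v → ∑-any _ X) ⟩
    ∑ (nb u) (λ v → ∑ X (λ x → ⟦ does (v ≟ x) ⟧))      ≡⟨ ∑-swap (nb u) X _ ⟩
    ∑ X (λ x → ∑ (nb u) (λ v → ⟦ does (v ≟ x) ⟧))      ≤⟨ ∑-bound X 1 (λ x _ → ∑-nb≟ u x) ⟩
    length X * 1                                       ≡⟨ *-identityʳ _ ⟩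
    length X ∎
    where open ≤-Reasoning

  fresh : List Vx → List Vx → Bool
  fresh Y []      = true
  fresh Y (v ∷ f) = fresh Y f ∧ not (v ∈ᵇ (f ++ Y))

  vertices : ∀ {s} → Vx → Vec (List Vx) s → List Vx
  vertices y []       = y ∷ []
  vertices y (a ∷ as) = a ++ vertices y as

  distinct : ∀ {s} → Star s → Bool
  distinct (y , [])     = true
  distinct (y , a ∷ as) = distinct (y , as) ∧ fresh (vertices y as) a

  fresh-Unique : ∀ {Y} f → Unique Y → fresh Y f ≡ true → Unique (f ++ Y)
  fresh-Unique []          u e = u
  fresh-Unique {Y} (v ∷ f) u e =
    let p , q = ∧-true e in
    All.tabulate (λ w∈ eq → ∈ᵇ-false (f ++ Y) (not-true q) (subst (_∈ f ++ Y) (sym eq) w∈)) AllPairs.∷ fresh-Unique f u p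

  distinct-Unique : ∀ {s} y (ls : Vec (List Vx) s) → distinct (y , ls) ≡ true → Unique (vertices y ls)
  distinct-Unique y []       e = [] AllPairs.∷ AllPairs.[]
  distinct-Unique y (a ∷ as) e = let p , q = ∧-true e in fresh-Unique a (distinct-Unique y as p) q

  vertices-length : ∀ {s} y (is : Vec ℕ s) (ls : Vec (List Vx) s) → IsStar is (y , ls) →
                    length (vertices y ls) ≡ suc (Vec.sum is)
  vertices-length y []       []       st = refl
  vertices-length y (i ∷ is) (a ∷ as) st =
    trans (length-++ a) (trans (cong₂ _+_ (Leg-length (st zero)) (vertices-length y is as (st ∘ suc))) (+-suc i (Vec.sum is)))

  module Counts (D : Bool → ℕ) (deg≤ : ∀ u → length (nb u) ≤ D (sd u)) where
    open Degrees D deg≤ public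

    legRich : Bool → ℕ → ℕ → ℕ
    legRich b j c = ∑ (sideL b) (λ z → ∑ (legL z j) (λ f → ⟦ does (c ≤? #walks j z (hd z f)) ⟧))

    starRich : ∀ {s} → Bool → Vec ℕ s → ℕ → ℕ
    starRich b is c = ∑ (starL b is) (λ σ → ⟦ does (c ≤? #roots b is (heads σ)) ⟧)

    -- Rich walks have share at most 1 / E of the budget, with the division cleared; every density
    -- below is encoded in this way.
    LegSparse : ℕ → ℕ → Bool → ℕ → Set
    LegSparse E c b j = E * legRich b j c ≤ sz b * P b j

    StarSparse : ∀ {s} → ℕ → ℕ → Bool → Vec ℕ s → Set
    StarSparse E c b is = E * starRich b is c ≤ total b is

    -- The two ways in which a star can have a rich part: here the outer `j` edges of a leg, in
    -- `cutEvent` what remains of the star without them.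
    legEvent : ∀ {s} → ℕ → Fin s → ℕ → Star s → Bool
    legEvent c l j σ = does (c ≤? #walks j (at (cut l j σ) l) (at σ l))

    cutEvent : ∀ {s} → ℕ → Bool → Vec ℕ s → Fin s → ℕ → Star s → Bool
    cutEvent c b is l j σ = does (c ≤? #roots b is (heads (cut l j σ)))

    -- A truncated star is extended in at most `Pj` ways, whichever star it is, so the share of rich
    -- truncations does not grow on passing to the longer shape.
    cutEvent-count : ∀ {s} E c b (is : Vec ℕ s) l j → StarSparse E c b is →
      E * ∑ (starL b (updateAt is l (j +_))) (λ σ → ⟦ cutEvent c b is l j σ ⟧) ≤ total b (updateAt is l (j +_))
    cutEvent-count E c b is l j sp = begin
      E * ∑ (starL b (updateAt is l (j +_))) (λ σ → ⟦ cutEvent c b is l j σ ⟧)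
        ≡⟨ cong (E *_) (∑-split b is l j _) ⟩
      E * ∑ (starL b is) (λ σ → ∑ (legL (at σ l) j) (λ f → ⟦ cutEvent c b is l j (ext l f σ) ⟧))
        ≤⟨ *-monoʳ-≤ E (∑-mono∈ (starL b is) λ σ σ∈ → step σ (starL-sound b is σ∈)) ⟩
      E * ∑ (starL b is) (λ σ → Pj * ⟦ does (c ≤? #roots b is (heads σ)) ⟧)
        ≡⟨ cong (E *_) (∑-*ˡ (starL b is) Pj _) ⟩
      E * (Pj * starRich b is c)       ≡⟨ lem E Pj _ ⟩
      E * starRich b is c * Pj         ≤⟨ *-monoˡ-≤ Pj sp ⟩
      sz b * Pr b is * Pj              ≡⟨ *-assoc (sz b) _ _ ⟩
      sz b * (Pr b is * Pj)            ≡⟨ cong (sz b *_) (sym (Pr-split b is l j)) ⟩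
      total b (updateAt is l (j +_)) ∎
      where
      open ≤-Reasoning
      Pj = P (flip (lookup is l) b) j
      lem : ∀ a b c → a * (b * c) ≡ a * c * b
      lem = solve-∀
      step : ∀ σ → sd (proj₁ σ) ≡ b × IsStar is σ →
             ∑ (legL (at σ l) j) (λ f → ⟦ cutEvent c b is l j (ext l f σ) ⟧) ≤ Pj * ⟦ does (c ≤? #roots b is (heads σ)) ⟧
      step σ (e , st) = ≤-trans
        (∑-bound (legL (at σ l) j) _ λ f f∈ →
          ≤-reflexive (cong (λ τ → ⟦ does (c ≤? #roots b is (heads τ)) ⟧) (cut-ext l j σ (Leg-length (legL-sound j f∈)))))
        (*-monoˡ-≤ _ (≤-trans (legL-length (at σ l) j) (≤-reflexive (cong (λ d → P d j) (trans (Leg-sd (st l)) (cong (flip (lookup is l)) e))))))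

    module _ (μ : ℕ) (D>0 : ∀ b → 0 < D b) (handshake : ∀ b b′ → sz b′ * D b′ ≤ μ * (sz b * D b)) where

      -- Both sides are budgets for the walks of length `i`, from the far ends and from the centers;
      -- `handshake` makes them agree up to `μ`.
      sz-R : ∀ b i → sz (flip i b) * R b i ≤ μ * (sz b * P b i)
      sz-R b i = *-cancelˡ-≤ (D b) ⦃ >-nonZero (D>0 b) ⦄ (begin
        D b * (sz (flip i b) * R b i)              ≡⟨ x∙yz≈y∙xz (D b) (sz (flip i b)) (R b i) ⟩
        sz (flip i b) * (D b * R b i)              ≡⟨ cong (sz (flip i b) *_) (sym (P-R b i)) ⟩
        sz (flip i b) * (P b i * D (flip i b))     ≡⟨ x∙yz≈y∙xz (sz (flip i b)) (P b i) (D (flip i b)) ⟩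
        P b i * (sz (flip i b) * D (flip i b))     ≤⟨ *-monoʳ-≤ (P b i) (handshake b (flip i b)) ⟩
        P b i * (μ * (sz b * D b))                 ≡⟨ lem₃ (P b i) μ (sz b) (D b) ⟩
        D b * (μ * (sz b * P b i))                 ∎)
        where
        open ≤-Reasoning
        lem₃ : ∀ a b c d → a * (b * (c * d)) ≡ d * (b * (c * a))
        lem₃ = solve-∀

      -- The rich segment begins at distance `i` from the center. Read backwards from there, a
      -- beginning is reached by at most `R b i` inner parts, and the remaining legs contribute
      -- their budget; so only the count of rich walks remains.
      legEvent-count : ∀ {s} E c b (is : Vec ℕ s) l j → (∀ b′ → LegSparse E c b′ j) →
        E * ∑ (starL b (updateAt is l (j +_))) (λ σ → ⟦ legEvent c l j σ ⟧) ≤ μ * total b (updateAt is l (j +_))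
      legEvent-count E c b is l j sp = begin
        E * ∑ (starL b (updateAt is l (j +_))) (λ σ → ⟦ legEvent c l j σ ⟧)
          ≡⟨ cong (E *_) (trans (∑-split b is l j _) (∑-cong (starL b is) λ σ → ∑-cong∈ (legL (at σ l) j) λ f f∈ →
               cong₂ (λ τ x → ⟦ does (c ≤? #walks j (at τ l) x) ⟧) (cut-ext l j σ (Leg-length (legL-sound j f∈))) (at-ext l f σ))) ⟩
        E * ∑ (starL b is) (λ σ → φ (at σ l))
          ≡⟨ cong (λ is → E * ∑ (starL b is) (λ σ → φ (at σ l))) (sym is≡) ⟩
        E * ∑ (starL b (updateAt is₀ l (i +_))) (λ σ → φ (at σ l))
          ≡⟨ cong (E *_) (∑-split b is₀ l i _) ⟩
        E * ∑ (starL b is₀) (λ σ → ∑ (legL (at σ l) i) (λ g → φ (at (ext l g σ) l)))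
          ≡⟨ cong (E *_) (∑-cong∈ (starL b is₀) λ σ σ∈ →
               trans (∑-cong (legL (at σ l) i) λ g → cong φ (at-ext l g σ))
                     (cong h (at₀ σ (proj₂ (starL-sound b is₀ σ∈))))) ⟩
        E * ∑ (starL b is₀) (λ σ → h (proj₁ σ))
          ≤⟨ *-monoʳ-≤ E (∑-center b is₀ h) ⟩
        E * (∑ (sideL b) h * Pr b is₀)
          ≤⟨ *-monoʳ-≤ E (*-monoˡ-≤ (Pr b is₀) (∑-reverse b i φ)) ⟩
        E * (R b i * legRich b′ j c * Pr b is₀)    ≡⟨ lem₁ E (R b i) (legRich b′ j c) (Pr b is₀) ⟩
        E * legRich b′ j c * (R b i * Pr b is₀)    ≤⟨ *-monoˡ-≤ (R b i * Pr b is₀) (sp b′) ⟩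
        sz b′ * P b′ j * (R b i * Pr b is₀)        ≡⟨ lem₂ (sz b′) (P b′ j) (R b i) (Pr b is₀) ⟩
        sz b′ * R b i * (Pr b is₀ * P b′ j)        ≤⟨ *-monoˡ-≤ (Pr b is₀ * P b′ j) (sz-R b i) ⟩
        μ * (sz b * P b i) * (Pr b is₀ * P b′ j)   ≡⟨ lem₃ μ (sz b) (P b i) (Pr b is₀) (P b′ j) ⟩
        μ * (sz b * (Pr b is₀ * P b i * P b′ j))
          ≡⟨ cong (λ x → μ * (sz b * x)) (trans (cong (_* P b′ j) (trans (cong (λ z → Pr b is₀ * P (flip z b) i) (sym l₀)) (trans (sym (Pr-split b is₀ l i)) (cong (Pr b) is≡)))) (sym (Pr-split b is l j))) ⟩
        μ * total b (updateAt is l (j +_)) ∎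
        where
        open ≤-Reasoning
        i = lookup is l
        b′ = flip i b
        -- With leg `l` emptied its inner part becomes a separate sum over walks from the center,
        -- which `∑-reverse` can turn around.
        is₀ = updateAt is l (λ _ → 0)
        φ : Vx → ℕ
        φ z = ∑ (legL z j) (λ f → ⟦ does (c ≤? #walks j z (hd z f)) ⟧)
        h : Vx → ℕ
        h y = ∑ (legL y i) (λ g → φ (hd y g))
        l₀ : lookup is₀ l ≡ 0
        l₀ = Vec.lookup∘updateAt l is
        is≡ : updateAt is₀ l (i +_) ≡ is
        is≡ = trans (Vec.updateAt-updateAt l is) (Vec.updateAt-id-local l is (+-identityʳ i))
        at₀ : ∀ σ → IsStar is₀ σ → at σ l ≡ proj₁ σ
        at₀ (y , ls) st with lookup ls l | Leg-length (st l)
        ... | []    | _ = refl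
        ... | _ ∷ _ | e with trans e l₀
        ... | ()
        lem₁ : ∀ a b c d → a * (b * c * d) ≡ a * c * (b * d)
        lem₁ = solve-∀
        lem₂ : ∀ a b c d → a * b * (c * d) ≡ a * c * (d * b)
        lem₂ = solve-∀
        lem₃ : ∀ a b c d e → a * (b * c) * (d * e) ≡ a * (b * (d * c * e))
        lem₃ = solve-∀

    -- Bounds the coincidences possible in a star with `N` edges: each of the `N` vertices besides
    -- the center against at most `N + 1` others.
    spread : ℕ → ℕ
    spread N = N * suc N

    module _ (Q : ℕ) (Q≤D : ∀ b → Q ≤ D b) where

      -- In each of the `j` steps at most `j + length Y` neighbours are already taken, out of a
      -- budget of at least `Q`.
      stale-count : ∀ Y z j → Q * ∑ (legL z j) (λ f → ⟦ not (fresh Y f) ⟧) ≤ j * (j + length Y) * P (sd z) j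
      stale-count Y z zero    = ≤-reflexive (*-zeroʳ Q)
      stale-count Y z (suc j) = begin
        Q * ∑ (legL z (suc j)) (λ f → ⟦ not (fresh Y f) ⟧)
          ≡⟨ cong (Q *_) (∑-legL-suc z j _) ⟩
        Q * ∑ (legL z j) (λ f → ∑ (nb (hd z f)) (λ v → ⟦ not (fresh Y f ∧ not (v ∈ᵇ (f ++ Y))) ⟧))
          ≤⟨ *-monoʳ-≤ Q (∑-mono∈ (legL z j) λ f f∈ → one f (legL-sound j f∈)) ⟩
        Q * ∑ (legL z j) (λ f → ⟦ not (fresh Y f) ⟧ * d + (j + length Y))
          ≡⟨ cong (Q *_) (trans (∑-+ (legL z j) _ _) (cong₂ _+_ (∑-*ʳ (legL z j) d _) (∑-const (legL z j) _))) ⟩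
        Q * (∑ (legL z j) (λ f → ⟦ not (fresh Y f) ⟧) * d + length (legL z j) * (j + length Y))
          ≡⟨ lem₁ Q _ d (length (legL z j)) (j + length Y) ⟩
        Q * ∑ (legL z j) (λ f → ⟦ not (fresh Y f) ⟧) * d + length (legL z j) * Q * (j + length Y)
          ≤⟨ +-mono-≤ (*-monoˡ-≤ d (stale-count Y z j))
               (*-monoˡ-≤ (j + length Y) (*-mono-≤ (legL-length z j) (Q≤D (flip j (sd z))))) ⟩
        j * (j + length Y) * P (sd z) j * d + P (sd z) j * d * (j + length Y)
          ≡⟨ lem₂ j (j + length Y) (P (sd z) j) d ⟩
        suc j * (j + length Y) * (P (sd z) j * d)
          ≤⟨ *-monoˡ-≤ (P (sd z) j * d) (*-monoʳ-≤ (suc j) (n≤1+n (j + length Y))) ⟩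
        suc j * (suc j + length Y) * P (sd z) (suc j) ∎
        where
        open ≤-Reasoning
        d = D (flip j (sd z))
        lem₁ : ∀ q a d c e → q * (a * d + c * e) ≡ q * a * d + c * q * e
        lem₁ = solve-∀
        lem₂ : ∀ j a p d → j * a * p * d + p * d * a ≡ (1 + j) * a * (p * d)
        lem₂ = solve-∀
        ⟦not∧⟧ : ∀ p q → ⟦ not (p ∧ not q) ⟧ ≤ ⟦ not p ⟧ + ⟦ q ⟧
        ⟦not∧⟧ true  true  = ≤-refl
        ⟦not∧⟧ true  false = ≤-refl
        ⟦not∧⟧ false q     = s≤s z≤n
        one : ∀ f → Leg z j f → ∑ (nb (hd z f)) (λ v → ⟦ not (fresh Y f ∧ not (v ∈ᵇ (f ++ Y))) ⟧)
                                ≤ ⟦ not (fresh Y f) ⟧ * d + (j + length Y)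
        one f lf = begin
          ∑ (nb (hd z f)) (λ v → ⟦ not (fresh Y f ∧ not (v ∈ᵇ (f ++ Y))) ⟧)
            ≤⟨ ∑-mono (nb (hd z f)) (λ v → ⟦not∧⟧ (fresh Y f) (v ∈ᵇ (f ++ Y))) ⟩
          ∑ (nb (hd z f)) (λ v → ⟦ not (fresh Y f) ⟧ + ⟦ v ∈ᵇ (f ++ Y) ⟧)
            ≡⟨ trans (∑-+ (nb (hd z f)) _ _) (cong (_+ ∑ (nb (hd z f)) (λ v → ⟦ v ∈ᵇ (f ++ Y) ⟧)) (trans (∑-const (nb (hd z f)) _) (*-comm _ ⟦ not (fresh Y f) ⟧))) ⟩
          ⟦ not (fresh Y f) ⟧ * length (nb (hd z f)) + ∑ (nb (hd z f)) (λ v → ⟦ v ∈ᵇ (f ++ Y) ⟧)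
            ≤⟨ +-mono-≤ (*-monoʳ-≤ ⟦ not (fresh Y f) ⟧ (≤-trans (deg≤ (hd z f)) (≤-reflexive (cong D (Leg-sd lf)))))
                 (≤-trans (∑-nb∈ (hd z f) (f ++ Y)) (≤-reflexive (trans (length-++ f) (cong (_+ length Y) (Leg-length lf))))) ⟩
          ⟦ not (fresh Y f) ⟧ * d + (j + length Y) ∎

      degenerate-legs : ∀ {s} y (is : Vec ℕ s) →
        Q * ∑ (legT y is) (λ ls → ⟦ not (distinct (y , ls)) ⟧) ≤ spread (Vec.sum is) * Pr (sd y) is
      degenerate-legs y []       = ≤-reflexive (*-zeroʳ Q)
      degenerate-legs y (i ∷ is) = begin
        Q * ∑ (legT y (i ∷ is)) (λ ls → ⟦ not (distinct (y , ls)) ⟧)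
          ≡⟨ cong (Q *_) (trans (∑-legT-∷ y i is _) (∑-swap (legL y i) (legT y is) _)) ⟩
        Q * ∑ (legT y is) (λ as → ∑ (legL y i) (λ a → ⟦ not (distinct (y , as) ∧ fresh (vertices y as) a) ⟧))
          ≤⟨ *-monoʳ-≤ Q (∑-mono (legT y is) one) ⟩
        Q * ∑ (legT y is) (λ as → ⟦ not (distinct (y , as)) ⟧ * p + ∑ (legL y i) (λ a → ⟦ not (fresh (vertices y as) a) ⟧))
          ≡⟨ trans (cong (Q *_) (∑-+ (legT y is) _ _)) (trans (*-distribˡ-+ Q _ _)
               (cong₂ _+_ (cong (Q *_) (∑-*ʳ (legT y is) p _)) (sym (∑-*ˡ (legT y is) Q _)))) ⟩
        Q * (∑ (legT y is) (λ as → ⟦ not (distinct (y , as)) ⟧) * p) + ∑ (legT y is) (λ as → Q * ∑ (legL y i) (λ a → ⟦ not (fresh (vertices y as) a) ⟧))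
          ≤⟨ +-mono-≤ (≤-trans (≤-reflexive (sym (*-assoc Q _ p))) (*-monoˡ-≤ p (degenerate-legs y is)))
               (∑-bound (legT y is) (i * (i + suc N) * p) λ as as∈ → ≤-trans (stale-count (vertices y as) y i)
                 (≤-reflexive (cong (λ x → i * (i + x) * p) (vertices-length y is as (legT-sound is as∈))))) ⟩
        spread N * Pr (sd y) is * p + length (legT y is) * (i * (i + suc N) * p)
          ≤⟨ +-monoʳ-≤ _ (*-monoˡ-≤ (i * (i + suc N) * p) (legT-length y is)) ⟩
        spread N * Pr (sd y) is * p + Pr (sd y) is * (i * (i + suc N) * p)
          ≡⟨ lem N i (Pr (sd y) is) p ⟩
        (N * (1 + N) + i * (1 + (i + N))) * (p * Pr (sd y) is)
          ≤⟨ *-monoˡ-≤ (p * Pr (sd y) is) (≤-trans (+-monoˡ-≤ _ (*-monoʳ-≤ N (s≤s (m≤n+m N i)))) (≤-reflexive (lem₂ N i))) ⟩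
        spread (i + N) * (p * Pr (sd y) is) ∎
        where
        open ≤-Reasoning
        N = Vec.sum is
        p = P (sd y) i
        lem : ∀ N i r p → N * (1 + N) * r * p + r * (i * (i + (1 + N)) * p) ≡ (N * (1 + N) + i * (1 + (i + N))) * (p * r)
        lem = solve-∀
        lem₂ : ∀ N i → N * (1 + (i + N)) + i * (1 + (i + N)) ≡ (i + N) * (1 + (i + N))
        lem₂ = solve-∀
        ⟦not∧⟧ : ∀ p q → ⟦ not (p ∧ q) ⟧ ≤ ⟦ not p ⟧ + ⟦ not q ⟧
        ⟦not∧⟧ true  q = ≤-refl
        ⟦not∧⟧ false q = s≤s z≤n
        one : ∀ as → ∑ (legL y i) (λ a → ⟦ not (distinct (y , as) ∧ fresh (vertices y as) a) ⟧)
              ≤ ⟦ not (distinct (y , as)) ⟧ * p + ∑ (legL y i) (λ a → ⟦ not (fresh (vertices y as) a) ⟧)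
        one as = ≤-trans (∑-mono (legL y i) λ a → ⟦not∧⟧ (distinct (y , as)) (fresh (vertices y as) a))
          (≤-trans (≤-reflexive (∑-+ (legL y i) _ _))
            (+-monoˡ-≤ _ (≤-trans (≤-reflexive (trans (∑-const (legL y i) _) (*-comm _ ⟦ not (distinct (y , as)) ⟧)))
                           (*-monoʳ-≤ ⟦ not (distinct (y , as)) ⟧ (legL-length y i)))))

      degenerate-count : ∀ {s} b (is : Vec ℕ s) →
        Q * ∑ (starL b is) (λ σ → ⟦ not (distinct σ) ⟧) ≤ spread (Vec.sum is) * total b is
      degenerate-count b is = begin
        Q * ∑ (starL b is) (λ σ → ⟦ not (distinct σ) ⟧)
          ≡⟨ trans (cong (Q *_) (∑-starL b is _)) (sym (∑-*ˡ (sideL b) Q _)) ⟩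
        ∑ (sideL b) (λ y → Q * ∑ (legT y is) (λ ls → ⟦ not (distinct (y , ls)) ⟧))
          ≤⟨ ∑-bound (sideL b) (spread (Vec.sum is) * Pr b is) (λ y y∈ →
               ≤-trans (degenerate-legs y is) (≤-reflexive (cong (λ c → spread (Vec.sum is) * Pr c is) (∈sideL⇒sd b y∈)))) ⟩
        sz b * (spread (Vec.sum is) * Pr b is)
          ≡⟨ x∙yz≈y∙xz (sz b) (spread (Vec.sum is)) (Pr b is) ⟩
        spread (Vec.sum is) * total b is ∎
        where
        open ≤-Reasoning

-- Rounds of deletion and what they cost.

positions : ∀ {s} → Vec ℕ s → List (Fin s × ℕ)
positions []       = []
positions (i ∷ is) = map (zero ,_) (upTo i) ++ map (λ (l , j) → suc l , j) (positions is)

positions-length : ∀ {s} (is : Vec ℕ s) → length (positions is) ≡ Vec.sum is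
positions-length []       = refl
positions-length (i ∷ is) = trans (length-++ (map (zero ,_) (upTo i)))
  (cong₂ _+_ (trans (length-map (zero ,_) (upTo i)) (length-upTo i)) (trans (length-map _ (positions is)) (positions-length is)))

∈-positions : ∀ {s} (is : Vec ℕ s) l {j} → j < lookup is l → (l , j) ∈ positions is
∈-positions (i ∷ is) zero    j< = ∈-++⁺ˡ (∈-map⁺ (zero ,_) (∈-upTo⁺ j<))
∈-positions (i ∷ is) (suc l) j< = ∈-++⁺ʳ (map (zero ,_) (upTo i)) (∈-map⁺ (λ (l , j) → suc l , j) (∈-positions is l j<))

positions-∈ : ∀ {s} (is : Vec ℕ s) {l j} → (l , j) ∈ positions is → j < lookup is l
positions-∈ (i ∷ is) p∈ with ∈-++⁻ (map (zero ,_) (upTo i)) p∈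
... | inj₁ q with ∈-map⁻ (zero ,_) q
...   | _ , r , refl = ∈-upTo⁻ r
positions-∈ (i ∷ is) p∈ | inj₂ q with ∈-map⁻ (λ (l , j) → suc l , j) q
...   | _ , r , refl = positions-∈ is r

∈-drop : {A : Set} (f : List A) {x : A} → x ∈ f →
         ∃ λ j → j < length f × ∃ λ g → drop j f ≡ x ∷ g
∈-drop (x ∷ f) (here refl) = 0 , s≤s z≤n , f , refl
∈-drop (y ∷ f) (there x∈)  = let j , j< , g , e = ∈-drop f x∈ in suc j , s≤s j< , g , e

⟦⟧-zero : ∀ p → ⟦ p ⟧ < 1 → p ≡ false
⟦⟧-zero false _ = refl
⟦⟧-zero true (s≤s ())

module Rounds {m n : ℕ} (G : BipGraph m n) (D : Bool → ℕ) (deg≤ : ∀ u → length (Graph.nb G u) ≤ D (Graph.sd G u))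
              {s : ℕ} (b : Bool) (is : Vec ℕ s) (c′ c a₀ b₀ : ℕ) where
  open Graph G
  open GraphCounts G
  open Counts D deg≤

  trunc : Fin s → ℕ → Vec ℕ s
  trunc l j = updateAt is l (_∸ j)

  -- Position `(l , j)` stands for removing `suc j` edges. The second alternative is restricted to
  -- cuts that leave the leg nonempty, since only shapes with positive legs are covered by the
  -- induction; a cut of the whole leg ends at the center.
  event : Star s → Fin s × ℕ → Bool
  event σ (l , j) = legEvent c′ l (suc j) σ ∨ (does (suc j <? lookup is l) ∧ cutEvent c′ b (trunc l (suc j)) l (suc j) σ)

  unclean : Star s → Bool
  unclean σ = any (event σ) (positions is)

  good : Star s → Bool
  good σ = does (c ≤? #roots b is (heads σ)) ∧ (distinct σ ∧ not (unclean σ))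

  repl : Fin s → Vx → Star s → Star s
  repl l v (y , ls) = y , updateAt ls l (λ a → v ∷ drop 1 a)

  mutual
    -- Survivors of `j` rounds. A round measures `class` and `fan` among the survivors of the
    -- previous one, so that a move made from a survivor of round `suc j` lands on a survivor of
    -- round `j`.
    T : ℕ → Star s → Bool
    T zero    σ = good σ
    T (suc j) σ = T j σ ∧ (does (a₀ ≤? class j (heads σ)) ∧ not (any (λ l → does (fan j l σ <? b₀)) (allFin s)))

    class : ℕ → Vec Vx s → ℕ
    class j v̄ = ∑ (starL b is) (λ τ → ⟦ T j τ ⟧ * ⟦ does (heads τ ≟ᵛ v̄) ⟧)

    fan : ℕ → Fin s → Star s → ℕ
    fan j l σ = ∑ (nb (at (cut l 1 σ) l)) (λ v → ⟦ T j (repl l v σ) ⟧)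

  #T : ℕ → ℕ
  #T j = ∑ (starL b is) (⟦_⟧ ∘ T j)

  T⇒good : ∀ j {σ} → T j σ ≡ true → good σ ≡ true
  T⇒good zero    e = e
  T⇒good (suc j) e = T⇒good j (proj₁ (∧-true e))

  lossA : ℕ → ℕ
  lossA j = ∑ (starL b is) (λ σ → ⟦ T j σ ⟧ * ⟦ does (class j (heads σ) <? a₀) ⟧)

  lossB : ℕ → Fin s → ℕ
  lossB j l = ∑ (starL b is) (λ σ → ⟦ T j σ ⟧ * ⟦ does (fan j l σ <? b₀) ⟧)

  round : ∀ j → #T j ≤ #T (suc j) + (lossA j + ∑ (allFin s) (lossB j))
  round j = begin
    ∑ (starL b is) (λ σ → ⟦ T j σ ⟧)
      ≤⟨ ∑-mono (starL b is) pointwise ⟩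
    ∑ (starL b is) (λ σ → ⟦ T (suc j) σ ⟧ + (⟦ T j σ ⟧ * ⟦ does (class j (heads σ) <? a₀) ⟧ + ∑ (allFin s) (λ l → ⟦ T j σ ⟧ * ⟦ does (fan j l σ <? b₀) ⟧)))
      ≡⟨ trans (∑-+ (starL b is) _ _) (cong (#T (suc j) +_) (trans (∑-+ (starL b is) _ _) (cong (lossA j +_) (∑-swap (starL b is) (allFin s) _)))) ⟩
    #T (suc j) + (lossA j + ∑ (allFin s) (lossB j)) ∎
    where
    open ≤-Reasoning
    helper : ∀ p q r x → (q ≡ false → 1 ≤ x) → ⟦ r ⟧ ≤ x → ⟦ p ⟧ ≤ ⟦ p ∧ (q ∧ not r) ⟧ + ⟦ p ⟧ * x
    helper false q r x _ _ = z≤n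
    helper true true true  x _ h = ≤-trans h (≤-reflexive (sym (+-identityʳ x)))
    helper true true false x _ h = s≤s z≤n
    helper true false r x h _ = ≤-trans (h refl) (≤-reflexive (sym (+-identityʳ x)))
    pointwise : ∀ σ → ⟦ T j σ ⟧ ≤ ⟦ T (suc j) σ ⟧ + (⟦ T j σ ⟧ * ⟦ does (class j (heads σ) <? a₀) ⟧ + ∑ (allFin s) (λ l → ⟦ T j σ ⟧ * ⟦ does (fan j l σ <? b₀) ⟧))
    pointwise σ = ≤-trans
      (helper (T j σ) (does (a₀ ≤? class j (heads σ))) (any (λ l → does (fan j l σ <? b₀)) (allFin s)) _
        (λ e → ≤-trans (≤-reflexive (sym (cong ⟦_⟧ (true-does (class j (heads σ) <? a₀) (≰⇒> (does-false (a₀ ≤? class j (heads σ)) e)))))) (m≤m+n _ _))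
        (≤-trans (∑-any _ (allFin s)) (m≤n+m _ _)))
      (≤-reflexive (cong (⟦ T (suc j) σ ⟧ +_) (trans (*-distribˡ-+ ⟦ T j σ ⟧ _ _)
        (cong (⟦ T j σ ⟧ * ⟦ does (class j (heads σ) <? a₀) ⟧ +_) (sym (∑-*ˡ (allFin s) ⟦ T j σ ⟧ _))))))

  -- A deleted star is rich, so at least `c` stars have its roots, while fewer than `a₀` of those
  -- are deleted here. Counting pairs of a deleted star and a star on the same roots gives the share
  -- `a₀ / c`.
  lossA-bound : ∀ j → c * lossA j ≤ a₀ * total b is
  lossA-bound j = begin
    c * lossA j
      ≡⟨ sym (∑-*ˡ (starL b is) c _) ⟩
    ∑ (starL b is) (λ σ → c * x σ)
      ≤⟨ ∑-mono (starL b is) rich ⟩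
    ∑ (starL b is) (λ σ → x σ * #roots b is (heads σ))
      ≡⟨ trans (∑-cong (starL b is) λ σ → sym (∑-*ˡ (starL b is) (x σ) _)) (∑-swap (starL b is) (starL b is) _) ⟩
    ∑ (starL b is) (λ τ → ∑ (starL b is) (λ σ → x σ * ⟦ does (heads τ ≟ᵛ heads σ) ⟧))
      ≤⟨ ∑-bound (starL b is) a₀ (λ τ _ → small τ) ⟩
    length (starL b is) * a₀
      ≤⟨ *-monoˡ-≤ a₀ (starL-length b is) ⟩
    total b is * a₀
      ≡⟨ *-comm (total b is) a₀ ⟩
    a₀ * total b is ∎
    where
    open ≤-Reasoning
    x : Star s → ℕ
    x σ = ⟦ T j σ ⟧ * ⟦ does (class j (heads σ) <? a₀) ⟧
    rich : ∀ σ → c * x σ ≤ x σ * #roots b is (heads σ)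
    rich σ with T j σ in eq
    ... | false = ≤-reflexive (*-zeroʳ c)
    ... | true  = ≤-trans (≤-reflexive (*-comm c _)) (*-monoʳ-≤ (1 * ⟦ does (class j (heads σ) <? a₀) ⟧) (does-true (c ≤? _) (proj₁ (∧-true (T⇒good j eq)))))
    small : ∀ τ → ∑ (starL b is) (λ σ → x σ * ⟦ does (heads τ ≟ᵛ heads σ) ⟧) ≤ a₀
    small τ with class j (heads τ) <? a₀
    ... | yes lt = ≤-trans (∑-mono (starL b is) le) (<⇒≤ lt)
      where
      le : ∀ σ → x σ * ⟦ does (heads τ ≟ᵛ heads σ) ⟧ ≤ ⟦ T j σ ⟧ * ⟦ does (heads σ ≟ᵛ heads τ) ⟧
      le σ with heads τ ≟ᵛ heads σ
      ... | no _  = ≤-trans (≤-reflexive (*-zeroʳ (x σ))) z≤n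
      ... | yes e rewrite true-does (heads σ ≟ᵛ heads τ) (sym e) =
        *-monoˡ-≤ 1 (≤-trans (*-monoʳ-≤ ⟦ T j σ ⟧ (⟦⟧≤1 (does (class j (heads σ) <? a₀)))) (≤-reflexive (*-identityʳ ⟦ T j σ ⟧)))
    ... | no ¬lt = ≤-trans (≤-reflexive (trans (∑-cong (starL b is) nil) (∑-zero (starL b is)))) z≤n
      where
      nil : ∀ σ → x σ * ⟦ does (heads τ ≟ᵛ heads σ) ⟧ ≡ 0
      nil σ with heads τ ≟ᵛ heads σ
      ... | no _  = *-zeroʳ (x σ)
      ... | yes e rewrite false-does (class j (heads σ) <? a₀) (subst (λ v̄ → ¬ (class j v̄ < a₀)) e ¬lt) = cong (_* 1) (*-zeroʳ ⟦ T j σ ⟧)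

  module _ (Q : ℕ) (Q≤D : ∀ b → Q ≤ D b) where

    -- Stars that differ only in the root of leg `l` have the same fan. Such a group loses nothing
    -- or has fewer than `b₀` survivors to lose, and the budget for groups is smaller than `total`
    -- by a factor of at least `Q`.
    lossB-bound : ∀ j l → 1 ≤ lookup is l → Q * lossB j l ≤ b₀ * total b is
    lossB-bound j l 1≤ = begin
      Q * lossB j l
        ≡⟨ cong (λ js → Q * ∑ (starL b js) F) (sym is≡) ⟩
      Q * ∑ (starL b (updateAt is′ l (1 +_))) F
        ≡⟨ cong (Q *_) (∑-split b is′ l 1 F) ⟩
      Q * ∑ (starL b is′) (λ σ → ∑ (legL (at σ l) 1) (λ f → F (ext l f σ)))
        ≤⟨ *-monoʳ-≤ Q (∑-bound (starL b is′) b₀ λ σ _ → small σ) ⟩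
      Q * (length (starL b is′) * b₀)
        ≤⟨ *-mono-≤ (Q≤D (flip (lookup is′ l) b)) (*-monoˡ-≤ b₀ (starL-length b is′)) ⟩
      d * (sz b * Pr b is′ * b₀)
        ≡⟨ lem d (sz b) (Pr b is′) b₀ ⟩
      b₀ * (sz b * (Pr b is′ * (1 * d)))
        ≡⟨ cong (λ x → b₀ * (sz b * x)) (trans (sym (Pr-split b is′ l 1)) (cong (Pr b) is≡)) ⟩
      b₀ * total b is ∎
      where
      open ≤-Reasoning
      is′ = trunc l 1
      is≡ : updateAt is′ l (1 +_) ≡ is
      is≡ = updateAt-∸+ is l 1 1≤
      d = D (flip (lookup is′ l) b)
      F : Star s → ℕ
      F σ = ⟦ T j σ ⟧ * ⟦ does (fan j l σ <? b₀) ⟧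
      lem : ∀ d z p b → d * (z * p * b) ≡ b * (z * (p * (1 * d)))
      lem = solve-∀
      fan-ext : ∀ v σ → fan j l (ext l (v ∷ []) σ) ≡ ∑ (nb (at σ l)) (λ w → ⟦ T j (ext l (w ∷ []) σ) ⟧)
      fan-ext v σ = trans (cong (λ τ → ∑ (nb (at τ l)) (λ w → ⟦ T j (repl l w (ext l (v ∷ []) σ)) ⟧)) (cut-ext l 1 σ refl))
        (∑-cong (nb (at σ l)) λ w → cong (λ ls → ⟦ T j (proj₁ σ , ls) ⟧) (Vec.updateAt-updateAt l (proj₂ σ)))
      collapse : ∀ x → x * ⟦ does (x <? b₀) ⟧ ≤ b₀
      collapse x = go (x <? b₀)
        where
        go : (d : Dec (x < b₀)) → x * ⟦ does d ⟧ ≤ b₀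
        go (yes lt) = ≤-trans (≤-reflexive (*-identityʳ x)) (<⇒≤ lt)
        go (no _)   = ≤-trans (≤-reflexive (*-zeroʳ x)) z≤n
      small : ∀ σ → ∑ (legL (at σ l) 1) (λ f → F (ext l f σ)) ≤ b₀
      small σ = begin
        ∑ (legL (at σ l) 1) (λ f → F (ext l f σ))
          ≡⟨ trans (∑-legL-suc (at σ l) 0 _) (+-identityʳ _) ⟩
        ∑ (nb (at σ l)) (λ v → F (ext l (v ∷ []) σ))
          ≡⟨ ∑-cong (nb (at σ l)) (λ v → cong (λ x → ⟦ T j (ext l (v ∷ []) σ) ⟧ * ⟦ does (x <? b₀) ⟧) (fan-ext v σ)) ⟩
        ∑ (nb (at σ l)) (λ v → ⟦ T j (ext l (v ∷ []) σ) ⟧ * ⟦ does (y <? b₀) ⟧)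
          ≡⟨ ∑-*ʳ (nb (at σ l)) _ _ ⟩
        y * ⟦ does (y <? b₀) ⟧
          ≤⟨ collapse y ⟩
        b₀ ∎
        where y = ∑ (nb (at σ l)) (λ w → ⟦ T j (ext l (w ∷ []) σ) ⟧)

    module _ (μ : ℕ) (D>0 : ∀ b → 0 < D b) (handshake : ∀ b b′ → sz b′ * D b′ ≤ μ * (sz b * D b))
             (1≤is : ∀ l → 1 ≤ lookup is l) where

      private
        N = Vec.sum is
        tot = total b is

      -- Union bound over the `N` positions: a rich outer walk costs `μ` and a rich truncation 1,
      -- whence `N * suc μ`.
      unclean-count : ∀ E₁ →
        (∀ l j → suc j ≤ lookup is l → ∀ b′ → LegSparse E₁ c′ b′ (suc j)) →
        (∀ l j → suc j < lookup is l → StarSparse E₁ c′ b (trunc l (suc j))) →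
        E₁ * ∑ (starL b is) (⟦_⟧ ∘ unclean) ≤ N * suc μ * tot
      unclean-count E₁ H₁ H₂ = begin
        E₁ * ∑ (starL b is) (⟦_⟧ ∘ unclean)
          ≤⟨ *-monoʳ-≤ E₁ (∑-mono (starL b is) λ σ → ∑-any (event σ) (positions is)) ⟩
        E₁ * ∑ (starL b is) (λ σ → ∑ (positions is) (λ p → ⟦ event σ p ⟧))
          ≡⟨ trans (cong (E₁ *_) (∑-swap (starL b is) (positions is) _)) (sym (∑-*ˡ (positions is) E₁ _)) ⟩
        ∑ (positions is) (λ p → E₁ * ∑ (starL b is) (λ σ → ⟦ event σ p ⟧))
          ≤⟨ ∑-bound (positions is) (suc μ * tot) (λ p p∈ → one p (positions-∈ is p∈)) ⟩
        length (positions is) * (suc μ * tot)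
          ≡⟨ trans (cong (_* (suc μ * tot)) (positions-length is)) (sym (*-assoc N (suc μ) tot)) ⟩
        N * suc μ * tot ∎
        where
        open ≤-Reasoning
        one : ∀ p → proj₂ p < lookup is (proj₁ p) → E₁ * ∑ (starL b is) (λ σ → ⟦ event σ p ⟧) ≤ suc μ * tot
        one (l , j) j< = begin
          E₁ * ∑ (starL b is) (λ σ → ⟦ event σ (l , j) ⟧)
            ≤⟨ *-monoʳ-≤ E₁ (≤-trans (∑-mono (starL b is) λ σ → ⟦∨⟧≤ (legEvent c′ l (suc j) σ) _) (≤-reflexive (∑-+ (starL b is) _ _))) ⟩
          E₁ * (∑ (starL b is) (λ σ → ⟦ legEvent c′ l (suc j) σ ⟧) + ∑ (starL b is) (λ σ → ⟦ does (suc j <? lookup is l) ∧ cutEvent c′ b (trunc l (suc j)) l (suc j) σ ⟧))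
            ≡⟨ *-distribˡ-+ E₁ _ _ ⟩
          E₁ * ∑ (starL b is) (λ σ → ⟦ legEvent c′ l (suc j) σ ⟧) + E₁ * ∑ (starL b is) (λ σ → ⟦ does (suc j <? lookup is l) ∧ cutEvent c′ b (trunc l (suc j)) l (suc j) σ ⟧)
            ≤⟨ +-mono-≤ leg tr ⟩
          μ * tot + tot
            ≡⟨ +-comm (μ * tot) tot ⟩
          suc μ * tot ∎
          where
          is≡ : updateAt (trunc l (suc j)) l (suc j +_) ≡ is
          is≡ = updateAt-∸+ is l (suc j) j<
          leg : E₁ * ∑ (starL b is) (λ σ → ⟦ legEvent c′ l (suc j) σ ⟧) ≤ μ * tot
          leg = subst (λ js → E₁ * ∑ (starL b js) (λ σ → ⟦ legEvent c′ l (suc j) σ ⟧) ≤ μ * total b js) is≡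
                  (legEvent-count μ D>0 handshake E₁ c′ b (trunc l (suc j)) l (suc j) (H₁ l j j<))
          tr : E₁ * ∑ (starL b is) (λ σ → ⟦ does (suc j <? lookup is l) ∧ cutEvent c′ b (trunc l (suc j)) l (suc j) σ ⟧) ≤ tot
          tr = go (suc j <? lookup is l)
            where
            go : (d : Dec (suc j < lookup is l)) → E₁ * ∑ (starL b is) (λ σ → ⟦ does d ∧ cutEvent c′ b (trunc l (suc j)) l (suc j) σ ⟧) ≤ tot
            go (yes lt) = subst (λ js → E₁ * ∑ (starL b js) (λ σ → ⟦ cutEvent c′ b (trunc l (suc j)) l (suc j) σ ⟧) ≤ total b js) is≡
                  (cutEvent-count E₁ c′ b (trunc l (suc j)) l (suc j) (H₂ l j lt))
            go (no _) = ≤-trans (≤-reflexive (trans (cong (E₁ *_) (∑-zero (starL b is))) (*-zeroʳ E₁))) z≤n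

      -- The rich stars have share above 1 / E. Repeated vertices and rich parts take at most 1 / 4E
      -- each, so 1 / 2E is left.
      initial : ∀ E → tot < E * starRich b is c →
        (4 * E) * suc (spread N) ≤ Q →
        (∀ l j → suc j ≤ lookup is l → ∀ b′ → LegSparse ((4 * E) * suc (N * suc μ)) c′ b′ (suc j)) →
        (∀ l j → suc j < lookup is l → StarSparse ((4 * E) * suc (N * suc μ)) c′ b (trunc l (suc j))) →
        2 * tot ≤ (4 * E) * #T 0
      initial E lt hQ H₁ H₂ = +-cancelʳ-≤ (2 * tot) _ _ (begin
        2 * tot + 2 * tot                  ≡⟨ lem tot ⟩
        4 * tot                            ≤⟨ *-monoʳ-≤ 4 (<⇒≤ lt) ⟩
        4 * (E * starRich b is c)          ≡⟨ sym (*-assoc 4 E _) ⟩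
        (4 * E) * starRich b is c          ≤⟨ *-monoʳ-≤ (4 * E) split ⟩
        (4 * E) * (#T 0 + (deg + unc))     ≡⟨ lem₂ (4 * E) (#T 0) deg unc ⟩
        (4 * E) * #T 0 + ((4 * E) * deg + (4 * E) * unc)
          ≤⟨ +-monoʳ-≤ ((4 * E) * #T 0) (+-mono-≤ degb uncb) ⟩
        (4 * E) * #T 0 + (tot + tot)       ≡⟨ cong ((4 * E) * #T 0 +_) (lem₃ tot) ⟩
        (4 * E) * #T 0 + 2 * tot           ∎)
        where
        open ≤-Reasoning
        lem : ∀ t → 2 * t + 2 * t ≡ 4 * t
        lem = solve-∀
        lem₂ : ∀ e a b c → e * (a + (b + c)) ≡ e * a + (e * b + e * c)
        lem₂ = solve-∀
        lem₃ : ∀ t → t + t ≡ 2 * t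
        lem₃ = solve-∀
        deg = ∑ (starL b is) (λ σ → ⟦ not (distinct σ) ⟧)
        unc = ∑ (starL b is) (⟦_⟧ ∘ unclean)
        degb : (4 * E) * deg ≤ tot
        degb = dilute (4 * E) (spread N) deg tot (≤-trans (*-monoˡ-≤ deg hQ) (degenerate-count Q Q≤D b is))
        uncb : (4 * E) * unc ≤ tot
        uncb = dilute (4 * E) (N * suc μ) unc tot (unclean-count ((4 * E) * suc (N * suc μ)) H₁ H₂)
        three : ∀ p q r → ⟦ p ⟧ ≤ ⟦ p ∧ (q ∧ not r) ⟧ + (⟦ not q ⟧ + ⟦ r ⟧)
        three false q r = z≤n
        three true true true = ≤-refl
        three true true false = ≤-refl
        three true false r = s≤s z≤n
        split : starRich b is c ≤ #T 0 + (deg + unc)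
        split = ≤-trans (∑-mono (starL b is) λ σ → three (does (c ≤? #roots b is (heads σ))) (distinct σ) (unclean σ))
          (≤-reflexive (trans (∑-+ (starL b is) _ _) (cong (#T 0 +_) (∑-+ (starL b is) _ _))))

      one-round : ∀ e j → e * suc a₀ ≤ c → e * suc (s * b₀) ≤ Q → e * #T j ≤ e * #T (suc j) + 2 * tot
      one-round e j hc hQ = begin
        e * #T j                                               ≤⟨ *-monoʳ-≤ e (round j) ⟩
        e * (#T (suc j) + (lossA j + LB))                      ≡⟨ lem e (#T (suc j)) (lossA j) LB ⟩
        e * #T (suc j) + (e * lossA j + e * LB)                ≤⟨ +-monoʳ-≤ (e * #T (suc j)) (+-mono-≤ A B) ⟩
        e * #T (suc j) + (tot + tot)                           ≡⟨ cong (e * #T (suc j) +_) (lem₃ tot) ⟩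
        e * #T (suc j) + 2 * tot ∎
        where
        open ≤-Reasoning
        LB = ∑ (allFin s) (lossB j)
        lem : ∀ e a b c → e * (a + (b + c)) ≡ e * a + (e * b + e * c)
        lem = solve-∀
        lem₃ : ∀ t → t + t ≡ 2 * t
        lem₃ = solve-∀
        A : e * lossA j ≤ tot
        A = dilute e a₀ (lossA j) tot (≤-trans (*-monoˡ-≤ (lossA j) hc) (lossA-bound j))
        B : e * LB ≤ tot
        B = dilute e (s * b₀) LB tot (≤-trans (*-monoˡ-≤ LB hQ) (≤-trans (≤-reflexive (sym (∑-*ˡ (allFin s) Q _)))
              (≤-trans (∑-bound (allFin s) (b₀ * tot) λ l _ → lossB-bound j l (1≤is l))
                (≤-reflexive (trans (cong (_* (b₀ * tot)) (length-tabulate {n = s} id)) (sym (*-assoc s b₀ tot)))))))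

      rounds : ∀ e j → e * suc a₀ ≤ c → e * suc (s * b₀) ≤ Q → e * #T 0 ≤ e * #T j + j * (2 * tot)
      rounds e zero    hc hQ = m≤m+n _ _
      rounds e (suc j) hc hQ = begin
        e * #T 0                                 ≤⟨ rounds e j hc hQ ⟩
        e * #T j + j * (2 * tot)                 ≤⟨ +-monoˡ-≤ (j * (2 * tot)) (one-round e j hc hQ) ⟩
        e * #T (suc j) + 2 * tot + j * (2 * tot) ≡⟨ +-assoc (e * #T (suc j)) (2 * tot) _ ⟩
        e * #T (suc j) + suc j * (2 * tot) ∎
        where open ≤-Reasoning

      -- For `e = 8 * E * suc r` a round costs 2 / e, so `suc r` rounds cost 1 / 4E, which is half
      -- of what `initial` provides.
      dense : ∀ E r → tot < E * starRich b is c →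
        (4 * E) * suc (spread N) ≤ Q →
        (8 * E * suc r) * suc a₀ ≤ c → (8 * E * suc r) * suc (s * b₀) ≤ Q →
        (∀ l j → suc j ≤ lookup is l → ∀ b′ → LegSparse ((4 * E) * suc (N * suc μ)) c′ b′ (suc j)) →
        (∀ l j → suc j < lookup is l → StarSparse ((4 * E) * suc (N * suc μ)) c′ b (trunc l (suc j))) →
        tot ≤ (4 * E) * #T (suc r)
      dense E r lt hQ hc hQ′ H₁ H₂ = *-cancelˡ-≤ (2 * suc r) (+-cancelʳ-≤ (suc r * (2 * tot)) _ _ (begin
        2 * suc r * tot + suc r * (2 * tot)   ≡⟨ lem₁ (suc r) tot ⟩
        2 * suc r * (2 * tot)                 ≤⟨ *-monoʳ-≤ (2 * suc r) (initial E lt hQ H₁ H₂) ⟩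
        2 * suc r * ((4 * E) * #T 0)          ≡⟨ lem₂ (suc r) E (#T 0) ⟩
        (8 * E * suc r) * #T 0                ≤⟨ rounds (8 * E * suc r) (suc r) hc hQ′ ⟩
        (8 * E * suc r) * #T (suc r) + suc r * (2 * tot)
          ≡⟨ cong (_+ suc r * (2 * tot)) (sym (lem₂ (suc r) E (#T (suc r)))) ⟩
        2 * suc r * ((4 * E) * #T (suc r)) + suc r * (2 * tot) ∎))
        where
        open ≤-Reasoning
        lem₁ : ∀ r t → 2 * r * t + r * (2 * t) ≡ 2 * r * (2 * t)
        lem₁ = solve-∀
        lem₂ : ∀ r E t → 2 * r * ((4 * E) * t) ≡ (8 * E * r) * t
        lem₂ = solve-∀

-- Companions of a star that avoid a bounded set.

⟦does⟧-mono : {P Q : Set} (d : Dec P) (e : Dec Q) → (P → Q) → ⟦ does d ⟧ ≤ ⟦ does e ⟧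
⟦does⟧-mono d e h = ⟦⟧-mono λ t → true-does e (h (does-true d t))

⟦does⟧-× : {P Q R : Set} (d : Dec P) (e : Dec Q) (f : Dec R) → (P → Q × R) → ⟦ does d ⟧ ≤ ⟦ does e ⟧ * ⟦ does f ⟧
⟦does⟧-× d e f h = ≤-trans
  (⟦⟧-mono λ t → let q , r = h (does-true d t) in true-∧ (true-does e q) (true-does f r))
  (≤-reflexive (⟦∧⟧ (does e) (does f)))

*-positiveˡ : ∀ x y → 0 < x * y → 0 < x
*-positiveˡ (suc x) y _ = s≤s z≤n

*-positiveʳ : ∀ x y → 0 < x * y → 0 < y
*-positiveʳ x y h = *-positiveˡ y x (subst (0 <_) (*-comm x y) h)

m*n<m⇒n≡0 : ∀ m n → m * n < m → n ≡ 0
m*n<m⇒n≡0 m zero    h = refl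
m*n<m⇒n≡0 m (suc n) h = ⊥-elim (<⇒≱ h (m≤m*n m (suc n)))

Unique-++ : {A : Set} (xs ys : List A) → Unique (xs ++ ys) →
            Unique xs × Unique ys × (∀ {x} → x ∈ xs → x ∉ ys)
Unique-++ []       ys u = AllPairs.[] , u , λ ()
Unique-++ (x ∷ xs) ys (x∉ AllPairs.∷ u) = let p , q , d = Unique-++ xs ys u in
  (All.tabulate (λ y∈ → All.lookup x∉ (∈-++⁺ˡ y∈)) AllPairs.∷ p) , q ,
  λ { (here refl) y∈ → All.lookup x∉ (∈-++⁺ʳ xs y∈) refl ; (there z∈) → d z∈ }

module Hits {m n : ℕ} (G : BipGraph m n) where
  open Graph G
  open GraphCounts G

  legT-roots : ∀ {s} c y (is : Vec ℕ s) (v̄ : Vec Vx s) → (∀ l → #walks (lookup is l) y (lookup v̄ l) ≤ c) →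
               ∑ (legT y is) (λ ls → ⟦ does (Vec.map (hd y) ls ≟ᵛ v̄) ⟧) ≤ c ^ s
  legT-roots c y []       []      h = ≤-refl
  legT-roots {suc s} c y (i ∷ is) (v ∷ v̄) h = begin
    ∑ (legT y (i ∷ is)) (λ ls → ⟦ does (Vec.map (hd y) ls ≟ᵛ (v ∷ v̄)) ⟧)
      ≡⟨ ∑-legT-∷ y i is _ ⟩
    ∑ (legL y i) (λ a → ∑ (legT y is) (λ as → ⟦ does ((hd y a ∷ Vec.map (hd y) as) ≟ᵛ (v ∷ v̄)) ⟧))
      ≤⟨ ∑-mono (legL y i) (λ a → ≤-trans (∑-mono (legT y is) λ as →
           ⟦does⟧-× ((hd y a ∷ Vec.map (hd y) as) ≟ᵛ (v ∷ v̄)) (hd y a ≟ v) (Vec.map (hd y) as ≟ᵛ v̄) Vec.∷-injective)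
           (≤-reflexive (∑-*ˡ (legT y is) ⟦ does (hd y a ≟ v) ⟧ _))) ⟩
    ∑ (legL y i) (λ a → ⟦ does (hd y a ≟ v) ⟧ * S)
      ≡⟨ ∑-*ʳ (legL y i) S _ ⟩
    #walks i y v * S
      ≤⟨ *-mono-≤ (h zero) (legT-roots c y is v̄ (h ∘ suc)) ⟩
    c ^ suc s ∎
    where
    open ≤-Reasoning
    S = ∑ (legT y is) (λ as → ⟦ does (Vec.map (hd y) as ≟ᵛ v̄) ⟧)

  -- Once the center is fixed the legs are independent, each chosen among at most `c` walks.
  center-roots : ∀ {s} c b (is : Vec ℕ s) (v̄ : Vec Vx s) x → (∀ l → #walks (lookup is l) x (lookup v̄ l) ≤ c) →
                 ∑ (starL b is) (λ σ → ⟦ does (heads σ ≟ᵛ v̄) ⟧ * ⟦ does (proj₁ σ ≟ x) ⟧) ≤ c ^ s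
  center-roots {s} c b is v̄ x h = begin
    ∑ (starL b is) (λ σ → ⟦ does (heads σ ≟ᵛ v̄) ⟧ * ⟦ does (proj₁ σ ≟ x) ⟧)
      ≡⟨ trans (∑-starL b is _) (∑-cong (sideL b) λ y → ∑-*ʳ (legT y is) ⟦ does (y ≟ x) ⟧ _) ⟩
    ∑ (sideL b) (λ y → S y * ⟦ does (y ≟ x) ⟧)
      ≤⟨ ∑-mono (sideL b) one ⟩
    ∑ (sideL b) (λ y → S x * ⟦ does (y ≟ x) ⟧)
      ≡⟨ ∑-*ˡ (sideL b) (S x) _ ⟩
    S x * ∑ (sideL b) (λ y → ⟦ does (y ≟ x) ⟧)
      ≤⟨ *-mono-≤ (legT-roots c x is v̄ h) (∑-sideL≟ b x) ⟩
    c ^ s * 1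
      ≡⟨ *-identityʳ (c ^ s) ⟩
    c ^ s ∎
    where
    open ≤-Reasoning
    S : Vx → ℕ
    S y = ∑ (legT y is) (λ ls → ⟦ does (Vec.map (hd y) ls ≟ᵛ v̄) ⟧)
    one : ∀ y → S y * ⟦ does (y ≟ x) ⟧ ≤ S x * ⟦ does (y ≟ x) ⟧
    one y with y ≟ x
    ... | yes refl = ≤-refl
    ... | no _     = ≤-reflexive (trans (*-zeroʳ (S y)) (sym (*-zeroʳ (S x))))

  lookup-≔ : ∀ {s} {A : Set} (v̄ w̄ : Vec A s) l x → v̄ [ l ]≔ x ≡ w̄ → v̄ ≡ w̄ [ l ]≔ lookup v̄ l
  lookup-≔ v̄ w̄ l x refl = sym (trans (Vec.[]≔-idempotent v̄ l) (Vec.[]≔-lookup v̄ l))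

  heads-cut : ∀ {s} l j (σ : Star s) → heads (cut l j σ) ≡ heads σ [ l ]≔ at (cut l j σ) l
  heads-cut l j (y , ls) = go ls l
    where
    go : ∀ {s} (ls : Vec (List Vx) s) l →
         Vec.map (hd y) (updateAt ls l (drop j)) ≡ Vec.map (hd y) ls [ l ]≔ hd y (lookup (updateAt ls l (drop j)) l)
    go (a ∷ ls) zero    = refl
    go (a ∷ ls) (suc l) = cong (hd y a ∷_) (go ls l)

  -- Cut at `x`, such a star becomes a shorter star whose `l`-th root is `x` and a walk from `x` to
  -- the former root, with at most `c` choices for each.
  through-roots : ∀ {s} c b (is : Vec ℕ s) l j (v̄ : Vec Vx s) x →
    #roots b is (v̄ [ l ]≔ x) ≤ c → #walks j x (lookup v̄ l) ≤ c →
    ∑ (starL b (updateAt is l (j +_))) (λ σ → ⟦ does (heads σ ≟ᵛ v̄) ⟧ * ⟦ does (at (cut l j σ) l ≟ x) ⟧) ≤ c * c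
  through-roots c b is l j v̄ x h₁ h₂ = begin
    ∑ (starL b (updateAt is l (j +_))) (λ σ → ⟦ does (heads σ ≟ᵛ v̄) ⟧ * ⟦ does (at (cut l j σ) l ≟ x) ⟧)
      ≡⟨ ∑-split b is l j _ ⟩
    ∑ (starL b is) (λ σ → ∑ (legL (at σ l) j) (λ f → ⟦ does (heads (ext l f σ) ≟ᵛ v̄) ⟧ * ⟦ does (at (cut l j (ext l f σ)) l ≟ x) ⟧))
      ≡⟨ ∑-cong (starL b is) (λ σ → trans (∑-cong∈ (legL (at σ l) j) λ f f∈ → cong₂ (λ v̄′ τ → ⟦ does (v̄′ ≟ᵛ v̄) ⟧ * ⟦ does (at τ l ≟ x) ⟧)
             (heads-ext l f σ) (cut-ext l j σ (Leg-length (legL-sound j f∈)))) (∑-*ʳ (legL (at σ l) j) ⟦ does (at σ l ≟ x) ⟧ _)) ⟩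
    ∑ (starL b is) (λ σ → ∑ (legL (at σ l) j) (λ f → ⟦ does ((heads σ [ l ]≔ hd (at σ l) f) ≟ᵛ v̄) ⟧) * ⟦ does (at σ l ≟ x) ⟧)
      ≤⟨ ∑-mono (starL b is) one ⟩
    ∑ (starL b is) (λ σ → ⟦ does (heads σ ≟ᵛ (v̄ [ l ]≔ x)) ⟧ * #walks j x (lookup v̄ l))
      ≡⟨ ∑-*ʳ (starL b is) _ _ ⟩
    #roots b is (v̄ [ l ]≔ x) * #walks j x (lookup v̄ l)
      ≤⟨ *-mono-≤ h₁ h₂ ⟩
    c * c ∎
    where
    open ≤-Reasoning
    one : ∀ σ → ∑ (legL (at σ l) j) (λ f → ⟦ does ((heads σ [ l ]≔ hd (at σ l) f) ≟ᵛ v̄) ⟧) * ⟦ does (at σ l ≟ x) ⟧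
              ≤ ⟦ does (heads σ ≟ᵛ (v̄ [ l ]≔ x)) ⟧ * #walks j x (lookup v̄ l)
    one σ with at σ l ≟ x
    ... | no _     = ≤-trans (≤-reflexive (*-zeroʳ (∑ (legL (at σ l) j) _))) z≤n
    ... | yes refl = ≤-trans (≤-reflexive (*-identityʳ _)) (≤-trans (∑-mono (legL (at σ l) j) λ f →
      ⟦does⟧-× ((heads σ [ l ]≔ hd (at σ l) f) ≟ᵛ v̄) (heads σ ≟ᵛ (v̄ [ l ]≔ at σ l)) (hd (at σ l) f ≟ lookup v̄ l)
        λ e → trans (lookup-≔ (heads σ) v̄ l _ e) (cong (v̄ [ l ]≔_) (at-heads σ l)) ,
              trans (sym (Vec.lookup∘updateAt l (heads σ))) (cong (λ v̄ → lookup v̄ l) e))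
      (≤-reflexive (∑-*ˡ (legL (at σ l) j) ⟦ does (heads σ ≟ᵛ (v̄ [ l ]≔ at σ l)) ⟧ _)))

  hits-∈ : ∀ {A : Set} (xs : List A) (w : A → ℕ) (p : A → Vx) K X →
           (∀ x → ∑ xs (λ a → w a * ⟦ does (p a ≟ x) ⟧) ≤ K) → ∑ xs (λ a → w a * ⟦ p a ∈ᵇ X ⟧) ≤ length X * K
  hits-∈ xs w p K X h = begin
    ∑ xs (λ a → w a * ⟦ p a ∈ᵇ X ⟧)
      ≤⟨ ∑-mono xs (λ a → ≤-trans (*-monoʳ-≤ (w a) (∑-any _ X)) (≤-reflexive (sym (∑-*ˡ X (w a) _)))) ⟩
    ∑ xs (λ a → ∑ X (λ x → w a * ⟦ does (p a ≟ x) ⟧))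
      ≡⟨ ∑-swap xs X _ ⟩
    ∑ X (λ x → ∑ xs (λ a → w a * ⟦ does (p a ≟ x) ⟧))
      ≤⟨ ∑-bound X K (λ x _ → h x) ⟩
    length X * K ∎
    where open ≤-Reasoning

module Avoid {m n : ℕ} (G : BipGraph m n) (D : Bool → ℕ) (deg≤ : ∀ u → length (Graph.nb G u) ≤ D (Graph.sd G u))
             {s : ℕ} (b : Bool) (is : Vec ℕ s) (c′ c a₀ b₀ : ℕ) (1≤is : ∀ l → 1 ≤ lookup is l) where
  open Graph G
  open GraphCounts G
  open Counts D deg≤
  open Hits G
  open Rounds G D deg≤ b is c′ c a₀ b₀

  good⇒ : ∀ σ → good σ ≡ true → distinct σ ≡ true × unclean σ ≡ false
  good⇒ σ g = let d , u = ∧-true {distinct σ} (proj₂ (∧-true {does (c ≤? #roots b is (heads σ))} g)) in d , not-true u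

  clean-leg : ∀ σ → good σ ≡ true → ∀ l j → j < lookup is l → #walks (suc j) (at (cut l (suc j) σ) l) (at σ l) ≤ c′
  clean-leg σ g l j j< = <⇒≤ (≰⇒> (does-false (c′ ≤? #walks (suc j) (at (cut l (suc j) σ) l) (at σ l))
    (proj₁ (∨-false {legEvent c′ l (suc j) σ} (any-false (event σ) (positions is) (proj₂ (good⇒ σ g)) (∈-positions is l j<))))))

  clean-cut : ∀ σ → good σ ≡ true → ∀ l j → suc j < lookup is l → #roots b (trunc l (suc j)) (heads (cut l (suc j) σ)) ≤ c′
  clean-cut σ g l j j< = <⇒≤ (≰⇒> (does-false (c′ ≤? #roots b (trunc l (suc j)) (heads (cut l (suc j) σ))) (go (true-does (suc j <? lookup is l) j<)
    (proj₂ (∨-false {legEvent c′ l (suc j) σ} (any-false (event σ) (positions is) (proj₂ (good⇒ σ g)) (∈-positions is l (<⇒≤ j<))))))))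
    where
    go : ∀ {p q} → p ≡ true → p ∧ q ≡ false → q ≡ false
    go refl e = e

  at-center : ∀ σ → IsStar is σ → ∀ l → at (cut l (lookup is l) σ) l ≡ proj₁ σ
  at-center (y , ls) st l = trans (cong (hd y) (Vec.lookup∘updateAt l ls)) (cong (hd y) (all (lookup ls l) (Leg-length (st l))))
    where
    all : ∀ (f : List Vx) {i} → length f ≡ i → drop i f ≡ []
    all []      {zero}  e = refl
    all (x ∷ f) {suc i} e = all f (suc-injective e)

  private
    w : ℕ → Vec Vx s → Star s → ℕ
    w j v̄ τ = ⟦ T j τ ⟧ * ⟦ does (heads τ ≟ᵛ v̄) ⟧

  -- Cleanness is a property of one star, but the bounds it yields depend only on the roots and on
  -- `x`. Either no survivor hits `x`, or the cleanness of a single one that does bounds them all.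
  vacuous : ∀ j v̄ (p : Star s → Vx) x K →
    (∀ τ → IsStar is τ → good τ ≡ true → heads τ ≡ v̄ → p τ ≡ x →
      ∑ (starL b is) (λ σ → ⟦ does (heads σ ≟ᵛ v̄) ⟧ * ⟦ does (p σ ≟ x) ⟧) ≤ K) →
    ∑ (starL b is) (λ τ → w j v̄ τ * ⟦ does (p τ ≟ x) ⟧) ≤ K
  vacuous j v̄ p x K h with 1 ≤? ∑ (starL b is) (λ τ → w j v̄ τ * ⟦ does (p τ ≟ x) ⟧)
  ... | no ¬p = ≤-trans (≤-pred (≰⇒> ¬p)) z≤n
  ... | yes q with ∑-positive (starL b is) _ q
  ... | τ , τ∈ , pos =
    let wpos = *-positiveˡ (w j v̄ τ) _ pos
    in ≤-trans (∑-mono (starL b is) λ σ → *-monoˡ-≤ ⟦ does (p σ ≟ x) ⟧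
                 (≤-trans (*-monoˡ-≤ ⟦ does (heads σ ≟ᵛ v̄) ⟧ (⟦⟧≤1 (T j σ))) (≤-reflexive (+-identityʳ _))))
         (h τ (proj₂ (starL-sound b is τ∈)) (T⇒good j (⟦⟧-positive (T j τ) (*-positiveˡ ⟦ T j τ ⟧ _ wpos)))
            (does-true (heads τ ≟ᵛ v̄) (⟦⟧-positive _ (*-positiveʳ ⟦ T j τ ⟧ _ wpos)))
            (does-true (p τ ≟ x) (⟦⟧-positive _ (*-positiveʳ (w j v̄ τ) _ pos))))

  center-hits : ∀ j v̄ x → ∑ (starL b is) (λ τ → w j v̄ τ * ⟦ does (proj₁ τ ≟ x) ⟧) ≤ c′ ^ s
  center-hits j v̄ x = vacuous j v̄ proj₁ x (c′ ^ s) λ { τ st g refl refl → center-roots c′ b is v̄ x λ l →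
      subst₂ (λ u v → #walks (lookup is l) u v ≤ c′) (at-center τ st l) (sym (at-heads τ l)) (whole τ st g l) }
    where
    whole : ∀ τ → IsStar is τ → good τ ≡ true → ∀ l → #walks (lookup is l) (at (cut l (lookup is l) τ) l) (at τ l) ≤ c′
    whole τ st g l with lookup is l | 1≤is l | clean-leg τ g l
    ... | suc i | _ | cl = cl i ≤-refl

  through-hits : ∀ j v̄ l i x → suc i < lookup is l →
    ∑ (starL b is) (λ τ → w j v̄ τ * ⟦ does (at (cut l (suc i) τ) l ≟ x) ⟧) ≤ c′ * c′
  through-hits j v̄ l i x i< = vacuous j v̄ (λ τ → at (cut l (suc i) τ) l) x (c′ * c′) λ where
    τ st g refl refl → subst (λ js → ∑ (starL b js) (λ σ → ⟦ does (heads σ ≟ᵛ v̄) ⟧ * ⟦ does (at (cut l (suc i) σ) l ≟ x) ⟧) ≤ c′ * c′)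
      (updateAt-∸+ is l (suc i) (<⇒≤ i<))
      (through-roots c′ b (trunc l (suc i)) l (suc i) v̄ x
        (subst (λ v̄ → #roots b (trunc l (suc i)) v̄ ≤ c′) (heads-cut l (suc i) τ) (clean-cut τ g l i i<))
        (subst (λ v → #walks (suc i) x v ≤ c′) (sym (at-heads τ l)) (clean-leg τ g l i (<⇒≤ i<))))

  -- Survivors on one root tuple through one vertex: `c′ ^ s` with this vertex as center, `c′ * c′`
  -- for each position on a leg.
  hit : ℕ
  hit = c′ ^ s + Vec.sum is * (c′ * c′)

  Avoiding : ℕ → Vec Vx s → List Vx → Set
  Avoiding j v̄ X = ∃ λ τ → IsStar is τ × T j τ ≡ true × heads τ ≡ v̄ × proj₁ τ ∉ X ×
                           (∀ l i → suc i < lookup is l → at (cut l (suc i) τ) l ∉ X)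

  avoid : ∀ j v̄ X → length X * hit < class j v̄ → Avoiding j v̄ X
  avoid j v̄ X lt with pigeonhole (starL b is) (w j v̄) (λ τ → w j v̄ τ * bad τ) (≤-<-trans total-bad lt)
    where
    bad : Star s → ℕ
    bad τ = ⟦ proj₁ τ ∈ᵇ X ⟧ + ∑ (positions is) (λ (l , i) → ⟦ does (suc i <? lookup is l) ∧ at (cut l (suc i) τ) l ∈ᵇ X ⟧)
    total-bad : ∑ (starL b is) (λ τ → w j v̄ τ * bad τ) ≤ length X * hit
    total-bad = begin
      ∑ (starL b is) (λ τ → w j v̄ τ * bad τ)
        ≡⟨ trans (∑-cong (starL b is) λ τ → trans (*-distribˡ-+ (w j v̄ τ) _ _) (cong (w j v̄ τ * ⟦ proj₁ τ ∈ᵇ X ⟧ +_) (sym (∑-*ˡ (positions is) (w j v̄ τ) _))))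
             (trans (∑-+ (starL b is) _ _) (cong (∑ (starL b is) (λ τ → w j v̄ τ * ⟦ proj₁ τ ∈ᵇ X ⟧) +_) (∑-swap (starL b is) (positions is) _))) ⟩
      ∑ (starL b is) (λ τ → w j v̄ τ * ⟦ proj₁ τ ∈ᵇ X ⟧) +
      ∑ (positions is) (λ (l , i) → ∑ (starL b is) (λ τ → w j v̄ τ * ⟦ does (suc i <? lookup is l) ∧ at (cut l (suc i) τ) l ∈ᵇ X ⟧))
        ≤⟨ +-mono-≤ (hits-∈ (starL b is) (w j v̄) proj₁ (c′ ^ s) X (center-hits j v̄))
             (∑-bound (positions is) (length X * (c′ * c′)) λ (l , i) _ → guarded l i (suc i <? lookup is l)) ⟩
      length X * c′ ^ s + length (positions is) * (length X * (c′ * c′))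
        ≡⟨ cong (λ N → length X * c′ ^ s + N * (length X * (c′ * c′))) (positions-length is) ⟩
      length X * c′ ^ s + Vec.sum is * (length X * (c′ * c′))
        ≡⟨ lem (length X) (c′ ^ s) (Vec.sum is) (c′ * c′) ⟩
      length X * hit ∎
      where
      open ≤-Reasoning
      lem : ∀ L p N q → L * p + N * (L * q) ≡ L * (p + N * q)
      lem = solve-∀
      guarded : ∀ l i (d : Dec (suc i < lookup is l)) →
        ∑ (starL b is) (λ τ → w j v̄ τ * ⟦ does d ∧ at (cut l (suc i) τ) l ∈ᵇ X ⟧) ≤ length X * (c′ * c′)
      guarded l i (yes i<) = hits-∈ (starL b is) (w j v̄) (λ τ → at (cut l (suc i) τ) l) (c′ * c′) X (λ x → through-hits j v̄ l i x i<)
      guarded l i (no _)   = ≤-trans (≤-reflexive (trans (∑-cong (starL b is) λ τ → *-zeroʳ (w j v̄ τ))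
        (∑-zero (starL b is)))) z≤n
  ... | τ , τ∈ , lt′ = τ , proj₂ (starL-sound b is τ∈)
      , ⟦⟧-positive (T j τ) (*-positiveˡ ⟦ T j τ ⟧ _ wpos)
      , does-true (heads τ ≟ᵛ v̄) (⟦⟧-positive _ (*-positiveʳ ⟦ T j τ ⟧ _ wpos))
      , ∈ᵇ-false X (⟦⟧-zero _ (s≤s (≤-trans (m≤m+n _ _) (≤-reflexive nobad))))
      , λ l i i< → ∈ᵇ-false X (⟦⟧-zero _ (s≤s (≤-trans (drop-guard (true-does (suc i <? lookup is l) i<))
          (≤-trans (∑-pick (λ (l , i) → ⟦ does (suc i <? lookup is l) ∧ at (cut l (suc i) τ) l ∈ᵇ X ⟧) (∈-positions is l (<⇒≤ i<)))
            (≤-trans (m≤n+m _ ⟦ proj₁ τ ∈ᵇ X ⟧) (≤-reflexive nobad))))))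
    where
    wpos = ≤-<-trans z≤n lt′
    nobad = m*n<m⇒n≡0 (w j v̄ τ) _ lt′
    drop-guard : ∀ {p q} → p ≡ true → ⟦ q ⟧ ≤ ⟦ p ∧ q ⟧
    drop-guard refl = ≤-refl

-- Webs, and the lengthening of their arms by moving roots.

module Webs {m n : ℕ} (G : BipGraph m n) where
  open Graph G
  open GraphCounts G

  ∈-filterᵇ : (p : Vx → Bool) (xs : List Vx) {v : Vx} → v ∈ xs → p v ≡ true → v ∈ filterᵇ p xs
  ∈-filterᵇ p (x ∷ xs) (here refl) e rewrite e = here refl
  ∈-filterᵇ p (x ∷ xs) (there v∈) e with p x
  ... | true  = there (∈-filterᵇ p xs v∈ e)
  ... | false = ∈-filterᵇ p xs v∈ e

  nb-sym : ∀ {u v} → v ∈ nb u → u ∈ nb v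
  nb-sym {u} {v} v∈ = ∈-filterᵇ _ (sideL (not (sd v)))
    (subst (λ b → u ∈ sideL b) (sym (trans (cong not (nb-sd v∈)) (not-involutive (sd u)))) (∈sideL u))
    (trans (adj-sym u v) (nb-adj v∈))

  -- The roots w l are not arms: to keep the web away from them, put them into X.
  record Web {s : ℕ} (ρ : Fin s → ℕ) (w : Fin s → Vx) (X : List Vx) : Set where
    field
      center   : Vx
      arm      : Fin s → List Vx
      arm-leg  : ∀ l → Leg center (ρ l) (w l ∷ arm l)
      center∉X : center ∉ X
      arm∉X    : ∀ l {x} → x ∈ arm l → x ∉ X
      center∉  : ∀ l → center ∉ arm l
      simple   : ∀ l → Unique (arm l)
      disjoint : ∀ {l l′} → l ≢ l′ → ∀ {x} → x ∈ arm l → x ∉ arm l′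

  -- The web may depend on `X`, of which only the size is limited. This allows both the greedy
  -- choice of disjoint webs and the protection of one more vertex in each prolongation.
  Robust : {s : ℕ} → ℕ → (Fin s → ℕ) → (Fin s → Vx) → Set
  Robust L ρ w = ∀ X → length X ≤ L → Web ρ w X

  -- The old root turns into an inner vertex of its arm. The given web avoids it as a forbidden
  -- vertex, which keeps the arms simple, disjoint and away from the center.
  prolong : {s : ℕ} {ρ ρ′ : Fin s → ℕ} {w w′ : Fin s → Vx} {X : List Vx} (l : Fin s) →
            ρ′ l ≡ suc (ρ l) → (∀ l′ → l ≢ l′ → ρ′ l′ ≡ ρ l′) →
            (∀ l′ → l ≢ l′ → w′ l′ ≡ w l′) → w′ l ∈ nb (w l) → w l ∉ X →
            Web ρ w (w l ∷ X) → Web ρ′ w′ X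
  prolong {ρ = ρ} {ρ′} {w} {w′} {X} l e e′ ew adj∈ new W = record
    { center = center ; arm = arm′ ; arm-leg = leg′ ; center∉X = center∉X ∘ there
    ; arm∉X = out ; center∉ = cen ; simple = simp ; disjoint = disj }
    where
    open Web W
    arm′ : Fin _ → List Vx
    arm′ l′ with l Fin.≟ l′
    ... | yes _ = w l ∷ arm l
    ... | no _  = arm l′
    leg′ : ∀ l′ → Leg center (ρ′ l′) (w′ l′ ∷ arm′ l′)
    leg′ l′ with l Fin.≟ l′
    ... | yes refl = subst (λ i → Leg center i (w′ l ∷ w l ∷ arm l)) (sym e) (adj∈ ∷ arm-leg l)
    ... | no ne     = subst₂ (λ i v → Leg center i (v ∷ arm l′)) (sym (e′ l′ ne)) (sym (ew l′ ne)) (arm-leg l′)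
    out : ∀ l′ {x} → x ∈ arm′ l′ → x ∉ X
    out l′ x∈ with l Fin.≟ l′
    out l′ (here refl) | yes _ = new
    out l′ (there x∈)  | yes _ = arm∉X l x∈ ∘ there
    out l′ x∈          | no _  = arm∉X l′ x∈ ∘ there
    cen : ∀ l′ → center ∉ arm′ l′
    cen l′ c∈ with l Fin.≟ l′
    cen l′ (here eq)  | yes _ = center∉X (here eq)
    cen l′ (there c∈) | yes _ = center∉ l c∈
    cen l′ c∈         | no _  = center∉ l′ c∈
    simp : ∀ l′ → Unique (arm′ l′)
    simp l′ with l Fin.≟ l′
    ... | yes _ = All.tabulate (λ x∈ eq → arm∉X l x∈ (here (sym eq))) AllPairs.∷ simple l
    ... | no _  = simple l′
    disj : ∀ {l₁ l₂} → l₁ ≢ l₂ → ∀ {x} → x ∈ arm′ l₁ → x ∉ arm′ l₂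
    disj {l₁} {l₂} ne x∈ y∈ with l Fin.≟ l₁ | l Fin.≟ l₂
    disj ne x∈ y∈ | yes refl | yes refl = ne refl
    disj {l₁} {l₂} ne (here refl) y∈ | yes refl | no _ = arm∉X l₂ y∈ (here refl)
    disj ne (there x∈) y∈ | yes refl | no _ = disjoint ne x∈ y∈
    disj {l₁} ne x∈ (here refl) | no _ | yes refl = arm∉X l₁ x∈ (here refl)
    disj ne x∈ (there y∈) | no _ | yes refl = disjoint ne x∈ y∈
    disj ne x∈ y∈ | no _ | no _ = disjoint ne x∈ y∈

  center∈vertices : ∀ {s} y (ls : Vec (List Vx) s) → y ∈ vertices y ls
  center∈vertices y []       = here refl
  center∈vertices y (a ∷ as) = ∈-++⁺ʳ a (center∈vertices y as)

  leg⊆vertices : ∀ {s} y (ls : Vec (List Vx) s) l {x} → x ∈ lookup ls l → x ∈ vertices y ls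
  leg⊆vertices y (a ∷ as) zero    x∈ = ∈-++⁺ˡ x∈
  leg⊆vertices y (a ∷ as) (suc l) x∈ = ∈-++⁺ʳ a (leg⊆vertices y as l x∈)

  legs-simple : ∀ {s} y (ls : Vec (List Vx) s) → Unique (vertices y ls) → ∀ l → Unique (lookup ls l)
  legs-simple y (a ∷ as) u zero    = proj₁ (Unique-++ a _ u)
  legs-simple y (a ∷ as) u (suc l) = legs-simple y as (proj₁ (proj₂ (Unique-++ a _ u))) l

  center∉legs : ∀ {s} y (ls : Vec (List Vx) s) → Unique (vertices y ls) → ∀ l → y ∉ lookup ls l
  center∉legs y (a ∷ as) u zero    y∈ = proj₂ (proj₂ (Unique-++ a _ u)) y∈ (center∈vertices y as)
  center∉legs y (a ∷ as) u (suc l) y∈ = center∉legs y as (proj₁ (proj₂ (Unique-++ a _ u))) l y∈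

  legs-disjoint : ∀ {s} y (ls : Vec (List Vx) s) → Unique (vertices y ls) →
                  ∀ {l l′} → l ≢ l′ → ∀ {x} → x ∈ lookup ls l → x ∉ lookup ls l′
  legs-disjoint y (a ∷ as) u {zero}  {zero}   ne x∈ y∈ = ne refl
  legs-disjoint y (a ∷ as) u {zero}  {suc l′} ne x∈ y∈ = proj₂ (proj₂ (Unique-++ a _ u)) x∈ (leg⊆vertices y as l′ y∈)
  legs-disjoint y (a ∷ as) u {suc l} {zero}   ne x∈ y∈ = proj₂ (proj₂ (Unique-++ a _ u)) y∈ (leg⊆vertices y as l x∈)
  legs-disjoint y (a ∷ as) u {suc l} {suc l′} ne x∈ y∈ =
    legs-disjoint y as (proj₁ (proj₂ (Unique-++ a _ u))) (ne ∘ cong suc) x∈ y∈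

-- Takes one double move off the outstanding ones, with the sum as induction measure; `unset` does
-- the same for single moves.
pop : ∀ {s} (e : Vec ℕ s) → (∀ l → lookup e l ≡ 0) ⊎ (∃ λ l → ∃ λ e′ → e ≡ updateAt e′ l suc × Vec.sum e ≡ suc (Vec.sum e′))
pop []           = inj₁ λ ()
pop (suc x ∷ e)  = inj₂ (zero , x ∷ e , refl , refl)
pop (zero ∷ e) with pop e
... | inj₁ z = inj₁ λ { zero → refl ; (suc l) → z l }
... | inj₂ (l , e′ , p , q) = inj₂ (suc l , zero ∷ e′ , cong (zero ∷_) p , q)

tally : ∀ {s} → Vec Bool s → ℕ
tally []       = 0
tally (x ∷ xs) = ⟦ x ⟧ + tally xs

tally≤ : ∀ {s} (ct : Vec Bool s) → tally ct ≤ s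
tally≤ []       = z≤n
tally≤ (x ∷ xs) = +-mono-≤ (⟦⟧≤1 x) (tally≤ xs)

unset : ∀ {s} (ct : Vec Bool s) → (∀ l → lookup ct l ≡ false) ⊎
        (∃ λ l → ∃ λ ct′ → ct ≡ ct′ [ l ]≔ true × lookup ct′ l ≡ false × tally ct ≡ suc (tally ct′))
unset []         = inj₁ λ ()
unset (true ∷ c) = inj₂ (zero , false ∷ c , refl , refl , refl)
unset (false ∷ c) with unset c
... | inj₁ z = inj₁ λ { zero → refl ; (suc l) → z l }
... | inj₂ (l , c′ , p , q , r) = inj₂ (suc l , false ∷ c′ , cong (false ∷_) p , q , r)

module Raise {m n : ℕ} (G : BipGraph m n) (D : Bool → ℕ) (deg≤ : ∀ u → length (Graph.nb G u) ≤ D (Graph.sd G u))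
             {s : ℕ} (b : Bool) (is : Vec ℕ s) (c′ c a₀ b₀ : ℕ) (1≤is : ∀ l → 1 ≤ lookup is l) where
  open Graph G
  open GraphCounts G
  open Counts D deg≤
  open Hits G
  open Webs G
  open Rounds G D deg≤ b is c′ c a₀ b₀
  open Avoid G D deg≤ b is c′ c a₀ b₀ 1≤is

  second : Star s → Fin s → Vx
  second σ l = at (cut l 1 σ) l

  -- `ct` marks the legs whose root currently stands on the second vertex.
  root : Star s → (Fin s → Bool) → Fin s → Vx
  root σ ct l = if ct l then second σ l else at σ l

  -- The invariant of the moves. A move makes one entry of `ρ` larger by 1, adds 1 to the round `j`
  -- and takes 1 from the size `L` of the sets that can be avoided.
  Raised : ℕ → ℕ → (Fin s → ℕ) → (Fin s → Bool) → Set
  Raised j L ρ ct = ∀ σ → IsStar is σ → T j σ ≡ true → Robust L ρ (root σ ct)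

  T-class : ∀ j σ → T (suc j) σ ≡ true → a₀ ≤ class j (heads σ)
  T-class j σ t = does-true (a₀ ≤? class j (heads σ)) (proj₁ (∧-true (proj₂ (∧-true {T j σ} t))))

  T-fan : ∀ j σ → T (suc j) σ ≡ true → ∀ l → b₀ ≤ fan j l σ
  T-fan j σ t l = ≮⇒≥ (does-false (fan j l σ <? b₀)
    (any-false _ (allFin s) (not-true (proj₂ (∧-true {does (a₀ ≤? class j (heads σ))} (proj₂ (∧-true {T j σ} t))))) (∈-allFin l)))

  leg-∷ : ∀ {y ls} → IsStar is (y , ls) → ∀ l → lookup ls l ≡ hd y (lookup ls l) ∷ drop 1 (lookup ls l)
  leg-∷ {y} {ls} st l with lookup ls l | st l
  ... | []    | lf = ⊥-elim (<⇒≢ (1≤is l) (Leg-length lf))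
  ... | _ ∷ _ | _  = refl

  second-nb : ∀ σ → IsStar is σ → ∀ l → at σ l ∈ nb (second σ l)
  second-nb (y , ls) st l rewrite Vec.lookup∘updateAt l {f = drop 1} ls with lookup ls l | lookup is l | st l | 1≤is l
  ... | []    | .0 | [] | ()
  ... | v ∷ f | suc i | v∈ ∷ _ | _ = v∈

  repl-star : ∀ σ → IsStar is σ → ∀ l {v} → v ∈ nb (second σ l) → IsStar is (repl l v σ)
  repl-star (y , ls) st l {v} v∈ l′ with l′ Fin.≟ l
  ... | no ne = subst (Leg y (lookup is l′)) (sym (Vec.lookup∘updateAt′ l′ l ne ls)) (st l′)
  ... | yes refl rewrite Vec.lookup∘updateAt l {f = drop 1} ls | Vec.lookup∘updateAt l {f = λ a → v ∷ drop 1 a} ls with lookup ls l | lookup is l | st l | 1≤is l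
  ...   | []    | .0 | [] | ()
  ...   | u ∷ f | suc i | _ ∷ lf | _ = v∈ ∷ lf

  repl-root : ∀ σ l v ct → ct l ≡ false → root (repl l v σ) ct l ≡ v
  repl-root (y , ls) l v ct e rewrite e | Vec.lookup∘updateAt l {f = λ a → v ∷ drop 1 a} ls = refl

  repl-root′ : ∀ σ l v ct ct′ l′ → l ≢ l′ → ct l′ ≡ ct′ l′ → root (repl l v σ) ct l′ ≡ root σ ct′ l′
  repl-root′ (y , ls) l v ct ct′ l′ ne e rewrite e with ct′ l′
  ... | false = cong (hd y) (Vec.lookup∘updateAt′ l′ l (ne ∘ sym) ls)
  ... | true  = cong (hd y) (trans (Vec.lookup∘updateAt l′ (updateAt ls l _))
      (trans (cong (drop 1) (Vec.lookup∘updateAt′ l′ l (ne ∘ sym) ls)) (sym (Vec.lookup∘updateAt l′ ls))))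

  heads-root : ∀ σ τ ct l → heads τ ≡ heads σ → ct l ≡ false → root τ ct l ≡ at σ l
  heads-root σ τ ct l e e′ rewrite e′ = trans (sym (at-heads τ l)) (trans (cong (λ v̄ → lookup v̄ l) e) (at-heads σ l))

  Raised-weaken : ∀ {j L ρ ct} → Raised j L ρ ct → Raised (suc j) L ρ ct
  Raised-weaken {j} Q σ st t = Q σ st (proj₁ (∧-true {T j σ} t))

  Raised-≤ : ∀ {j j′ L ρ ct} → j ≤ j′ → Raised j L ρ ct → Raised j′ L ρ ct
  Raised-≤ {zero}  {zero}   z≤n Q = Q
  Raised-≤ {j} {suc j′} le Q with m≤n⇒m<n∨m≡n le
  ... | inj₁ lt   = Raised-weaken {j′} (Raised-≤ {j} {j′} (≤-pred lt) Q)
  ... | inj₂ refl = Q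

  Web-cong : ∀ {ρ ρ′ : Fin s → ℕ} {w w′ : Fin s → Vx} {X} → (∀ l → ρ l ≡ ρ′ l) → (∀ l → w l ≡ w′ l) → Web ρ w X → Web ρ′ w′ X
  Web-cong e e′ W = record { center = center ; arm = arm
    ; arm-leg = λ l → subst₂ (λ i v → Leg center i (v ∷ arm l)) (e l) (e′ l) (arm-leg l)
    ; center∉X = center∉X ; arm∉X = arm∉X ; center∉ = center∉ ; simple = simple ; disjoint = disjoint }
    where open Web W

  Raised-cong : ∀ {j L ρ ρ′ ct ct′} → (∀ l → ρ l ≡ ρ′ l) → (∀ l → ct l ≡ ct′ l) → Raised j L ρ ct → Raised j L ρ′ ct′
  Raised-cong {ct = ct} {ct′} e e′ Q σ st t X le = Web-cong e (λ l → cong (λ x → if x then second σ l else at σ l) (e′ l)) (Q σ st t X le)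

  -- `Lm` caps the forbidden sets of all moves: by `Lm-hit` a class contains a companion off the
  -- set, by `Lm<b₀` a fan contains a root off it.
  module _ (Lm : ℕ) (Lm-hit : Lm * hit < a₀) (Lm<b₀ : Lm < b₀) where

    many : ∀ j σ (X : List Vx) → T (suc j) σ ≡ true → length X ≤ Lm → length X * hit < class j (heads σ)
    many j σ X t le = ≤-<-trans (*-monoˡ-≤ hit le) (<-≤-trans Lm-hit (T-class j σ t))

    -- A companion on the same roots is itself a web of the original lengths, with its legs stripped
    -- of their roots as arms.
    Raised-base : ∀ {L} → L ≤ Lm → Raised 1 L (lookup is) (λ _ → false)
    Raised-base L≤ σ st t X le = from-star (avoid 0 (heads σ) X (many 0 σ X t (≤-trans le L≤)))
     where
     from-star : Avoiding 0 (heads σ) X → Web (lookup is) (root σ (λ _ → false)) X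
     from-star ((y , ls) , st′ , t′ , h , y∉ , out) = record
      { center = y ; arm = λ l → drop 1 (lookup ls l)
      ; arm-leg = λ l → subst (Leg y (lookup is l)) (trans (leg-∷ {y} {ls} st′ l) (cong (_∷ drop 1 (lookup ls l)) (heads-root σ (y , ls) (λ _ → false) l h refl))) (st′ l)
      ; center∉X = y∉
      ; arm∉X = λ l x∈ → avoids l x∈
      ; center∉ = λ l y∈ → center∉legs y ls uniq l (tail⊆ _ y∈)
      ; simple = λ l → tail-Unique _ (legs-simple y ls uniq l)
      ; disjoint = λ ne x∈ y∈ → legs-disjoint y ls uniq ne (tail⊆ _ x∈) (tail⊆ _ y∈) }
      where
      uniq = distinct-Unique y ls (proj₁ (good⇒ (y , ls) t′))
      tail⊆ : ∀ (f : List Vx) {x} → x ∈ drop 1 f → x ∈ f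
      tail⊆ (_ ∷ f) x∈ = there x∈
      tail-Unique : ∀ (f : List Vx) → Unique f → Unique (drop 1 f)
      tail-Unique [] u = u
      tail-Unique (_ ∷ f) (_ AllPairs.∷ u) = u
      avoids : ∀ l {x} → x ∈ drop 1 (lookup ls l) → x ∉ X
      avoids l {x} x∈ with ∈-drop (drop 1 (lookup ls l)) x∈
      ... | i , i< , g , e = subst (_∉ X) (trans (cong (hd y) (Vec.lookup∘updateAt l ls)) (cong (hd y) (trans (drop-suc i (lookup ls l)) e)))
              (out l i (subst (suc i <_) (trans (cong length (sym (leg-∷ {y} {ls} st′ l))) (Leg-length (st′ l))) (s≤s i<)))
        where
        drop-suc : ∀ i (f : List Vx) → drop (suc i) f ≡ drop i (drop 1 f)
        drop-suc zero    []      = refl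
        drop-suc (suc i) []      = refl
        drop-suc i       (x ∷ f) = refl

    -- The root moves to its neighbour on the leg; a new neighbour of it takes its former place.
    descend : ∀ {j L ρ ρ′ ct ct′} l → ct l ≡ false → ct′ l ≡ true → (∀ l′ → l ≢ l′ → ct l′ ≡ ct′ l′) →
              ρ′ l ≡ suc (ρ l) → (∀ l′ → l ≢ l′ → ρ′ l′ ≡ ρ l′) → suc L ≤ Lm →
              Raised j (suc L) ρ ct → Raised (suc j) L ρ′ ct′
    descend {j} {L} {ρ} {ρ′} {ct} {ct′} l e₁ e₂ ect e eρ L< Q σ st t X le =
      let v , v∈ , q = pigeonhole (nb (second σ l)) (λ v → ⟦ T j (repl l v σ) ⟧) (λ v → ⟦ v ∈ᵇ X ⟧)
                          (≤-<-trans (∑-nb∈ (second σ l) X) (≤-<-trans (≤-trans le (≤-trans (n≤1+n L) L<)) (<-≤-trans Lm<b₀ (T-fan j σ t l))))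
          r≡ = repl-root σ l v ct e₁
          v∉ = ∈ᵇ-false X (⟦⟧-zero (v ∈ᵇ X) (<-≤-trans q (⟦⟧≤1 _)))
          W  = Q (repl l v σ) (repl-star σ st l v∈) (⟦⟧-positive (T j (repl l v σ)) (≤-<-trans z≤n q)) (root (repl l v σ) ct l ∷ X) (s≤s le)
      in prolong l e eρ (λ l′ ne → sym (repl-root′ σ l v ct ct′ l′ ne (ect l′ ne)))
           (subst₂ (λ x y → x ∈ nb y) (sym (second-root e₂)) (sym r≡) (nb-sym v∈))
           (subst (_∉ X) (sym r≡) v∉) W
      where
      second-root : ct′ l ≡ true → root σ ct′ l ≡ second σ l
      second-root e rewrite e = refl

    -- The root moves back: another star on the same heads supplies a new second vertex.
    ascend : ∀ {j L ρ ρ′} ct l → ct l ≡ true → (∀ l′ → l ≢ l′ → ct l′ ≡ false) →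
             ρ′ l ≡ suc (ρ l) → (∀ l′ → l ≢ l′ → ρ′ l′ ≡ ρ l′) → suc L ≤ Lm →
             Raised j (suc L) ρ ct → Raised (suc j) L ρ′ (λ _ → false)
    ascend {j} {L} {ρ} {ρ′} ct l e₁ ect e eρ L< Q σ st t X le = from-star (avoid j (heads σ) X (many j σ X t (≤-trans le (≤-trans (n≤1+n L) L<))))
     where
     from-star : Avoiding j (heads σ) X → Web ρ′ (root σ (λ _ → false)) X
     from-star (τ , st′ , t′ , h , y∉ , out) =
      prolong l e eρ (λ l′ ne → sym (heads-root σ τ ct l′ h (ect l′ ne)))
        (subst₂ (λ x y → x ∈ nb y) (heads-root σ τ (λ _ → false) l h refl) (sym sec) (second-nb τ st′ l))
        (subst (_∉ X) (sym sec) sec∉)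
        (Q τ st′ t′ (root τ ct l ∷ X) (s≤s le))
      where
      sec : root τ ct l ≡ second τ l
      sec rewrite e₁ = refl
      sec∉ : second τ l ∉ X
      sec∉ with m≤n⇒m<n∨m≡n (1≤is l)
      ... | inj₁ lt = out l 0 lt
      -- On a leg of length 1 the second vertex is the center, about which `out` says nothing.
      ... | inj₂ eq = subst (_∉ X) (sym (trans (cong (λ i → at (cut l i τ) l) eq) (at-center τ st′ l))) y∉

    private
      single : Fin s → Fin s → Bool
      single l l′ = does (l Fin.≟ l′)

    -- Each descent is followed at once by the ascent of the same leg. The ascent passes to a
    -- companion, which agrees with the star in its heads only, so no other root may be off its head
    -- at that time.
    Raised-even : ∀ N e {L} → Vec.sum e ≡ N → L + 2 * N ≤ Lm →
                  Raised (1 + 2 * N) L (λ l → lookup is l + 2 * lookup e l) (λ _ → false)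
    Raised-even N e {L} eN le with pop e
    ... | inj₁ z = Raised-≤ {1} {1 + 2 * N} {ct = λ _ → false} (s≤s z≤n) (Raised-cong {1} {ct = λ _ → false} {λ _ → false} (λ l → trans (sym (+-identityʳ _)) (cong (λ x → lookup is l + 2 * x) (sym (z l)))) (λ _ → refl)
                     (Raised-base (≤-trans (m≤m+n L _) le)))
    Raised-even zero e eN le | inj₂ (l , e′ , p , q) with trans (sym eN) q
    ... | ()
    Raised-even (suc N) e {L} eN le | inj₂ (l , e′ , p , q) = subst (λ j → Raised j L (λ l → lookup is l + 2 * lookup e l) (λ _ → false)) (lem N)
      (ascend {j = 2 + 2 * N} (single l) l (true-does (l Fin.≟ l) refl) (λ l′ ne → false-does (l Fin.≟ l′) ne)
        (trans (cong (λ x → lookup is l + 2 * x) (trans (cong (λ e → lookup e l) p) (Vec.lookup∘updateAt l e′))) (trans (lem₂ (lookup is l) (lookup e′ l)) (cong suc (sym mid-l))))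
        (λ l′ ne → trans (cong (λ e → lookup is l′ + 2 * lookup e l′) p) (trans (cong (λ x → lookup is l′ + 2 * x) (Vec.lookup∘updateAt′ l′ l (ne ∘ sym) e′)) (sym (mid-ne l′ ne))))
        (≤-trans (s≤s (m≤m+n L (1 + 2 * N))) (≤-trans (≤-reflexive (lem₃ L N)) le))
        (descend {j = 1 + 2 * N} {ρ = λ l → lookup is l + 2 * lookup e′ l} {ρ′ = mid} {ct = λ _ → false} {ct′ = single l} l refl (true-does (l Fin.≟ l) refl) (λ l′ ne → sym (false-does (l Fin.≟ l′) ne))
          mid-l mid-ne
          (≤-trans (s≤s (s≤s (m≤m+n L (2 * N)))) (≤-trans (≤-reflexive (lem₄ L N)) le))
          (Raised-even N e′ (suc-injective (trans (sym q) eN)) (≤-trans (≤-reflexive (lem₄ L N)) le))))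
      where
      mid : Fin s → ℕ
      mid l′ = ⟦ single l l′ ⟧ + (lookup is l′ + 2 * lookup e′ l′)
      mid-l : mid l ≡ suc (lookup is l + 2 * lookup e′ l)
      mid-l rewrite true-does (l Fin.≟ l) refl = refl
      mid-ne : ∀ l′ → l ≢ l′ → mid l′ ≡ lookup is l′ + 2 * lookup e′ l′
      mid-ne l′ ne rewrite false-does (l Fin.≟ l′) ne = refl
      lem : ∀ N → 3 + 2 * N ≡ 1 + 2 * (1 + N)
      lem = solve-∀
      lem₂ : ∀ i e → i + 2 * (1 + e) ≡ 2 + (i + 2 * e)
      lem₂ = solve-∀
      lem₃ : ∀ L N → 1 + (L + (1 + 2 * N)) ≡ L + 2 * (1 + N)
      lem₃ = solve-∀
      lem₄ : ∀ L N → 2 + (L + 2 * N) ≡ L + 2 * (1 + N)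
      lem₄ = solve-∀

    -- The legs with an odd defect descend once more, at the very end. Descents on distinct legs do
    -- not disturb each other, since a new root leaves the second vertices in place.
    Raised-all : ∀ t ct e {L} → tally ct ≡ t → L + (t + 2 * Vec.sum e) ≤ Lm →
                 Raised (1 + (t + 2 * Vec.sum e)) L (λ l → lookup is l + 2 * lookup e l + ⟦ lookup ct l ⟧) (lookup ct)
    Raised-all t ct e {L} et le with unset ct
    ... | inj₁ z = Raised-≤ {1 + 2 * Vec.sum e} {1 + (t + 2 * Vec.sum e)} {ct = lookup ct} (s≤s (m≤n+m _ t)) (Raised-cong {1 + 2 * Vec.sum e} {ct = λ _ → false} {lookup ct} (λ l → sym (trans (cong (λ x → _ + ⟦ x ⟧) (z l)) (+-identityʳ _))) (λ l → sym (z l))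
                     (Raised-even (Vec.sum e) e refl (≤-trans (+-monoʳ-≤ L (m≤n+m _ t)) le)))
    Raised-all zero ct e et le | inj₂ (l , ct′ , p , q , r) with trans (sym et) r
    ... | ()
    Raised-all (suc t) .(ct′ [ l ]≔ true) e {L} et le | inj₂ (l , ct′ , refl , q , r) =
      descend {j = 1 + (t + 2 * Vec.sum e)} {ρ = λ l → lookup is l + 2 * lookup e l + ⟦ lookup ct′ l ⟧} {ct = lookup ct′} l q (Vec.lookup∘updateAt l ct′)
        (λ l′ ne → sym (Vec.lookup∘updateAt′ l′ l (ne ∘ sym) ct′))
        (trans (cong (λ x → lookup is l + 2 * lookup e l + ⟦ x ⟧) (Vec.lookup∘updateAt l ct′))
           (trans (lem (lookup is l + 2 * lookup e l)) (cong (λ x → suc (lookup is l + 2 * lookup e l + ⟦ x ⟧)) (sym q))))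
        (λ l′ ne → cong (λ x → lookup is l′ + 2 * lookup e l′ + ⟦ x ⟧) (Vec.lookup∘updateAt′ l′ l (ne ∘ sym) ct′))
        (≤-trans (s≤s (m≤m+n L _)) (≤-trans (≤-reflexive (sym (+-suc L _))) le))
        (Raised-all t ct′ e (suc-injective (trans (sym r) et)) (≤-trans (≤-reflexive (sym (+-suc L _))) le))
      where
      lem : ∀ i → i + 1 ≡ 1 + (i + 0)
      lem = solve-∀

-- Greedy disjoint choice and the embedding of the subdivision.

length-concatMap : {A B : Set} (g : A → List B) (xs : List A) → length (concatMap g xs) ≡ ∑ xs (length ∘ g)
length-concatMap g xs = trans (sym (∑1 (concatMap g xs))) (trans (∑-concatMap g xs (λ _ → 1)) (∑-cong xs λ x → ∑1 (g x)))

∈-concatMap-intro : {A B : Set} (g : A → List B) {xs : List A} {x : A} {y : B} → x ∈ xs → y ∈ g x → y ∈ concatMap g xs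
∈-concatMap-intro g {x ∷ xs} (here refl) y∈ = ∈-++⁺ˡ y∈
∈-concatMap-intro g {x ∷ xs} (there x∈)  y∈ = ∈-++⁺ʳ (g x) (∈-concatMap-intro g x∈ y∈)

-- Every choice adds at most `B` entries to the forbidden list, which therefore stays within `L` for
-- all `K` choices.
greedy : {U : Set} (K : ℕ) (A : Fin K → Set) (vs : ∀ q → A q → List U) (B L : ℕ) (X₀ : List U) →
         (∀ q a → length (vs q a) ≤ B) →
         (∀ q X → length X ≤ L → Σ (A q) λ a → ∀ {x} → x ∈ vs q a → x ∉ X) →
         length X₀ + K * B ≤ L →
         Σ (∀ q → A q) λ ch → (∀ q {x} → x ∈ vs q (ch q) → x ∉ X₀) ×
                              (∀ q q′ → q ≢ q′ → ∀ {x} → x ∈ vs q (ch q) → x ∉ vs q′ (ch q′))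
greedy zero    A vs B L X₀ short pick le = (λ ()) , (λ ()) , λ ()
greedy (suc K) A vs B L X₀ short pick le = ch′ , out′ , disj′
  where
  a₀ = pick zero X₀ (≤-trans (m≤m+n (length X₀) _) le)
  Y = vs zero (proj₁ a₀)
  rest = greedy K (A ∘ suc) (λ q → vs (suc q)) B L (Y ++ X₀) (short ∘ suc) (pick ∘ suc)
    (≤-trans (≤-reflexive (cong (_+ K * B) (length-++ Y))) (≤-trans (+-monoˡ-≤ (K * B) (+-monoˡ-≤ (length X₀) (short zero (proj₁ a₀))))
      (≤-trans (≤-reflexive (lem B (length X₀) (K * B))) le)))
    where
    lem : ∀ b x k → b + x + k ≡ x + (b + k)
    lem = solve-∀
  ch = proj₁ rest
  out = proj₁ (proj₂ rest)
  disj = proj₂ (proj₂ rest)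
  ch′ : ∀ q → A q
  ch′ zero    = proj₁ a₀
  ch′ (suc q) = ch q
  out′ : ∀ q {x} → x ∈ vs q (ch′ q) → x ∉ X₀
  out′ zero    x∈ = proj₂ a₀ x∈
  out′ (suc q) x∈ y∈ = out q x∈ (∈-++⁺ʳ Y y∈)
  disj′ : ∀ q q′ → q ≢ q′ → ∀ {x} → x ∈ vs q (ch′ q) → x ∉ vs q′ (ch′ q′)
  disj′ zero    zero     ne x∈ y∈ = ne refl
  disj′ zero    (suc q′) ne x∈ y∈ = out q′ y∈ (∈-++⁺ˡ x∈)
  disj′ (suc q) zero     ne x∈ y∈ = out q x∈ (∈-++⁺ˡ y∈)
  disj′ (suc q) (suc q′) ne x∈ y∈ = disj q q′ (ne ∘ cong suc) x∈ y∈

module Embed {m n : ℕ} (G : BipGraph m n) where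
  open Graph G
  open Webs G

  -- The default past the end of the list matters: for a path it is the branch vertex at the center
  -- of the leg.
  nth : Vx → List Vx → ℕ → Vx
  nth d []      x       = d
  nth d (v ∷ f) zero    = v
  nth d (v ∷ f) (suc x) = nth d f x

  nth-beyond : ∀ d f x → length f ≤ x → nth d f x ≡ d
  nth-beyond d []      x       le       = refl
  nth-beyond d (v ∷ f) (suc x) (s≤s le) = nth-beyond d f x le

  nth-∈ : ∀ d f x → x < length f → nth d f x ∈ f
  nth-∈ d (v ∷ f) zero    lt       = here refl
  nth-∈ d (v ∷ f) (suc x) (s≤s lt) = there (nth-∈ d f x lt)

  nth-injective : ∀ d f x y → Unique f → x < length f → y < length f → nth d f x ≡ nth d f y → x ≡ y
  nth-injective d (v ∷ f) zero    zero    u lt lt′ e = refl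
  nth-injective d (v ∷ f) zero    (suc y) (v∉ AllPairs.∷ u) lt (s≤s lt′) e = ⊥-elim (All.lookup v∉ (nth-∈ d f y lt′) e)
  nth-injective d (v ∷ f) (suc x) zero    (v∉ AllPairs.∷ u) (s≤s lt) lt′ e = ⊥-elim (All.lookup v∉ (nth-∈ d f x lt) (sym e))
  nth-injective d (v ∷ f) (suc x) (suc y) (v∉ AllPairs.∷ u) (s≤s lt) (s≤s lt′) e = cong suc (nth-injective d f x y u lt lt′ e)

  nth-adj : ∀ {d j f} → Leg d j f → ∀ x → x < j → adj (nth d f x) (nth d f (suc x)) ≡ true
  nth-adj {d} {f = v ∷ f} (v∈ ∷ l) zero lt = trans (cong (adj v) (start f)) (nb-adj v∈)
    where
    start : ∀ f → nth d f zero ≡ hd d f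
    start []      = refl
    start (_ ∷ _) = refl
  nth-adj (v∈ ∷ l) (suc x) (s≤s lt) = nth-adj l x lt

  -- A leg with center `b j` and root `a i` is listed from the root, hence reads as a path from `i`
  -- to `j` with inner vertices `q i j l`.
  embed : ∀ {s t k r} → 1 ≤ k → (a : Fin s → Vx) (b : Fin t → Vx) (q : Fin s → Fin t → Fin r → List Vx) →
    (∀ i j l → Leg (b j) (2 * k) (a i ∷ q i j l)) →
    (∀ i i′ → a i ≡ a i′ → i ≡ i′) → (∀ j j′ → b j ≡ b j′ → j ≡ j′) → (∀ i j → a i ≢ b j) →
    (∀ i j l → Unique (q i j l)) →
    (∀ i j l i′ → a i′ ∉ q i j l) → (∀ i j l j′ → b j′ ∉ q i j l) →
    (∀ p p′ → p ≢ p′ → let i , j , l = p ; i′ , j′ , l′ = p′ in ∀ {x} → x ∈ q i j l → x ∉ q i′ j′ l′) →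
    ContainsSubdiv G s t k r
  embed {s} {t} {k} {r} 1≤k a b q legs a-inj b-inj a≢b simple a∉ b∉ disj = record { φ = φ ; φ-inj = λ {x} {y} → inj x y ; φ-edges = edges′ }
    where
    len : ∀ i j l → length (q i j l) ≡ 2 * k ∸ 1
    len i j l = cong (_∸ 1) (Leg-length (legs i j l))
    φ : HVert s t k r → Vx
    φ (inj₁ i)                       = a i
    φ (inj₂ (inj₁ j))                = b j
    φ (inj₂ (inj₂ (i , j , l , x)))  = nth (b j) (q i j l) (toℕ x)
    x< : ∀ i j l (x : Fin (2 * k ∸ 1)) → toℕ x < length (q i j l)
    x< i j l x = subst (toℕ x <_) (sym (len i j l)) (toℕ<n x)
    φ∈ : ∀ i j l x → φ (inj₂ (inj₂ (i , j , l , x))) ∈ q i j l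
    φ∈ i j l x = nth-∈ (b j) (q i j l) (toℕ x) (x< i j l x)
    inj : ∀ x y → φ x ≡ φ y → x ≡ y
    inj (inj₁ i) (inj₁ i′) e = cong inj₁ (a-inj i i′ e)
    inj (inj₁ i) (inj₂ (inj₁ j)) e = ⊥-elim (a≢b i j e)
    inj (inj₁ i) (inj₂ (inj₂ (i′ , j′ , l′ , x))) e = ⊥-elim (a∉ i′ j′ l′ i (subst (_∈ _) (sym e) (φ∈ i′ j′ l′ x)))
    inj (inj₂ (inj₁ j)) (inj₁ i) e = ⊥-elim (a≢b i j (sym e))
    inj (inj₂ (inj₁ j)) (inj₂ (inj₁ j′)) e = cong (inj₂ ∘ inj₁) (b-inj j j′ e)
    inj (inj₂ (inj₁ j)) (inj₂ (inj₂ (i′ , j′ , l′ , x))) e = ⊥-elim (b∉ i′ j′ l′ j (subst (_∈ _) (sym e) (φ∈ i′ j′ l′ x)))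
    inj (inj₂ (inj₂ (i , j , l , x))) (inj₁ i′) e = ⊥-elim (a∉ i j l i′ (subst (_∈ _) e (φ∈ i j l x)))
    inj (inj₂ (inj₂ (i , j , l , x))) (inj₂ (inj₁ j′)) e = ⊥-elim (b∉ i j l j′ (subst (_∈ _) e (φ∈ i j l x)))
    inj (inj₂ (inj₂ (i , j , l , x))) (inj₂ (inj₂ (i′ , j′ , l′ , x′))) e with same i i′ j j′ l l′
      where
      same : ∀ (i i′ : Fin s) (j j′ : Fin t) (l l′ : Fin r) → Dec ((i , j , l) ≡ (i′ , j′ , l′))
      same i i′ j j′ l l′ with i Fin.≟ i′ | j Fin.≟ j′ | l Fin.≟ l′
      ... | yes refl | yes refl | yes refl = yes refl
      ... | no ne | _ | _ = no λ { refl → ne refl }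
      ... | _ | no ne | _ = no λ { refl → ne refl }
      ... | _ | _ | no ne = no λ { refl → ne refl }
    ... | no ne    = ⊥-elim (disj (i , j , l) (i′ , j′ , l′) ne (φ∈ i j l x) (subst (_∈ _) (sym e) (φ∈ i′ j′ l′ x′)))
    ... | yes refl = cong (λ x → inj₂ (inj₂ (i , j , l , x)))
        (toℕ-injective (nth-injective (b j) (q i j l) (toℕ x) (toℕ x′) (simple i j l) (x< i j l x) (x< i j l x′) e))
    φ-path : ∀ i j l x → φ (pathVert {s} {t} {k} {r} i j l x) ≡ nth (b j) (a i ∷ q i j l) x
    φ-path i j l zero = refl
    φ-path i j l (suc x) with x <? 2 * k ∸ 1
    ... | yes p = cong (nth (b j) (q i j l)) (toℕ-fromℕ< p)
    ... | no ¬p = sym (nth-beyond (b j) (q i j l) x (≤-trans (≤-reflexive (len i j l)) (≮⇒≥ ¬p)))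
    edges′ : ∀ i j l x → x < 2 * k → Adj G (φ (pathVert {s} {t} {k} {r} i j l x)) (φ (pathVert {s} {t} {k} {r} i j l (suc x)))
    edges′ i j l x lt = adj⇒Adj _ _ (trans (cong₂ adj (φ-path i j l x) (φ-path i j l (suc x))) (nth-adj (legs i j l) x lt))

  -- Prolongs a leg at the other end: the center `y` becomes its innermost vertex and `z` the new
  -- center.
  Leg-snoc : ∀ {y z j f} → Leg y j f → y ∈ nb z → Leg z (suc j) (f ++ y ∷ [])
  Leg-snoc []                      y∈ = y∈ ∷ []
  Leg-snoc {y} {z} (_∷_ {f = f} v∈ l) y∈ = subst (λ u → _ ∈ nb u) (sym (hd-++ z f (y ∷ []))) v∈ ∷ Leg-snoc l y∈

  web-vertices : ∀ {s} {ρ : Fin s → ℕ} {w X} → Web ρ w X → List Vx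
  web-vertices {s} W = Web.center W ∷ concatMap (Web.arm W) (allFin s)

  web-size : ∀ {s} {ρ : Fin s → ℕ} {w X} B → (∀ l → ρ l ≤ B) → (W : Web ρ w X) → length (web-vertices W) ≤ suc (s * B)
  web-size {s} {ρ} B ρ≤ W = s≤s (≤-trans (≤-reflexive (length-concatMap arm (allFin s)))
    (≤-trans (∑-bound (allFin s) B λ l _ → ≤-trans (n≤1+n _) (≤-trans (≤-reflexive (Leg-length (arm-leg l))) (ρ≤ l)))
      (≤-reflexive (cong (_* B) (length-tabulate {n = s} id)))))
    where open Web W

  bare : ∀ {s} {ρ : Fin s → ℕ} {w X} → Web ρ w X → Web ρ w []
  bare W = record { center = center ; arm = arm ; arm-leg = arm-leg ; center∉X = λ () ; arm∉X = λ _ _ ()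
                  ; center∉ = center∉ ; simple = simple ; disjoint = disjoint }
    where open Web W

  robust-pick : ∀ {s} {ρ : Fin s → ℕ} {w L} → Robust L ρ w → ∀ X → length X ≤ L →
                Σ (Web ρ w []) λ W → ∀ {x} → x ∈ web-vertices W → x ∉ X
  robust-pick {s} rb X le = bare W , λ
    { (here refl) → center∉X
    ; (there x∈) → let l , _ , x∈′ = find (∈-concatMap⁻ arm {xs = allFin s} x∈) in arm∉X l x∈′ }
    where
    W = rb X le
    open Web W

  -- The roots form one class of branch vertices, the centers of `t` disjoint webs on them the
  -- other. The forbidden list starts with the `s` roots, and a web adds at most `suc (s * (2 * k))`
  -- vertices.
  subdiv-from-star : ∀ {s t k L} {ρ : Fin s → ℕ} → 1 ≤ k → (w : Fin s → Vx) → (∀ i i′ → w i ≡ w i′ → i ≡ i′) →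
    (∀ l → ρ l ≡ 2 * k) → Robust L ρ w → s + t * suc (s * (2 * k)) ≤ L → ContainsSubdiv G s t k 1
  subdiv-from-star {s} {t} {k} {L} {ρ} 1≤k w w-inj ρ≡ rb le =
    embed 1≤k w (λ j → Web.center (W j)) (λ i j _ → Web.arm (W j) i)
      (λ i j _ → subst (λ d → Leg (Web.center (W j)) d (w i ∷ Web.arm (W j) i)) (ρ≡ i) (Web.arm-leg (W j) i))
      w-inj
      (λ j j′ e → centers-inj j j′ e)
      (λ i j e → out j (here e) (root∈ i) )
      (λ i j _ → Web.simple (W j) i)
      (λ i j _ i′ a∈ → out j (arm∈ j i a∈) (root∈ i′))
      b∉
      arms-disjoint
    where
    X₀ = map w (allFin s)
    chosen = greedy t (λ _ → Web ρ w []) (λ _ → web-vertices) (suc (s * (2 * k))) L X₀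
      (λ _ → web-size (2 * k) (λ l → ≤-reflexive (ρ≡ l))) (λ _ → robust-pick rb)
      (≤-trans (≤-reflexive (cong (_+ t * suc (s * (2 * k))) (trans (length-map w (allFin s)) (length-tabulate {n = s} id)))) le)
    W : Fin t → Web ρ w []
    W = proj₁ chosen
    out₀ = proj₁ (proj₂ chosen)
    disj = proj₂ (proj₂ chosen)
    out : ∀ j {x} → x ∈ web-vertices (W j) → x ∉ X₀
    out = out₀
    root∈ : ∀ i → w i ∈ X₀
    root∈ i = ∈-map⁺ w (∈-allFin i)
    arm∈ : ∀ j i {x} → x ∈ Web.arm (W j) i → x ∈ web-vertices (W j)
    arm∈ j i x∈ = there (∈-concatMap-intro (Web.arm (W j)) (∈-allFin i) x∈)
    centers-inj : ∀ j j′ → Web.center (W j) ≡ Web.center (W j′) → j ≡ j′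
    centers-inj j j′ e with j Fin.≟ j′
    ... | yes eq = eq
    ... | no ne  = ⊥-elim (disj j j′ ne (here refl) (here e))
    b∉ : ∀ i j (l : Fin 1) j′ → Web.center (W j′) ∉ Web.arm (W j) i
    b∉ i j l j′ c∈ with j Fin.≟ j′
    ... | yes refl = Web.center∉ (W j) i c∈
    ... | no ne    = disj j j′ ne (arm∈ j i c∈) (here refl)
    arms-disjoint : ∀ (p p′ : Fin s × Fin t × Fin 1) → p ≢ p′ →
      ∀ {x} → x ∈ Web.arm (W (proj₁ (proj₂ p))) (proj₁ p) → x ∉ Web.arm (W (proj₁ (proj₂ p′))) (proj₁ p′)
    arms-disjoint (i , j , zero) (i′ , j′ , zero) ne x∈ y∈ with j Fin.≟ j′
    ... | no ne′   = disj j j′ ne′ (arm∈ j i x∈) (arm∈ j′ i′ y∈)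
    ... | yes refl = Web.disjoint (W j) (λ { refl → ne refl }) x∈ y∈

  -- A web with arms 1 and 2k - 1 is a path of length 2k whose center is the inner vertex next to
  -- `b j`. All `s * (t * r)` of them are chosen greedily, off the branch vertices.
  subdiv-from-paths : ∀ {s t k r L} {ρ : Fin 2 → ℕ} → 1 ≤ k → (a : Fin s → Vx) (b : Fin t → Vx) (w : Fin s → Fin t → Fin 2 → Vx) →
    (∀ i i′ → a i ≡ a i′ → i ≡ i′) → (∀ j j′ → b j ≡ b j′ → j ≡ j′) → (∀ i j → a i ≢ b j) →
    (∀ i j → w i j zero ≡ b j) → (∀ i j → w i j (suc zero) ≡ a i) →
    ρ zero ≡ 1 → ρ (suc zero) ≡ 2 * k ∸ 1 → (∀ i j → Robust L ρ (w i j)) →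
    s + t + s * (t * r) * suc (2 * (2 * k)) ≤ L → ContainsSubdiv G s t k r
  subdiv-from-paths {s} {t} {k} {r} {L} {ρ} 1≤k a b w a-inj b-inj a≢b w₀ w₁ ρ₀ ρ₁ rb le =
    embed 1≤k a b q legs a-inj b-inj a≢b simp
      (λ i j l i′ a∈ → out (idx i j l) (q⊆ i j l a∈) (∈-++⁺ˡ (∈-map⁺ a (∈-allFin i′))))
      (λ i j l j′ b∈ → out (idx i j l) (q⊆ i j l b∈) (∈-++⁺ʳ (map a (allFin s)) (∈-map⁺ b (∈-allFin j′))))
      (λ (i , j , l) (i′ , j′ , l′) ne x∈ y∈ → disj (idx i j l) (idx i′ j′ l′) (ne ∘ idx-inj i j l i′ j′ l′) (q⊆ i j l x∈) (q⊆ i′ j′ l′ y∈))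
    where
    K = s * (t * r)
    triple : Fin K → Fin s × Fin t × Fin r
    triple x = let p = Fin.remQuot (t * r) x in proj₁ p , Fin.remQuot r (proj₂ p)
    idx : Fin s → Fin t → Fin r → Fin K
    idx i j l = Fin.combine i (Fin.combine j l)
    triple-idx : ∀ i j l → triple (idx i j l) ≡ (i , j , l)
    triple-idx i j l = trans (cong (λ p → proj₁ p , Fin.remQuot r (proj₂ p)) (remQuot-combine {k = t * r} i (Fin.combine j l)))
                             (cong (i ,_) (remQuot-combine {k = r} j l))
    idx-inj : ∀ i j l i′ j′ l′ → idx i j l ≡ idx i′ j′ l′ → (i , j , l) ≡ (i′ , j′ , l′)
    idx-inj i j l i′ j′ l′ e = trans (sym (triple-idx i j l)) (trans (cong triple e) (triple-idx i′ j′ l′))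
    X₀ = map a (allFin s) ++ map b (allFin t)
    X₀-length : length X₀ ≡ s + t
    X₀-length = trans (length-++ (map a (allFin s))) (cong₂ _+_ (trans (length-map a (allFin s)) (length-tabulate {n = s} id)) (trans (length-map b (allFin t)) (length-tabulate {n = t} id)))
    ρ≤ : ∀ l → ρ l ≤ 2 * k
    ρ≤ zero       = ≤-trans (≤-reflexive ρ₀) (≤-trans 1≤k (m≤m+n k _))
    ρ≤ (suc zero) = ≤-trans (≤-reflexive ρ₁) (m∸n≤m (2 * k) 1)
    item : Fin K → Set
    item x = Web ρ (w (proj₁ (triple x)) (proj₁ (proj₂ (triple x)))) []
    chosen = greedy K item (λ _ → web-vertices) (suc (2 * (2 * k))) L X₀
      (λ _ → web-size (2 * k) ρ≤) (λ x → robust-pick (rb (proj₁ (triple x)) (proj₁ (proj₂ (triple x)))))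
      (≤-trans (≤-reflexive (cong (_+ K * suc (2 * (2 * k))) X₀-length)) le)
    W : ∀ x → item x
    W = proj₁ chosen
    out : ∀ x {v} → v ∈ web-vertices (W x) → v ∉ X₀
    out = proj₁ (proj₂ chosen)
    disj = proj₂ (proj₂ chosen)
    q : Fin s → Fin t → Fin r → List Vx
    q i j l = Web.arm (W (idx i j l)) (suc zero) ++ Web.center (W (idx i j l)) ∷ []
    q⊆ : ∀ i j l {v} → v ∈ q i j l → v ∈ web-vertices (W (idx i j l))
    q⊆ i j l v∈ with ∈-++⁻ (Web.arm (W (idx i j l)) (suc zero)) v∈
    ... | inj₁ v∈′        = there (∈-concatMap-intro (Web.arm (W (idx i j l))) (∈-allFin (suc zero)) v∈′)
    ... | inj₂ (here eq) = here eq
    simp : ∀ i j l → Unique (q i j l)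
    simp i j l = snoc (Web.simple (W (idx i j l)) (suc zero)) (Web.center∉ (W (idx i j l)) (suc zero))
      where
      snoc : ∀ {f : List Vx} {y} → Unique f → y ∉ f → Unique (f ++ y ∷ [])
      snoc AllPairs.[] y∉ = [] AllPairs.∷ AllPairs.[]
      snoc {x ∷ f} {y} (x∉ AllPairs.∷ u) y∉ = All.tabulate notx AllPairs.∷ snoc u (y∉ ∘ there)
        where
        notx : ∀ {z} → z ∈ f ++ y ∷ [] → x ≢ z
        notx z∈ eq with ∈-++⁻ f z∈
        ... | inj₁ z∈′ = All.lookup x∉ z∈′ eq
        ... | inj₂ (here refl) = y∉ (here (sym eq))
    legs : ∀ i j l → Leg (b j) (2 * k) (a i ∷ q i j l)
    legs i j l = subst (λ d → Leg (b j) d (a i ∷ q i j l)) (m+[n∸m]≡n (≤-trans 1≤k (m≤m+n k (k + 0))))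
      (Leg-snoc (subst₂ (λ d v → Leg center d (v ∷ arm (suc zero))) ρ₁ (eq₁ (triple-idx i j l)) (arm-leg (suc zero)))
                (nb-sym (subst (_∈ nb center) (eq₀ (triple-idx i j l)) (last ρ₀ (arm-leg zero)))))
      where
      open Web (W (idx i j l))
      eq₁ : ∀ {p} → p ≡ (i , j , l) → w (proj₁ p) (proj₁ (proj₂ p)) (suc zero) ≡ a i
      eq₁ refl = w₁ i j
      eq₀ : ∀ {p} → p ≡ (i , j , l) → w (proj₁ p) (proj₁ (proj₂ p)) zero ≡ b j
      eq₀ refl = w₀ i j
      last : ∀ {d v f} → d ≡ 1 → Leg center d (v ∷ f) → v ∈ nb center
      last refl (v∈ ∷ []) = v∈

-- Bicliques among the stars with a common center.

module Biclique {m n : ℕ} (G : BipGraph m n) where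
  open Graph G
  open GraphCounts G

  -- A counting form of the Kővári-Sós-Turán argument for the bipartite graph `Tr` between the
  -- neighbours of `y` and `Ω`, of density above 1 / F. Different elements of `Ω` may share a root,
  -- so distinct roots need an argument of their own.
  module _ {Om : Set} (y : Vx) (Ω : List Om) (Tr : Vx → Om → Bool) (root : Om → Vx) (d p F : ℕ)
           (A≤ : length (nb y) ≤ d) (Ω≤ : length Ω ≤ p)
           (dense : d * p < F * ∑ (nb y) (λ v → ∑ Ω (λ ω → ⟦ Tr v ω ⟧))) where

    f : Om → ℕ
    f ω = ∑ (nb y) (λ v → ⟦ Tr v ω ⟧)

    card : (Om → Bool) → ℕ
    card q = ∑ Ω (⟦_⟧ ∘ q)

    heavy : Om → Bool
    heavy ω = does (d ≤? 2 * F * f ω)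

    -- Elements of degree below d / 2F carry less than half of the edges that `dense` guarantees;
    -- the rest lies on heavy elements of degree at most `d`.
    many-heavy : p < 2 * F * card heavy
    many-heavy = *-cancelˡ-< d _ _ (+-cancelʳ-< (d * p) _ _ (begin-strict
      d * p + d * p                                      ≡⟨ lem (d * p) ⟩
      2 * (d * p)                                        <⟨ *-monoʳ-< 2 dense ⟩
      2 * (F * ∑ (nb y) (λ v → ∑ Ω (λ ω → ⟦ Tr v ω ⟧)))  ≡⟨ cong (λ x → 2 * (F * x)) (∑-swap (nb y) Ω _) ⟩
      2 * (F * ∑ Ω f)                                    ≡⟨ trans (sym (*-assoc 2 F _)) (sym (∑-*ˡ Ω (2 * F) f)) ⟩
      ∑ Ω (λ ω → 2 * F * f ω)                            ≤⟨ ∑-mono Ω one ⟩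
      ∑ Ω (λ ω → 2 * F * d * ⟦ heavy ω ⟧ + d)            ≡⟨ trans (∑-+ Ω _ _) (cong₂ _+_ (∑-*ˡ Ω (2 * F * d) _) (∑-const Ω d)) ⟩
      2 * F * d * card heavy + length Ω * d              ≤⟨ +-monoʳ-≤ (2 * F * d * card heavy) (≤-trans (*-monoˡ-≤ d Ω≤) (≤-reflexive (*-comm p d))) ⟩
      2 * F * d * card heavy + d * p                     ≡⟨ cong (_+ d * p) (lem₂ F d (card heavy)) ⟩
      d * (2 * F * card heavy) + d * p                   ∎))
      where
      open ≤-Reasoning
      lem : ∀ x → x + x ≡ 2 * x
      lem = solve-∀
      lem₂ : ∀ F d c → 2 * F * d * c ≡ d * (2 * F * c)
      lem₂ = solve-∀
      f≤ : ∀ ω → f ω ≤ d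
      f≤ ω = ≤-trans (∑-mono (nb y) λ v → ⟦⟧≤1 (Tr v ω)) (≤-trans (≤-reflexive (∑1 (nb y))) A≤)
      one : ∀ ω → 2 * F * f ω ≤ 2 * F * d * ⟦ heavy ω ⟧ + d
      one ω = go (d ≤? 2 * F * f ω)
        where
        go : (q : Dec (d ≤ 2 * F * f ω)) → 2 * F * f ω ≤ 2 * F * d * ⟦ does q ⟧ + d
        go (yes _) = ≤-trans (*-monoʳ-≤ (2 * F) (f≤ ω)) (≤-trans (≤-reflexive (sym (*-identityʳ (2 * F * d)))) (m≤m+n _ d))
        go (no q)  = ≤-trans (<⇒≤ (≰⇒> q)) (m≤n+m d _)

    -- An average neighbour is joined to 1 / 2F of the heavy elements in `q`, so `g₁` sums to at
    -- least 4d times `card q`. The penalty in `g₂` exceeds what a member of `Z` could gain, yet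
    -- `g₂` sums to at most 2d times `card q`.
    next : ∀ q Z → (∀ ω → q ω ≡ true → heavy ω ≡ true) → 8 * F * length Z ≤ d → 0 < d → 0 < card q →
           ∃ λ z → z ∈ nb y × z ∉ Z × card q ≤ 8 * F * card (λ ω → q ω ∧ Tr z ω)
    next q Z hv Z≤ 0<d 0<c = from (pigeonhole (nb y) g₁ g₂ lt)
      where
      g₁ g₂ : Vx → ℕ
      g₁ z = 8 * F * card (λ ω → q ω ∧ Tr z ω)
      g₂ z = card q + ⟦ z ∈ᵇ Z ⟧ * (8 * F * card q)
      lt : ∑ (nb y) g₂ < ∑ (nb y) g₁
      lt = begin-strict
        ∑ (nb y) g₂
          ≡⟨ trans (∑-+ (nb y) _ _) (cong₂ _+_ (∑-const (nb y) (card q)) (∑-*ʳ (nb y) (8 * F * card q) _)) ⟩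
        length (nb y) * card q + ∑ (nb y) (λ z → ⟦ z ∈ᵇ Z ⟧) * (8 * F * card q)
          ≤⟨ +-mono-≤ (*-monoˡ-≤ (card q) A≤) (*-monoˡ-≤ (8 * F * card q) (∑-nb∈ y Z)) ⟩
        d * card q + length Z * (8 * F * card q)
          ≡⟨ cong (d * card q +_) (lem (length Z) F (card q)) ⟩
        d * card q + 8 * F * length Z * card q
          ≤⟨ +-monoʳ-≤ (d * card q) (*-monoˡ-≤ (card q) Z≤) ⟩
        d * card q + d * card q
          <⟨ m<m+n _ (≤-trans (*-mono-≤ 0<d 0<c) (m≤m+n (d * card q) (d * card q))) ⟩
        d * card q + d * card q + (d * card q + d * card q)
          ≡⟨ lem₂ (d * card q) ⟩
        4 * (d * card q)
          ≡⟨ cong (4 *_) (trans (sym (∑-*ˡ Ω d _)) refl) ⟩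
        4 * ∑ Ω (λ ω → d * ⟦ q ω ⟧)
          ≤⟨ *-monoʳ-≤ 4 (∑-mono Ω weigh) ⟩
        4 * ∑ Ω (λ ω → 2 * F * (⟦ q ω ⟧ * f ω))
          ≡⟨ trans (cong (4 *_) (∑-*ˡ Ω (2 * F) _)) (lem₃ F _) ⟩
        8 * F * ∑ Ω (λ ω → ⟦ q ω ⟧ * f ω)
          ≡⟨ cong (8 * F *_) (trans (∑-cong Ω λ ω → trans (sym (∑-*ˡ (nb y) ⟦ q ω ⟧ _)) (∑-cong (nb y) λ z → sym (⟦∧⟧ (q ω) (Tr z ω)))) (∑-swap Ω (nb y) _)) ⟩
        8 * F * ∑ (nb y) (λ z → card (λ ω → q ω ∧ Tr z ω))
          ≡⟨ sym (∑-*ˡ (nb y) (8 * F) _) ⟩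
        ∑ (nb y) g₁ ∎
        where
        open ≤-Reasoning
        lem : ∀ l F c → l * (8 * F * c) ≡ 8 * F * l * c
        lem = solve-∀
        lem₂ : ∀ x → x + x + (x + x) ≡ 4 * x
        lem₂ = solve-∀
        lem₃ : ∀ F x → 4 * (2 * F * x) ≡ 8 * F * x
        lem₃ = solve-∀
        weigh : ∀ ω → d * ⟦ q ω ⟧ ≤ 2 * F * (⟦ q ω ⟧ * f ω)
        weigh ω with q ω in eq
        ... | false = ≤-trans (≤-reflexive (*-zeroʳ d)) z≤n
        ... | true  = ≤-trans (≤-reflexive (*-identityʳ d)) (≤-trans (does-true (d ≤? 2 * F * f ω) (hv ω eq))
                        (≤-reflexive (cong (2 * F *_) (sym (+-identityʳ (f ω))))))
      from : (∃ λ z → z ∈ nb y × g₂ z < g₁ z) → ∃ λ z → z ∈ nb y × z ∉ Z × card q ≤ 8 * F * card (λ ω → q ω ∧ Tr z ω)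
      from (z , z∈ , lt) = z , z∈ , z∉ , ≤-trans (m≤m+n (card q) _) (<⇒≤ lt)
       where
       z∉ : z ∉ Z
       z∉ z∈Z = <⇒≱ lt (≤-trans (*-monoʳ-≤ (8 * F) (∑-mono Ω λ ω → ⟦⟧-mono {q ω ∧ Tr z ω} {q ω} (proj₁ ∘ ∧-true)))
        (≤-trans (≤-trans (≤-reflexive (sym (+-identityʳ _))) (≤-reflexive (cong (λ x → ⟦ x ⟧ * (8 * F * card q)) (sym inb)))) (m≤n+m _ (card q))))
         where
         inb : z ∈ᵇ Z ≡ true
         inb with z ∈ᵇ Z in eq
         ... | true  = refl
         ... | false = ⊥-elim (∈ᵇ-false Z eq z∈Z)

    record Side (j : ℕ) : Set where
      field
        zs    : Fin j → Vx
        zs∈   : ∀ i → zs i ∈ nb y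
        inj   : ∀ i i′ → zs i ≡ zs i′ → i ≡ i′
        common : Om → Bool
        common-heavy : ∀ ω → common ω ≡ true → heavy ω ≡ true
        joined : ∀ ω → common ω ≡ true → ∀ i → Tr (zs i) ω ≡ true
        many  : p < 2 * F * (8 * F) ^ j * card common

    pick-side : ∀ t j → j ≤ t → 8 * F * t ≤ d → 0 < d → Side j
    pick-side t zero    j≤ t≤ 0<d = record { zs = λ () ; zs∈ = λ () ; inj = λ () ; common = heavy ; common-heavy = λ _ e → e
      ; joined = λ _ _ () ; many = <-≤-trans many-heavy (≤-reflexive (cong (_* card heavy) (sym (*-identityʳ (2 * F))))) }
    pick-side t (suc j) j≤ t≤ 0<d = record { zs = zs′ ; zs∈ = zs∈′ ; inj = inj′
      ; common = λ ω → common ω ∧ Tr z ω ; common-heavy = λ ω e → common-heavy ω (proj₁ (∧-true e))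
      ; joined = λ { ω e zero → proj₂ (∧-true {common ω} e) ; ω e (suc i) → joined ω (proj₁ (∧-true e)) i }
      ; many = <-≤-trans many (≤-trans (*-monoʳ-≤ (2 * F * (8 * F) ^ j) card≤) (≤-reflexive (lem F ((8 * F) ^ j) _))) }
      where
      open Side (pick-side t j (≤-trans (n≤1+n j) j≤) t≤ 0<d)
      lem : ∀ F x c → 2 * F * x * (8 * F * c) ≡ 2 * F * (8 * F * x) * c
      lem = solve-∀
      Z = map zs (allFin j)
      Z-length : length Z ≡ j
      Z-length = trans (length-map zs (allFin j)) (length-tabulate {n = j} id)
      nx = next common Z common-heavy (≤-trans (*-monoʳ-≤ (8 * F) (≤-trans (≤-reflexive Z-length) (≤-trans (n≤1+n j) j≤))) t≤) 0<d
             (*-positiveʳ (2 * F * (8 * F) ^ j) _ (≤-<-trans z≤n many))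
      z = proj₁ nx
      z∉ = proj₁ (proj₂ (proj₂ nx))
      card≤ = proj₂ (proj₂ (proj₂ nx))
      zs′ : Fin (suc j) → Vx
      zs′ zero    = z
      zs′ (suc i) = zs i
      zs∈′ : ∀ i → zs′ i ∈ nb y
      zs∈′ zero    = proj₁ (proj₂ nx)
      zs∈′ (suc i) = zs∈ i
      inj′ : ∀ i i′ → zs′ i ≡ zs′ i′ → i ≡ i′
      inj′ zero zero e = refl
      inj′ zero (suc i′) e = ⊥-elim (z∉ (subst (_∈ Z) (sym e) (∈-map⁺ zs (∈-allFin i′))))
      inj′ (suc i) zero e = ⊥-elim (z∉ (subst (_∈ Z) e (∈-map⁺ zs (∈-allFin i))))
      inj′ (suc i) (suc i′) e = cong suc (inj i i′ e)

    record Biclique (s t : ℕ) : Set where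
      field
        zs     : Fin t → Vx
        zs∈    : ∀ j → zs j ∈ nb y
        zs-inj : ∀ j j′ → zs j ≡ zs j′ → j ≡ j′
        ωs     : Fin s → Om
        ωs∈    : ∀ i → ωs i ∈ Ω
        ωs-inj : ∀ i i′ → root (ωs i) ≡ root (ωs i′) → i ≡ i′
        apart  : ∀ i j → root (ωs i) ≢ zs j
        joined : ∀ i j → Tr (zs j) (ωs i) ≡ true

    -- After `t` neighbours more than `p / M` elements are joined to all of them, whereas a single
    -- root accounts for at most `p / Q`; so a short list of forbidden roots never exhausts them.
    biclique : ∀ s t Q → (∀ x → Q * ∑ Ω (λ ω → ⟦ does (root ω ≟ x) ⟧) ≤ p) → 8 * F * t ≤ d → 0 < d →
               suc (s + t) * (2 * F * (8 * F) ^ t) ≤ Q → Biclique s t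
    biclique s t Q rare t≤ 0<d Q≥ = record
      { zs = zs ; zs∈ = zs∈ ; zs-inj = inj ; ωs = proj₁ ∘ ch ; ωs∈ = λ i → proj₁ (proj₂ (ch i))
      ; ωs-inj = distinct-roots ; apart = λ i j e → proj₁ (proj₂ chosen) i (here refl) (subst (_∈ Z) (sym e) (∈-map⁺ zs (∈-allFin j)))
      ; joined = λ i j → joined (proj₁ (ch i)) (proj₂ (proj₂ (ch i))) j }
      where
      open Side (pick-side t t ≤-refl t≤ 0<d)
      M = 2 * F * (8 * F) ^ t
      Z = map zs (allFin t)
      -- The successor makes `L` nonzero, as the strict comparison in `lt` demands.
      L = suc (s + t)
      pick : ∀ X → length X ≤ L → Σ (Σ Om λ ω → ω ∈ Ω × common ω ≡ true) λ (ω , _) → ∀ {x} → x ∈ root ω ∷ [] → x ∉ X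
      pick X le = from (pigeonhole Ω (λ ω → ⟦ common ω ⟧) (λ ω → 1 * ⟦ root ω ∈ᵇ X ⟧) lt)
        where
        lt : ∑ Ω (λ ω → 1 * ⟦ root ω ∈ᵇ X ⟧) < card common
        lt = *-cancelˡ-< Q _ _ (begin-strict
          Q * ∑ Ω (λ ω → 1 * ⟦ root ω ∈ᵇ X ⟧)
            ≤⟨ *-monoʳ-≤ Q (≤-trans (∑-mono Ω λ ω → ≤-trans (≤-reflexive (+-identityʳ _)) (∑-any _ X)) (≤-reflexive (∑-swap Ω X _))) ⟩
          Q * ∑ X (λ x → ∑ Ω (λ ω → ⟦ does (root ω ≟ x) ⟧))
            ≡⟨ sym (∑-*ˡ X Q _) ⟩
          ∑ X (λ x → Q * ∑ Ω (λ ω → ⟦ does (root ω ≟ x) ⟧))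
            ≤⟨ ∑-bound X p (λ x _ → rare x) ⟩
          length X * p            ≤⟨ *-monoˡ-≤ p le ⟩
          L * p                   <⟨ *-monoʳ-< L many ⟩
          L * (M * card common)   ≡⟨ sym (*-assoc L M _) ⟩
          L * M * card common     ≤⟨ *-monoˡ-≤ (card common) Q≥ ⟩
          Q * card common         ∎)
          where open ≤-Reasoning
        from : (∃ λ ω → ω ∈ Ω × 1 * ⟦ root ω ∈ᵇ X ⟧ < ⟦ common ω ⟧) →
               Σ (Σ Om λ ω → ω ∈ Ω × common ω ≡ true) λ (ω , _) → ∀ {x} → x ∈ root ω ∷ [] → x ∉ X
        from (ω , ω∈ , lt) = (ω , ω∈ , ⟦⟧-positive (common ω) (≤-<-trans z≤n lt)) ,
          λ { (here refl) → ∈ᵇ-false X (⟦⟧-zero (root ω ∈ᵇ X) (≤-<-trans (≤-reflexive (sym (+-identityʳ _))) (<-≤-trans lt (⟦⟧≤1 (common ω))))) }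
      chosen = greedy s (λ _ → Σ Om λ ω → ω ∈ Ω × common ω ≡ true) (λ _ (ω , _) → root ω ∷ []) 1 L Z (λ _ _ → ≤-refl) (λ _ → pick)
        (≤-trans (≤-reflexive (trans (cong₂ _+_ (trans (length-map zs (allFin t)) (length-tabulate {n = t} id)) (*-identityʳ s)) (+-comm t s))) (n≤1+n _))
      ch = proj₁ chosen
      distinct-roots : ∀ i i′ → root (proj₁ (ch i)) ≡ root (proj₁ (ch i′)) → i ≡ i′
      distinct-roots i i′ e with i Fin.≟ i′
      ... | yes eq = eq
      ... | no ne  = ⊥-elim (proj₂ (proj₂ chosen) i i′ ne (here refl) (here e))

-- Sparseness of walks, by stars with legs 1 and i.

halve : ∀ d → ∃ λ e → ∃ λ c → d ≡ 2 * e + ⟦ c ⟧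
halve zero    = 0 , false , refl
halve (suc d) with halve d
... | e , false , eq = e , true , trans (cong suc eq) (lem e)
  where
  lem : ∀ e → 1 + (2 * e + 0) ≡ 2 * e + 1
  lem = solve-∀
... | e , true , eq = suc e , false , trans (cong suc eq) (lem e)
  where
  lem : ∀ e → 1 + (2 * e + 1) ≡ 2 * (1 + e) + 0
  lem = solve-∀

-- handshake is what double counting the edges leaves when D is only within a constant factor of
-- the degrees.
record Setting {m n : ℕ} (G : BipGraph m n) (μ Q : ℕ) : Set where
  open Graph G
  field
    D         : Bool → ℕ
    deg≤      : ∀ u → length (nb u) ≤ D (sd u)
    handshake : ∀ b b′ → sz b′ * D b′ ≤ μ * (sz b * D b)
    Q<D       : ∀ b → Q < D b

module Sparse {m n : ℕ} (G : BipGraph m n) {μ Q : ℕ} (S : Setting G μ Q) where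
  open Graph G public
  open GraphCounts G public
  open Setting S public
  open Counts D deg≤ public

  Q≤D : ∀ b → Q ≤ D b
  Q≤D b = <⇒≤ (Q<D b)

  D>0 : ∀ b → 0 < D b
  D>0 b = ≤-<-trans z≤n (Q<D b)

  total>0 : ∀ {s} E c b (is : Vec ℕ s) → total b is < E * starRich b is c → 0 < total b is
  total>0 E c b is lt = let σ , σ∈ , _ = ∑-positive (starL b is) _ (*-positiveʳ E _ (≤-<-trans z≤n lt)) in
    ≤-trans (nonempty σ∈) (starL-length b is)
    where
    nonempty : ∀ {A : Set} {x : A} {xs : List A} → x ∈ xs → 0 < length xs
    nonempty (here _)  = s≤s z≤n
    nonempty (there _) = s≤s z≤n

  -- Prescribing a vertex of the leg leaves one choice for the step that reaches it, out of a budget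
  -- of at least `Q`. The second vertex is reached by a step only if it is not the center, hence
  -- `2 ≤ i`.
  rare-root : ∀ y i c → 1 ≤ i → (c ≡ true → 2 ≤ i) → ∀ x →
    Q * ∑ (legL y i) (λ ω → ⟦ does ((if c then hd y (drop 1 ω) else hd y ω) ≟ x) ⟧) ≤ P (sd y) i
  rare-root y (suc i) false _ _ x = begin
    Q * ∑ (legL y (suc i)) (λ ω → ⟦ does (hd y ω ≟ x) ⟧)
      ≡⟨ cong (Q *_) (∑-legL-suc y i _) ⟩
    Q * ∑ (legL y i) (λ f → ∑ (nb (hd y f)) (λ v → ⟦ does (v ≟ x) ⟧))
      ≤⟨ *-monoʳ-≤ Q (≤-trans (∑-bound (legL y i) 1 λ f _ → ∑-nb≟ (hd y f) x) (≤-trans (≤-reflexive (*-identityʳ _)) (legL-length y i))) ⟩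
    Q * P (sd y) i
      ≤⟨ *-monoˡ-≤ (P (sd y) i) (Q≤D (flip i (sd y))) ⟩
    D (flip i (sd y)) * P (sd y) i
      ≡⟨ *-comm (D (flip i (sd y))) _ ⟩
    P (sd y) (suc i) ∎
    where open ≤-Reasoning
  rare-root y (suc zero) true _ h x with h refl
  ... | s≤s ()
  rare-root y (suc (suc i)) true _ _ x = begin
    Q * ∑ (legL y (suc (suc i))) (λ ω → ⟦ does (hd y (drop 1 ω) ≟ x) ⟧)
      ≡⟨ cong (Q *_) (∑-legL-suc y (suc i) _) ⟩
    Q * ∑ (legL y (suc i)) (λ f → ∑ (nb (hd y f)) (λ v → ⟦ does (hd y f ≟ x) ⟧))
      ≤⟨ *-monoʳ-≤ Q (∑-mono∈ (legL y (suc i)) λ f f∈ → ≤-trans (≤-reflexive (∑-const (nb (hd y f)) _))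
           (≤-trans (*-monoˡ-≤ _ (≤-trans (deg≤ (hd y f)) (≤-reflexive (cong D (Leg-sd (legL-sound (suc i) f∈)))))) (≤-reflexive (*-comm d _)))) ⟩
    Q * ∑ (legL y (suc i)) (λ f → ⟦ does (hd y f ≟ x) ⟧ * d)
      ≡⟨ trans (cong (Q *_) (∑-*ʳ (legL y (suc i)) d _)) (sym (*-assoc Q _ d)) ⟩
    Q * ∑ (legL y (suc i)) (λ f → ⟦ does (hd y f ≟ x) ⟧) * d
      ≤⟨ *-monoˡ-≤ d (rare-root y (suc i) false (s≤s z≤n) (λ ()) x) ⟩
    P (sd y) (suc (suc i)) ∎
    where
    open ≤-Reasoning
    d = D (flip (suc i) (sd y))

  StarSparse-mono : ∀ {s} {E E′ c c′} b (is : Vec ℕ s) → E ≤ E′ → c′ ≤ c → StarSparse E′ c′ b is → StarSparse E c b is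
  StarSparse-mono {E = E} {E′} {c} {c′} b is E≤ c≤ sp = ≤-trans (*-mono-≤ E≤ (∑-mono (starL b is) λ σ →
    ⟦does⟧-mono (c ≤? #roots b is (heads σ)) (c′ ≤? #roots b is (heads σ)) (≤-trans c≤))) sp

  LegSparse-mono : ∀ {E E′ c c′} b j → E ≤ E′ → c′ ≤ c → LegSparse E′ c′ b j → LegSparse E c b j
  LegSparse-mono {E} {E′} {c} {c′} b j E≤ c≤ sp = ≤-trans (*-mono-≤ E≤ (∑-mono (sideL b) λ z → ∑-mono (legL z j) λ f →
    ⟦does⟧-mono (c ≤? #walks j z (hd z f)) (c′ ≤? #walks j z (hd z f)) (≤-trans c≤))) sp

  -- There are no multiple edges, so the threshold 2 is never reached.
  LegSparse-1 : ∀ E b → LegSparse E 2 b 1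
  LegSparse-1 E b = ≤-trans (≤-reflexive (trans (cong (E *_) none) (*-zeroʳ E))) z≤n
    where
    single : ∀ z x → ¬ (2 ≤ #walks 1 z x)
    single z x le = <⇒≱ (s≤s (≤-trans (≤-reflexive (trans (∑-legL-suc z 0 _) (+-identityʳ _))) (∑-nb≟ z x))) le
    none : legRich b 1 2 ≡ 0
    none = trans (∑-cong (sideL b) λ z → trans (∑-cong (legL z 1) λ f → cong ⟦_⟧ (false-does (2 ≤? #walks 1 z (hd z f)) (single z (hd z f))))
      (∑-zero (legL z 1))) (∑-zero (sideL b))

  ∑-legL-snoc : ∀ z i (F : List Vx → ℕ) → ∑ (legL z (suc i)) F ≡ ∑ (nb z) (λ y → ∑ (legL y i) (λ f → F (f ++ y ∷ [])))
  ∑-legL-snoc z i F = trans (cong (λ j → ∑ (legL z j) F) (+-comm 1 i))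
    (trans (∑-legL-+ z i 1 F) (trans (∑-legL-suc z 0 _) (+-identityʳ _)))

  ∑-fork : ∀ b i (F : Star 2 → ℕ) →
    ∑ (starL b (1 ∷ i ∷ [])) F ≡ ∑ (sideL b) (λ y → ∑ (nb y) (λ v → ∑ (legL y i) (λ f → F (y , (v ∷ []) ∷ f ∷ []))))
  ∑-fork b i F = trans (∑-starL b (1 ∷ i ∷ []) F) (∑-cong (sideL b) λ y → trans (∑-legT-∷ y 1 (i ∷ []) _)
    (trans (∑-legL-suc y 0 _) (trans (+-identityʳ _) (∑-cong (nb y) λ v → trans (∑-legT-∷ y i [] _) (∑-cong (legL y i) λ f → +-identityʳ _)))))

  nb-swap′ : ∀ b (F : Vx → Vx → ℕ) →
             ∑ (sideL (not b)) (λ u → ∑ (nb u) (F u)) ≡ ∑ (sideL b) (λ v → ∑ (nb v) (λ u → F u v))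
  nb-swap′ b F = sym (nb-swap b (λ v u → F u v))

  -- Seen from the vertex after `z`, a walk of length `suc i` is a star with one leg ending in `z`
  -- and one leg of length `i`.
  #walks≤#roots : ∀ b i z x → sd z ≡ b → #walks (suc i) z x ≤ #roots (not b) (1 ∷ i ∷ []) (z ∷ x ∷ [])
  #walks≤#roots b i z x refl = begin
    #walks (suc i) z x
      ≡⟨ trans (∑-legL-snoc z i _) (∑-cong (nb z) λ y → ∑-cong (legL y i) λ f → cong (λ v → ⟦ does (v ≟ x) ⟧) (hd-++ z f (y ∷ []))) ⟩
    ∑ (nb z) (λ y → ∑ (legL y i) (λ f → ⟦ does (hd y f ≟ x) ⟧))
      ≤⟨ ∑-mono (nb z) (λ y → ∑-mono (legL y i) λ f → ⟦does⟧-mono (hd y f ≟ x) ((z ∷ hd y f ∷ []) ≟ᵛ (z ∷ x ∷ [])) λ { refl → refl }) ⟩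
    ∑ (nb z) (λ y → ∑ (legL y i) (λ f → ⟦ does ((z ∷ hd y f ∷ []) ≟ᵛ (z ∷ x ∷ [])) ⟧))
      ≤⟨ ∑-pick (λ v → ∑ (nb v) (λ y → ∑ (legL y i) (λ f → ⟦ does ((v ∷ hd y f ∷ []) ≟ᵛ (z ∷ x ∷ [])) ⟧))) (∈sideL z) ⟩
    ∑ (sideL b) (λ v → ∑ (nb v) (λ y → ∑ (legL y i) (λ f → ⟦ does ((v ∷ hd y f ∷ []) ≟ᵛ (z ∷ x ∷ [])) ⟧)))
      ≡⟨ sym (nb-swap′ b (λ y v → ∑ (legL y i) (λ f → ⟦ does ((v ∷ hd y f ∷ []) ≟ᵛ (z ∷ x ∷ [])) ⟧))) ⟩
    ∑ (sideL (not b)) (λ y → ∑ (nb y) (λ v → ∑ (legL y i) (λ f → ⟦ does ((v ∷ hd y f ∷ []) ≟ᵛ (z ∷ x ∷ [])) ⟧)))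
      ≡⟨ sym (∑-fork (not b) i _) ⟩
    #roots (not b) (1 ∷ i ∷ []) (z ∷ x ∷ []) ∎
    where open ≤-Reasoning

  legRich≤starRich : ∀ b i c → legRich b (suc i) c ≤ starRich (not b) (1 ∷ i ∷ []) c
  legRich≤starRich b i c = begin
    legRich b (suc i) c
      ≡⟨ ∑-cong (sideL b) (λ z → trans (∑-legL-snoc z i _) (∑-cong (nb z) λ y → ∑-cong (legL y i) λ f →
           cong (λ v → ⟦ does (c ≤? #walks (suc i) z v) ⟧) (hd-++ z f (y ∷ [])))) ⟩
    ∑ (sideL b) (λ z → ∑ (nb z) (λ y → ∑ (legL y i) (λ f → ⟦ does (c ≤? #walks (suc i) z (hd y f)) ⟧)))
      ≤⟨ ∑-mono∈ (sideL b) (λ z z∈ → ∑-mono (nb z) λ y → ∑-mono (legL y i) λ f →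
           ⟦does⟧-mono (c ≤? #walks (suc i) z (hd y f)) (c ≤? #roots (not b) (1 ∷ i ∷ []) (z ∷ hd y f ∷ []))
             (λ le → ≤-trans le (#walks≤#roots b i z (hd y f) (∈sideL⇒sd b z∈)))) ⟩
    ∑ (sideL b) (λ z → ∑ (nb z) (λ y → ∑ (legL y i) (λ f → ⟦ does (c ≤? #roots (not b) (1 ∷ i ∷ []) (z ∷ hd y f ∷ [])) ⟧)))
      ≡⟨ trans (sym (nb-swap′ b _)) (sym (∑-fork (not b) i _)) ⟩
    starRich (not b) (1 ∷ i ∷ []) c ∎
    where open ≤-Reasoning

  -- Counting from an end of the walk instead of from the center moves to the other side of the
  -- graph; `handshake` charges `μ`, which the density `E * suc μ` pays.
  Star⇒LegSparse : ∀ E c b i → StarSparse (E * suc μ) c (not b) (1 ∷ i ∷ []) → LegSparse E c b (suc i)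
  Star⇒LegSparse E c b i sp = dilute E μ (legRich b (suc i) c) (sz b * P b (suc i)) (begin
    E * suc μ * legRich b (suc i) c                  ≤⟨ *-monoʳ-≤ (E * suc μ) (legRich≤starRich b i c) ⟩
    E * suc μ * starRich (not b) (1 ∷ i ∷ []) c      ≤⟨ sp ⟩
    sz (not b) * (1 * D (not b) * (P (not b) i * 1)) ≡⟨ lem₁ (sz (not b)) (D (not b)) (P (not b) i) ⟩
    sz (not b) * D (not b) * P (not b) i             ≤⟨ *-monoˡ-≤ (P (not b) i) (handshake b (not b)) ⟩
    μ * (sz b * D b) * P (not b) i                   ≡⟨ lem₂ μ (sz b) (D b) (P (not b) i) ⟩
    μ * (sz b * (1 * D b * P (not b) i))             ≡⟨ cong (λ x → μ * (sz b * x)) (trans (sym (P-+ b i 1)) (cong (P b) (+-comm i 1))) ⟩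
    μ * (sz b * P b (suc i))                         ∎)
    where
    open ≤-Reasoning
    lem₁ : ∀ z d p → z * (1 * d * (p * 1)) ≡ z * d * p
    lem₁ = solve-∀
    lem₂ : ∀ m z d p → m * (z * d) * p ≡ m * (z * (1 * d * p))
    lem₂ = solve-∀

module PathStep (μ s t k r : ℕ) (1≤k : 1 ≤ k) (E c′ i : ℕ) where

  -- `F` is twice `4 * E`, to make an inequality strict. `rr` allows for 2 single and `k` double
  -- moves, `Lf` is what `subdiv-from-paths` asks for, and `Lm` adds one forbidden vertex per move.
  -- `N` and `hit₀` are the values of `Vec.sum is` and `hit` for legs 1 and `i`.
  F rr Lf Lm hit₀ a₀ b₀ cₚ N E₁ : ℕ
  F    = 8 * E
  rr   = 2 + 2 * k
  Lf   = s + t + s * (t * r) * suc (2 * (2 * k))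
  Lm   = Lf + rr
  N    = suc (i + 0)
  hit₀ = c′ ^ 2 + N * (c′ * c′)
  a₀   = suc (Lm * hit₀)
  b₀   = suc Lm
  cₚ   = (8 * E * suc rr) * suc a₀
  E₁   = (4 * E) * suc (N * suc μ)

  -- One summand for each use of large degrees: repeated vertices, fans, and in the biclique room
  -- for `t` neighbours and the rarity of a root.
  Qₚ : ℕ
  Qₚ = (4 * E) * suc (N * suc N) + ((8 * E * suc rr) * suc (2 * b₀) + (8 * F * t + suc (s + t) * (2 * F * (8 * F) ^ t)))

  module _ {m n Q : ℕ} {G : BipGraph m n} (S : Setting G μ Q) (Q≥ : Qₚ ≤ Q) (noH : ¬ ContainsSubdiv G s t k r)
           (b : Bool) (1≤i : 1 ≤ i) (i≤ : i ≤ 2 * k ∸ 1) where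
    open Sparse G S
    open Embed G
    open Webs G

    is : Vec ℕ 2
    is = 1 ∷ i ∷ []

    1≤is : ∀ l → 1 ≤ lookup is l
    1≤is zero       = ≤-refl
    1≤is (suc zero) = 1≤i

    open Rounds G D deg≤ b is c′ cₚ a₀ b₀
    open Avoid G D deg≤ b is c′ cₚ a₀ b₀ 1≤is
    open Raise G D deg≤ b is c′ cₚ a₀ b₀ 1≤is

    private
      Rr : ℕ
      Rr = suc rr

      e₀ = proj₁ (halve (2 * k ∸ 1 ∸ i))
      cc = proj₁ (proj₂ (halve (2 * k ∸ 1 ∸ i)))

      lengths : i + 2 * e₀ + ⟦ cc ⟧ ≡ 2 * k ∸ 1
      lengths = trans (+-assoc i (2 * e₀) ⟦ cc ⟧) (trans (cong (i +_) (sym (proj₂ (proj₂ (halve (2 * k ∸ 1 ∸ i)))))) (m+[n∸m]≡n i≤))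

      -- For `i` equal to 1 the defect 2k - 2 is even and no single move is made; so the final root
      -- of the long leg is never the center.
      cc⇒2≤i : cc ≡ true → 2 ≤ i
      cc⇒2≤i e with m≤n⇒m<n∨m≡n 1≤i
      ... | inj₁ lt = lt
      ... | inj₂ eq = ⊥-elim (even≢odd k (suc e₀) (trans (sym (m+[n∸m]≡n (≤-trans 1≤k (m≤m+n k (k + 0))))) (cong suc (trans (sym lengths)
                        (trans (cong₂ (λ i c → i + 2 * e₀ + ⟦ c ⟧) (sym eq) e) (lem e₀))))))
        where
        lem : ∀ e → 1 + 2 * e + 1 ≡ 2 * (1 + e)
        lem = solve-∀

      e≤k : e₀ ≤ k
      e≤k = *-cancelˡ-≤ 2 (≤-trans (m≤n+m (2 * e₀) i) (≤-trans (m≤m+n _ ⟦ cc ⟧) (≤-trans (≤-reflexive lengths) (m∸n≤m (2 * k) 1))))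

      ev : Vec ℕ 2
      ev = 0 ∷ e₀ ∷ []

      ct : Vec Bool 2
      ct = false ∷ cc ∷ []

      cost : tally ct + 2 * Vec.sum ev ≤ rr
      cost = +-mono-≤ (tally≤ ct) (*-monoʳ-≤ 2 (≤-trans (≤-reflexive (+-identityʳ e₀)) e≤k))

      raised : Raised Rr Lf (λ l → lookup is l + 2 * lookup ev l + ⟦ lookup ct l ⟧) (lookup ct)
      raised = Raised-≤ {1 + (tally ct + 2 * Vec.sum ev)} {Rr} {ct = lookup ct} (s≤s cost)
        (Raised-all Lm ≤-refl ≤-refl (tally ct) ct ev refl (+-monoʳ-≤ Lf cost))

      end : Vx → List Vx → Vx
      end y ω = if cc then hd y (drop 1 ω) else hd y ω

      Tr : Vx → Vx → List Vx → Bool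
      Tr y v ω = T Rr (y , (v ∷ []) ∷ ω ∷ [])

      -- Averaging over the centers; the positive total turns the doubled bound into a strict one.
      crowded : total b is ≤ (4 * E) * #T Rr → 0 < total b is →
        ∃ λ y → y ∈ sideL b × D b * P b i < F * ∑ (nb y) (λ v → ∑ (legL y i) (λ ω → ⟦ Tr y v ω ⟧))
      crowded le pos = pigeonhole (sideL b) (λ y → F * S′ y) (λ _ → D b * P b i) (begin-strict
        ∑ (sideL b) (λ _ → D b * P b i)      ≡⟨ ∑-const (sideL b) _ ⟩
        sz b * (D b * P b i)                 ≡⟨ lem₁ (sz b) (D b) (P b i) ⟩
        total b is                           <⟨ m<m+n (total b is) pos ⟩
        total b is + total b is              ≤⟨ +-mono-≤ le le ⟩
        (4 * E) * #T Rr + (4 * E) * #T Rr    ≡⟨ lem₂ E (#T Rr) ⟩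
        F * #T Rr                            ≡⟨ cong (F *_) (∑-fork b i (⟦_⟧ ∘ T Rr)) ⟩
        F * ∑ (sideL b) S′                   ≡⟨ sym (∑-*ˡ (sideL b) F S′) ⟩
        ∑ (sideL b) (λ y → F * S′ y)         ∎)
        where
        open ≤-Reasoning
        S′ : Vx → ℕ
        S′ y = ∑ (nb y) (λ v → ∑ (legL y i) (λ ω → ⟦ Tr y v ω ⟧))
        lem₁ : ∀ z d p → z * (d * p) ≡ z * (1 * d * (p * 1))
        lem₁ = solve-∀
        lem₂ : ∀ E x → (4 * E) * x + (4 * E) * x ≡ (8 * E) * x
        lem₂ = solve-∀

      -- Stars with the same center can exchange their legs. A biclique of survivors therefore
      -- provides `t` ends of short legs and `s` ends of long legs, each pair joined by robust webs.
      contradict : (∃ λ y → y ∈ sideL b × D b * P b i < F * ∑ (nb y) (λ v → ∑ (legL y i) (λ ω → ⟦ Tr y v ω ⟧))) → ⊥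
      contradict (y , y∈ , lt) = noH (subdiv-from-paths 1≤k (end y ∘ ωs) zs (λ i j → root (star i j) (lookup ct))
        ωs-inj zs-inj apart (λ _ _ → refl) (λ _ _ → refl) refl lengths
        (λ i j → raised (star i j) (isstar i j) (joined i j)) ≤-refl)
        where
        sd≡ = ∈sideL⇒sd b y∈
        8Ft≤Q : 8 * F * t ≤ Q
        8Ft≤Q = ≤-trans (m≤m+n _ (suc (s + t) * (2 * F * (8 * F) ^ t))) (≤-trans (m≤n+m _ ((8 * E * suc rr) * suc (2 * b₀))) (≤-trans (m≤n+m _ ((4 * E) * suc (N * suc N))) Q≥))
        big≤Q : suc (s + t) * (2 * F * (8 * F) ^ t) ≤ Q
        big≤Q = ≤-trans (m≤n+m _ (8 * F * t)) (≤-trans (m≤n+m _ ((8 * E * suc rr) * suc (2 * b₀))) (≤-trans (m≤n+m _ ((4 * E) * suc (N * suc N))) Q≥))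
        open Biclique G
        open Biclique.Biclique (biclique y (legL y i) (Tr y) (end y) (D b) (P b i) F
          (subst (λ c → length (nb y) ≤ D c) sd≡ (deg≤ y)) (subst (λ c → length (legL y i) ≤ P c i) sd≡ (legL-length y i)) lt
          s t Q (λ x → ≤-trans (rare-root y i cc 1≤i cc⇒2≤i x) (≤-reflexive (cong (λ c → P c i) sd≡)))
          (≤-trans 8Ft≤Q (Q≤D b)) (D>0 b) big≤Q)
        star : Fin s → Fin t → Star 2
        star i j = y , (zs j ∷ []) ∷ ωs i ∷ []
        isstar : ∀ i j → IsStar is (star i j)
        isstar i j zero       = zs∈ j ∷ []
        isstar i j (suc zero) = legL-sound _ (ωs∈ i)

    path-sparse : (∀ j → suc j ≤ i → ∀ b′ → LegSparse E₁ c′ b′ (suc j)) →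
                  (∀ j → 1 ≤ j → j < i → StarSparse E₁ c′ b (1 ∷ j ∷ [])) →
                  StarSparse E cₚ b is
    path-sparse H₁ H₂ with E * starRich b is cₚ ≤? total b is
    ... | yes le = le
    ... | no nle = ⊥-elim (contradict (crowded
        (dense Q Q≤D μ D>0 handshake 1≤is E rr (≰⇒> nle) (≤-trans (m≤m+n _ _) Q≥) ≤-refl
          (≤-trans (m≤m+n _ _) (≤-trans (m≤n+m _ ((4 * E) * suc (N * suc N))) Q≥)) h₁ h₂)
        (total>0 E cₚ b is (≰⇒> nle))))
      where
      h₁ : ∀ l j → suc j ≤ lookup is l → ∀ b′ → LegSparse E₁ c′ b′ (suc j)
      h₁ zero       j le = H₁ j (≤-trans le 1≤i)
      h₁ (suc zero) j le = H₁ j le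
      h₂ : ∀ l j → suc j < lookup is l → StarSparse E₁ c′ b (trunc l (suc j))
      h₂ zero       j (s≤s ())
      h₂ (suc zero) j lt = H₂ (i ∸ suc j) (m<n⇒0<n∸m lt) (∸-monoʳ-< (s≤s z≤n) (<⇒≤ lt))

module PathClaim (μ s t k r : ℕ) (1≤k : 1 ≤ k) where

  -- The constants precede the graph, and one pair `c`, `Q₀` serves all `i ≤ N`, since a step refers
  -- to all shorter shapes at once.
  PathSparse : ℕ → ℕ → ℕ → ℕ → Set
  PathSparse N E c Q₀ = ∀ {m n Q} {G : BipGraph m n} (S : Setting G μ Q) → Q₀ ≤ Q → ¬ ContainsSubdiv G s t k r →
    let open Sparse G S in ∀ i → i ≤ N → i ≤ 2 * k ∸ 1 → ∀ b →
    (1 ≤ i → StarSparse E c b (1 ∷ i ∷ [])) × LegSparse E c b (suc i)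

  path-claim : ∀ N E → ∃ λ c → ∃ λ Q₀ → PathSparse N E c Q₀
  path-claim zero E = 2 , 0 , claim
    where
    claim : PathSparse 0 E 2 0
    claim {G = G} S _ _ .0 z≤n _ b = (λ ()) , Sparse.LegSparse-1 G S E b
  path-claim (suc N) E = c₀ + cₚ , Q₀ + (Q₁ + Qₚ) , claim
    where
    -- Leaves room for the factor that `Star⇒LegSparse` costs.
    Eˣ = E * suc μ
    -- `E₁` does not depend on the threshold, so a dummy 0 suffices to obtain it; the true `c′` is
    -- what the induction returns for this `E₁`.
    open PathStep μ s t k r 1≤k Eˣ 0 (suc N) using (E₁)
    IH₀ = path-claim N E
    c₀ = proj₁ IH₀
    Q₀ = proj₁ (proj₂ IH₀)
    IH₁ = path-claim N E₁
    c′ = proj₁ IH₁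
    Q₁ = proj₁ (proj₂ IH₁)
    open PathStep μ s t k r 1≤k Eˣ c′ (suc N) using (cₚ; Qₚ; path-sparse)
    claim : PathSparse (suc N) E (c₀ + cₚ) (Q₀ + (Q₁ + Qₚ))
    claim {Q = Q} {G} S Q≥ noH i i≤ i≤2k b with m≤n⇒m<n∨m≡n i≤
    ... | inj₁ lt = let st , lg = proj₂ (proj₂ IH₀) S (≤-trans (m≤m+n Q₀ _) Q≥) noH i (≤-pred lt) i≤2k b in
            (λ 1≤i → StarSparse-mono {E = E} {E} {c₀ + cₚ} {c₀} b (1 ∷ i ∷ []) ≤-refl (m≤m+n c₀ cₚ) (st 1≤i)) ,
            LegSparse-mono {E} {E} {c₀ + cₚ} {c₀} b (suc i) ≤-refl (m≤m+n c₀ cₚ) lg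
      where open Sparse G S
    ... | inj₂ refl = (λ _ → StarSparse-mono {E = E} {Eˣ} {c₀ + cₚ} {cₚ} b (1 ∷ suc N ∷ []) (m≤m*n E (suc μ)) (m≤n+m cₚ c₀) (star b)) ,
            LegSparse-mono {E} {E} {c₀ + cₚ} {cₚ} b (suc (suc N)) ≤-refl (m≤n+m cₚ c₀) (Star⇒LegSparse E cₚ b (suc N) (star (not b)))
      where
      open Sparse G S
      IH = proj₂ (proj₂ IH₁) S (≤-trans (m≤m+n Q₁ Qₚ) (≤-trans (m≤n+m _ Q₀) Q≥)) noH
      star : ∀ b → StarSparse Eˣ cₚ b (1 ∷ suc N ∷ [])
      star b = path-sparse S (≤-trans (m≤n+m Qₚ Q₁) (≤-trans (m≤n+m _ Q₀) Q≥)) noH b (s≤s z≤n) i≤2k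
        (λ j le b′ → proj₂ (IH j (≤-pred le) (≤-trans (≤-pred le) (≤-trans (n≤1+n N) i≤2k)) b′))
        (λ j 1≤j lt → proj₁ (IH j (≤-pred lt) (≤-trans (<⇒≤ lt) i≤2k) b) 1≤j)

-- Sparseness of stars with s legs.

module TwoLegs {m n : ℕ} (G : BipGraph m n) {μ Q : ℕ} (S : Setting G μ Q) where
  open Sparse G S

  -- The other legs contribute at most their budget. Both sides carry the factor for leg `l`, so
  -- that the full product `Pr` can appear without a division.
  ∑-one-leg : ∀ {s} y (is : Vec ℕ s) l (g : List Vx → ℕ) →
    ∑ (legT y is) (λ ls → g (lookup ls l)) * P (sd y) (lookup is l) ≤ ∑ (legL y (lookup is l)) g * Pr (sd y) is
  ∑-one-leg y (i ∷ is) zero g = begin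
    ∑ (legT y (i ∷ is)) (λ ls → g (lookup ls zero)) * p
      ≡⟨ cong (_* p) (trans (∑-legT-∷ y i is _) (trans (∑-cong (legL y i) λ a → trans (∑-const (legT y is) (g a)) (*-comm _ (g a))) (∑-*ʳ (legL y i) _ g))) ⟩
    ∑ (legL y i) g * length (legT y is) * p
      ≤⟨ *-monoˡ-≤ p (*-monoʳ-≤ (∑ (legL y i) g) (legT-length y is)) ⟩
    ∑ (legL y i) g * Pr (sd y) is * p
      ≡⟨ lem (∑ (legL y i) g) (Pr (sd y) is) p ⟩
    ∑ (legL y i) g * (p * Pr (sd y) is) ∎
    where
    open ≤-Reasoning
    p = P (sd y) i
    lem : ∀ a b c → a * b * c ≡ a * (c * b)
    lem = solve-∀
  ∑-one-leg y (i ∷ is) (suc l) g = begin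
    ∑ (legT y (i ∷ is)) (λ ls → g (lookup ls (suc l))) * p
      ≡⟨ cong (_* p) (trans (∑-legT-∷ y i is _) (∑-const (legL y i) _)) ⟩
    length (legL y i) * S₁ * p
      ≤⟨ *-monoˡ-≤ p (*-monoˡ-≤ S₁ (legL-length y i)) ⟩
    P (sd y) i * S₁ * p
      ≡⟨ *-assoc (P (sd y) i) S₁ p ⟩
    P (sd y) i * (S₁ * p)
      ≤⟨ *-monoʳ-≤ (P (sd y) i) (∑-one-leg y is l g) ⟩
    P (sd y) i * (∑ (legL y (lookup is l)) g * Pr (sd y) is)
      ≡⟨ x∙yz≈y∙xz (P (sd y) i) (∑ (legL y (lookup is l)) g) (Pr (sd y) is) ⟩
    ∑ (legL y (lookup is l)) g * (P (sd y) i * Pr (sd y) is) ∎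
    where
    open ≤-Reasoning
    p = P (sd y) (lookup is l)
    S₁ = ∑ (legT y is) (λ ls → g (lookup ls l))

  ∑-two-legs : ∀ {s} y (is : Vec ℕ s) l l′ → l ≢ l′ → (g : List Vx → List Vx → ℕ) →
    ∑ (legT y is) (λ ls → g (lookup ls l) (lookup ls l′)) * (P (sd y) (lookup is l) * P (sd y) (lookup is l′)) ≤
    ∑ (legL y (lookup is l)) (λ a → ∑ (legL y (lookup is l′)) (g a)) * Pr (sd y) is
  ∑-two-legs y (i ∷ is) zero zero ne g = ⊥-elim (ne refl)
  ∑-two-legs y (i ∷ is) zero (suc l′) ne g = begin
    ∑ (legT y (i ∷ is)) (λ ls → g (lookup ls zero) (lookup ls (suc l′))) * (p * p′)
      ≡⟨ trans (cong (_* (p * p′)) (∑-legT-∷ y i is _)) (trans (x∙yz≈y∙xz (∑ (legL y i) h) p p′) (cong (p *_) (sym (∑-*ʳ (legL y i) p′ h)))) ⟩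
    p * ∑ (legL y i) (λ a → ∑ (legT y is) (λ as → g a (lookup as l′)) * p′)
      ≤⟨ *-monoʳ-≤ p (∑-mono (legL y i) λ a → ∑-one-leg y is l′ (g a)) ⟩
    p * ∑ (legL y i) (λ a → ∑ (legL y (lookup is l′)) (g a) * Pr (sd y) is)
      ≡⟨ trans (cong (p *_) (∑-*ʳ (legL y i) (Pr (sd y) is) h′)) (x∙yz≈y∙xz p (∑ (legL y i) h′) (Pr (sd y) is)) ⟩
    ∑ (legL y i) (λ a → ∑ (legL y (lookup is l′)) (g a)) * (p * Pr (sd y) is) ∎
    where
    open ≤-Reasoning
    p = P (sd y) i
    p′ = P (sd y) (lookup is l′)
    h h′ : List Vx → ℕ
    h a = ∑ (legT y is) (λ as → g a (lookup as l′))
    h′ a = ∑ (legL y (lookup is l′)) (g a)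
  ∑-two-legs y (i ∷ is) (suc l) zero ne g = begin
    ∑ (legT y (i ∷ is)) (λ ls → g (lookup ls (suc l)) (lookup ls zero)) * (p * p′)
      ≡⟨ cong (∑ (legT y (i ∷ is)) (λ ls → g (lookup ls (suc l)) (lookup ls zero)) *_) (*-comm p p′) ⟩
    ∑ (legT y (i ∷ is)) (λ ls → g (lookup ls (suc l)) (lookup ls zero)) * (p′ * p)
      ≤⟨ ∑-two-legs y (i ∷ is) zero (suc l) (λ ()) (λ a a′ → g a′ a) ⟩
    ∑ (legL y i) (λ a′ → ∑ (legL y (lookup is l)) (λ a → g a a′)) * Pr (sd y) (i ∷ is)
      ≡⟨ cong (_* Pr (sd y) (i ∷ is)) (∑-swap (legL y i) (legL y (lookup is l)) _) ⟩
    ∑ (legL y (lookup is l)) (λ a → ∑ (legL y i) (g a)) * Pr (sd y) (i ∷ is) ∎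
    where
    open ≤-Reasoning
    p = P (sd y) (lookup is l)
    p′ = P (sd y) i
  ∑-two-legs y (i ∷ is) (suc l) (suc l′) ne g = begin
    ∑ (legT y (i ∷ is)) (λ ls → g (lookup ls (suc l)) (lookup ls (suc l′))) * p
      ≡⟨ cong (_* p) (trans (∑-legT-∷ y i is _) (∑-const (legL y i) _)) ⟩
    length (legL y i) * S₁ * p
      ≤⟨ *-monoˡ-≤ p (*-monoˡ-≤ S₁ (legL-length y i)) ⟩
    P (sd y) i * S₁ * p
      ≡⟨ *-assoc (P (sd y) i) S₁ p ⟩
    P (sd y) i * (S₁ * p)
      ≤⟨ *-monoʳ-≤ (P (sd y) i) (∑-two-legs y is l l′ (ne ∘ cong suc) g) ⟩
    P (sd y) i * (∑ (legL y (lookup is l)) (λ a → ∑ (legL y (lookup is l′)) (g a)) * Pr (sd y) is)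
      ≡⟨ x∙yz≈y∙xz (P (sd y) i) (∑ (legL y (lookup is l)) (λ a → ∑ (legL y (lookup is l′)) (g a))) (Pr (sd y) is) ⟩
    ∑ (legL y (lookup is l)) (λ a → ∑ (legL y (lookup is l′)) (g a)) * (P (sd y) i * Pr (sd y) is) ∎
    where
    open ≤-Reasoning
    p = P (sd y) (lookup is l) * P (sd y) (lookup is l′)
    S₁ = ∑ (legT y is) (λ ls → g (lookup ls l) (lookup ls l′))

  ∑-cherry : ∀ y (F : Vx → Vx → ℕ) → ∑ (legL y 1) (λ a → ∑ (legL y 1) (λ a′ → F (hd y a) (hd y a′)))
                                     ≡ ∑ (nb y) (λ v → ∑ (legL y 1) (λ f → F v (hd y f)))
  ∑-cherry y F = trans (∑-legL-suc y 0 _) (+-identityʳ _)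

  -- Only the ends of two legs of length 1 are concerned, so the other legs cancel and the share is
  -- that of the rich stars of shape (1 , 1).
  cherry-count : ∀ {s} E c b (is : Vec ℕ s) l l′ → l ≢ l′ → lookup is l ≡ 1 → lookup is l′ ≡ 1 →
    StarSparse E c b (1 ∷ 1 ∷ []) →
    E * ∑ (starL b is) (λ σ → ⟦ does (c ≤? #roots b (1 ∷ 1 ∷ []) (at σ l ∷ at σ l′ ∷ [])) ⟧) ≤ total b is
  cherry-count {s} E c b is l l′ ne e e′ sp = *-cancelʳ-≤ _ _ (d * d) ⦃ m*n≢0 d d ⦃ >-nonZero (D>0 b) ⦄ ⦃ >-nonZero (D>0 b) ⦄ ⦄ (begin
    E * ∑ (starL b is) (λ σ → h (at σ l) (at σ l′)) * (d * d)
      ≡⟨ trans (*-assoc E _ (d * d)) (cong (E *_) (trans (cong (_* (d * d)) (∑-starL b is _)) (sym (∑-*ʳ (sideL b) (d * d) _)))) ⟩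
    E * ∑ (sideL b) (λ y → ∑ (legT y is) (λ ls → h (hd y (lookup ls l)) (hd y (lookup ls l′))) * (d * d))
      ≤⟨ *-monoʳ-≤ E (∑-mono∈ (sideL b) λ y y∈ → one y (∈sideL⇒sd b y∈)) ⟩
    E * ∑ (sideL b) (λ y → ∑ (nb y) (λ v → ∑ (legL y 1) (λ f → h v (hd y f))) * Pr b is)
      ≡⟨ cong (E *_) (∑-*ʳ (sideL b) (Pr b is) _) ⟩
    E * (∑ (sideL b) (λ y → ∑ (nb y) (λ v → ∑ (legL y 1) (λ f → h v (hd y f)))) * Pr b is)
      ≡⟨ cong (λ x → E * (x * Pr b is)) (sym (∑-fork b 1 _)) ⟩
    E * (starRich b (1 ∷ 1 ∷ []) c * Pr b is)
      ≡⟨ sym (*-assoc E _ (Pr b is)) ⟩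
    E * starRich b (1 ∷ 1 ∷ []) c * Pr b is
      ≤⟨ *-monoˡ-≤ (Pr b is) sp ⟩
    sz b * (1 * d * (1 * d * 1)) * Pr b is
      ≡⟨ lem (sz b) d (Pr b is) ⟩
    total b is * (d * d) ∎)
    where
    open ≤-Reasoning
    d = D b
    h : Vx → Vx → ℕ
    h v v′ = ⟦ does (c ≤? #roots b (1 ∷ 1 ∷ []) (v ∷ v′ ∷ [])) ⟧
    lem : ∀ z d p → z * (1 * d * (1 * d * 1)) * p ≡ z * p * (d * d)
    lem = solve-∀
    d≡ : ∀ y → sd y ≡ b → P (sd y) (lookup is l) * P (sd y) (lookup is l′) ≡ d * d
    d≡ y eq = trans (cong₂ (λ i j → P (sd y) i * P (sd y) j) e e′)
      (trans (cong (λ c → 1 * D c * (1 * D c)) eq) (cong₂ _*_ (*-identityˡ d) (*-identityˡ d)))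
    one : ∀ y → sd y ≡ b → ∑ (legT y is) (λ ls → h (hd y (lookup ls l)) (hd y (lookup ls l′))) * (d * d) ≤
                           ∑ (nb y) (λ v → ∑ (legL y 1) (λ f → h v (hd y f))) * Pr b is
    one y eq = ≤-trans (≤-reflexive (cong (∑ (legT y is) (λ ls → h (hd y (lookup ls l)) (hd y (lookup ls l′))) *_) (sym (d≡ y eq))))
      (≤-trans (∑-two-legs y is l l′ ne (λ a a′ → h (hd y a) (hd y a′)))
        (≤-reflexive (cong₂ _*_ (trans (cong₂ (λ i j → ∑ (legL y i) (λ a → ∑ (legL y j) (λ a′ → h (hd y a) (hd y a′)))) e e′) (∑-cherry y h))
                                (cong (λ c → Pr c is) eq))))

sum-updateAt-< : ∀ {s} (is : Vec ℕ s) l (f : ℕ → ℕ) → f (lookup is l) < lookup is l → Vec.sum (updateAt is l f) < Vec.sum is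
sum-updateAt-< (i ∷ is) zero    f lt = +-monoˡ-< (Vec.sum is) lt
sum-updateAt-< (i ∷ is) (suc l) f lt = +-monoʳ-< i (sum-updateAt-< is l f lt)

sum-bound : ∀ {s} (is : Vec ℕ s) B → (∀ l → lookup is l ≤ B) → Vec.sum is ≤ s * B
sum-bound []       B h = z≤n
sum-bound (i ∷ is) B h = +-mono-≤ (h zero) (sum-bound is B (h ∘ suc))

sum-positive : ∀ {s} → 1 ≤ s → (is : Vec ℕ s) → (∀ l → 1 ≤ lookup is l) → 0 < Vec.sum is
sum-positive _ (i ∷ is) h = ≤-trans (h zero) (m≤m+n i _)

module StarStep (μ s t k : ℕ) (1≤k : 1 ≤ k) (E c′ c₂ N̂ : ℕ) where

  rr Lf Lm hit₀ a₀ b₀ cₛ E₁ Qₛ : ℕ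
  -- At most one single and `k` double moves for each leg.
  rr   = s + 2 * (s * k)
  Lf   = s + t * suc (s * (2 * k))
  Lm   = Lf + rr
  hit₀ = c′ ^ s + N̂ * (c′ * c′)
  -- The second summand serves `cherry-rich`: a center carries at most `c′ ^ s` members of a class,
  -- so a surviving class needs more than `c₂` cherries.
  a₀   = suc (Lm * hit₀ + c′ ^ s * c₂)
  b₀   = suc Lm
  cₛ   = (8 * E * suc rr) * suc a₀
  E₁   = (4 * E) * suc (N̂ * suc μ)
  Qₛ   = (4 * E) * suc (N̂ * suc N̂) + (8 * E * suc rr) * suc (s * b₀)

  module _ {m n Q : ℕ} {G : BipGraph m n} (S : Setting G μ Q) (Q≥ : Qₛ ≤ Q) (noH : ¬ ContainsSubdiv G s t k 1)
           (is : Vec ℕ s) (is≤N̂ : Vec.sum is ≤ N̂) (1≤is : ∀ l → 1 ≤ lookup is l) (is≤2k : ∀ l → lookup is l ≤ 2 * k) where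
    open Sparse G S
    open Embed G
    open Webs G
    open TwoLegs G S

    open Rounds G D deg≤ true is c′ cₛ a₀ b₀
    open Avoid G D deg≤ true is c′ cₛ a₀ b₀ 1≤is
    open Raise G D deg≤ true is c′ cₛ a₀ b₀ 1≤is

    private
      Rr : ℕ
      Rr = suc rr

      half : ℕ → ℕ
      half i = proj₁ (halve (2 * k ∸ i))

      odd : ℕ → Bool
      odd i = proj₁ (proj₂ (halve (2 * k ∸ i)))

      ev : Vec ℕ s
      ev = Vec.map half is

      ct : Vec Bool s
      ct = Vec.map odd is

      lengths : ∀ l → lookup is l + 2 * lookup ev l + ⟦ lookup ct l ⟧ ≡ 2 * k
      lengths l = trans (cong₂ (λ e c → i + 2 * e + ⟦ c ⟧) (Vec.lookup-map l half is) (Vec.lookup-map l odd is))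
        (trans (+-assoc i _ _) (trans (cong (i +_) (sym (proj₂ (proj₂ (halve (2 * k ∸ i)))))) (m+[n∸m]≡n (is≤2k l))))
        where i = lookup is l

      ev≤k : ∀ l → lookup ev l ≤ k
      ev≤k l = *-cancelˡ-≤ 2 (≤-trans (m≤n+m (2 * lookup ev l) (lookup is l)) (≤-trans (m≤m+n _ ⟦ lookup ct l ⟧) (≤-reflexive (lengths l))))

      cost : tally ct + 2 * Vec.sum ev ≤ rr
      cost = +-mono-≤ (tally≤ ct) (*-monoʳ-≤ 2 (sum-bound ev k ev≤k))

      hit≤ : Lm * hit < a₀
      hit≤ = s≤s (≤-trans (*-monoʳ-≤ Lm (+-monoʳ-≤ (c′ ^ s) (*-monoˡ-≤ (c′ * c′) is≤N̂))) (m≤m+n _ _))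

      raised : Raised Rr Lf (λ l → lookup is l + 2 * lookup ev l + ⟦ lookup ct l ⟧) (lookup ct)
      raised = Raised-≤ {1 + (tally ct + 2 * Vec.sum ev)} {Rr} {ct = lookup ct} (s≤s cost)
        (Raised-all Lm hit≤ ≤-refl (tally ct) ct ev refl (+-monoʳ-≤ Lf cost))

      T-down : ∀ j {σ} → T (suc j) σ ≡ true → T 1 σ ≡ true
      T-down zero    t = t
      T-down (suc j) {σ} t = T-down j {σ} (proj₁ (∧-true {T (suc j) σ} t))

      unit-leg : ∀ {y i f} → Leg y i f → i ≡ 1 → hd y f ∈ nb y
      unit-leg (v∈ ∷ []) refl = v∈

      cherry : Vx → Vx → Vx → ℕ
      cherry v v′ y = ∑ (nb y) (λ u → ∑ (legL y 1) (λ f → ⟦ does ((u ∷ hd y f ∷ []) ≟ᵛ (v ∷ v′ ∷ [])) ⟧))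

      cherry≥1 : ∀ {v v′ y} → v ∈ nb y → v′ ∈ nb y → 1 ≤ cherry v v′ y
      cherry≥1 {v} {v′} {y} v∈ v′∈ = ≤-trans (≤-reflexive (sym (cong ⟦_⟧ (true-does ((v ∷ v′ ∷ []) ≟ᵛ (v ∷ v′ ∷ [])) refl))))
        (≤-trans (∑-pick (λ u → ⟦ does ((v ∷ u ∷ []) ≟ᵛ (v ∷ v′ ∷ [])) ⟧) v′∈)
          (≤-trans (≤-reflexive (sym (trans (∑-legL-suc y 0 _) (+-identityʳ _))))
            (∑-pick (λ u → ∑ (legL y 1) (λ f → ⟦ does ((u ∷ hd y f ∷ []) ≟ᵛ (v ∷ v′ ∷ [])) ⟧)) v∈)))

      -- A center that carries a member of the class is adjacent to both roots and so gives a cherry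
      -- on them; it carries at most `c′ ^ s` members.
      class≤cherries : ∀ σ l l′ → lookup is l ≡ 1 → lookup is l′ ≡ 1 →
        class 0 (heads σ) ≤ c′ ^ s * #roots true (1 ∷ 1 ∷ []) (at σ l ∷ at σ l′ ∷ [])
      class≤cherries σ l l′ e e′ = begin
        class 0 (heads σ)
          ≡⟨ ∑-starL true is _ ⟩
        ∑ (sideL true) (λ y → inner y)
          ≤⟨ ∑-mono∈ (sideL true) one ⟩
        ∑ (sideL true) (λ y → c′ ^ s * cherry (at σ l) (at σ l′) y)
          ≡⟨ trans (∑-*ˡ (sideL true) (c′ ^ s) _) (cong (c′ ^ s *_) (sym (∑-fork true 1 _))) ⟩
        c′ ^ s * #roots true (1 ∷ 1 ∷ []) (at σ l ∷ at σ l′ ∷ []) ∎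
        where
        open ≤-Reasoning
        wt : Star s → ℕ
        wt τ = ⟦ T 0 τ ⟧ * ⟦ does (heads τ ≟ᵛ heads σ) ⟧
        inner : Vx → ℕ
        inner y = ∑ (legT y is) (λ ls → wt (y , ls))
        bounded : ∀ y → y ∈ sideL true → inner y ≤ c′ ^ s
        bounded y y∈ = ≤-trans (≤-reflexive (∑-cong (legT y is) λ ls → trans (sym (*-identityʳ _)) (cong (λ x → wt (y , ls) * ⟦ x ⟧) (sym (true-does (y ≟ y) refl)))))
          (≤-trans (∑-pick (λ y′ → ∑ (legT y′ is) (λ ls → wt (y′ , ls) * ⟦ does (y′ ≟ y) ⟧)) y∈)
            (≤-trans (≤-reflexive (sym (∑-starL true is (λ τ → wt τ * ⟦ does (proj₁ τ ≟ y) ⟧)))) (center-hits 0 (heads σ) y)))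
        same : ∀ τ → heads τ ≡ heads σ → ∀ l → at τ l ≡ at σ l
        same τ h l = trans (sym (at-heads τ l)) (trans (cong (λ v̄ → lookup v̄ l) h) (at-heads σ l))
        found : ∀ y → (∃ λ ls → ls ∈ legT y is × 0 < wt (y , ls)) → 1 ≤ cherry (at σ l) (at σ l′) y
        found y (ls , ls∈ , pos) = cherry≥1 {y = y} (nb∈ l e) (nb∈ l′ e′)
          where
          h : heads (y , ls) ≡ heads σ
          h = does-true (heads (y , ls) ≟ᵛ heads σ) (⟦⟧-positive _ (*-positiveʳ ⟦ T 0 (y , ls) ⟧ _ pos))
          nb∈ : ∀ l → lookup is l ≡ 1 → at σ l ∈ nb y
          nb∈ l e = subst (_∈ nb y) (same (y , ls) h l) (unit-leg (legT-sound is ls∈ l) e)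
        one : ∀ y → y ∈ sideL true → inner y ≤ c′ ^ s * cherry (at σ l) (at σ l′) y
        one y y∈ = go (1 ≤? inner y)
          where
          go : Dec (1 ≤ inner y) → inner y ≤ c′ ^ s * cherry (at σ l) (at σ l′) y
          go (no ¬p) = ≤-trans (≤-pred (≰⇒> ¬p)) z≤n
          go (yes p) = ≤-trans (bounded y y∈) (≤-trans (≤-reflexive (sym (*-identityʳ (c′ ^ s))))
            (*-monoʳ-≤ (c′ ^ s) (found y (∑-positive (legT y is) (λ ls → wt (y , ls)) p))))

      cherry-rich : ∀ σ l l′ → lookup is l ≡ 1 → lookup is l′ ≡ 1 → T Rr σ ≡ true →
        c₂ ≤ #roots true (1 ∷ 1 ∷ []) (at σ l ∷ at σ l′ ∷ [])
      cherry-rich σ l l′ e e′ t = <⇒≤ (*-cancelˡ-< (c′ ^ s) _ _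
        (<-≤-trans (s≤s (m≤n+m (c′ ^ s * c₂) (Lm * hit₀))) (≤-trans (T-class 0 σ (T-down rr {σ} t)) (class≤cherries σ l l′ e e′))))

      -- Two legs of length 1 would both be re-rooted at the center.  But the companions of a
      -- surviving star have many centers, all adjacent to the two roots, so the roots of such a pair
      -- would be rich for the shape (1 , 1).
      no-cherries : StarSparse (suc (4 * E)) c₂ true (1 ∷ 1 ∷ []) → total true is ≤ (4 * E) * #T Rr → 0 < #T Rr →
        ∀ l l′ → l ≢ l′ → lookup is l ≡ 1 → lookup is l′ ≡ 1 → ⊥
      no-cherries H₀ le pos l l′ ne e e′ = <⇒≱ (m<n+m ((4 * E) * #T Rr) pos)
        (≤-trans (*-monoʳ-≤ (suc (4 * E)) (∑-mono (starL true is) λ σ →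
            ⟦⟧-mono {T Rr σ} (λ t → true-does (c₂ ≤? #roots true (1 ∷ 1 ∷ []) (at σ l ∷ at σ l′ ∷ [])) (cherry-rich σ l l′ e e′ t))))
          (≤-trans (cherry-count (suc (4 * E)) c₂ true is l l′ ne e e′ H₀) le))

      -- The one exception to a root lying on its own leg: the second vertex of a leg of length 1 is
      -- the center.
      place : ∀ {y ls} → IsStar is (y , ls) → ∀ c l →
        (if c then second (y , ls) l else at (y , ls) l) ∈ lookup ls l ⊎
        ((if c then second (y , ls) l else at (y , ls) l) ≡ y × lookup is l ≡ 1)
      place {y} {ls} st false l = inj₁ (subst (hd y (lookup ls l) ∈_) (sym (leg-∷ {y} {ls} st l)) (here refl))
      place {y} {ls} st true  l rewrite Vec.lookup∘updateAt l {f = drop 1} ls with lookup ls l | lookup is l | st l | 1≤is l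
      ... | []          | .0           | []         | ()
      ... | v ∷ []      | suc zero     | v∈ ∷ []    | _ = inj₂ (refl , refl)
      ... | v ∷ u ∷ f   | suc (suc i)  | _ ∷ _ ∷ _  | _ = inj₁ (there (here refl))

      -- Legs of a good star are disjoint and miss the center, so two roots could coincide only at
      -- the center, which takes two legs of length 1.
      roots-injective : (∀ l l′ → l ≢ l′ → lookup is l ≡ 1 → lookup is l′ ≡ 1 → ⊥) →
        ∀ σ → IsStar is σ → good σ ≡ true → ∀ l l′ → root σ (lookup ct) l ≡ root σ (lookup ct) l′ → l ≡ l′
      roots-injective nc (y , ls) st g l l′ eq with l Fin.≟ l′
      ... | yes e = e
      ... | no ne = ⊥-elim (apart (place {y} {ls} st (lookup ct l) l) (place {y} {ls} st (lookup ct l′) l′))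
        where
        uniq = distinct-Unique y ls (proj₁ (good⇒ (y , ls) g))
        r r′ : Vx
        r  = root (y , ls) (lookup ct) l
        r′ = root (y , ls) (lookup ct) l′
        apart : r ∈ lookup ls l ⊎ (r ≡ y × lookup is l ≡ 1) → r′ ∈ lookup ls l′ ⊎ (r′ ≡ y × lookup is l′ ≡ 1) → ⊥
        apart (inj₁ p) (inj₁ q) = legs-disjoint y ls uniq ne p (subst (_∈ lookup ls l′) (sym eq) q)
        apart (inj₁ p) (inj₂ (q , _)) = center∉legs y ls uniq l (subst (_∈ lookup ls l) (trans eq q) p)
        apart (inj₂ (p , _)) (inj₁ q) = center∉legs y ls uniq l′ (subst (_∈ lookup ls l′) (trans (sym eq) p) q)
        apart (inj₂ (_ , p)) (inj₂ (_ , q)) = nc l l′ ne p q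

      contradict : StarSparse (suc (4 * E)) c₂ true (1 ∷ 1 ∷ []) → total true is ≤ (4 * E) * #T Rr → 0 < total true is → ⊥
      contradict H₀ le pos = from (∑-positive (starL true is) (⟦_⟧ ∘ T Rr) #T>0)
        where
        #T>0 : 0 < #T Rr
        #T>0 = *-positiveʳ (4 * E) _ (≤-trans pos le)
        from : (∃ λ σ → σ ∈ starL true is × 0 < ⟦ T Rr σ ⟧) → ⊥
        from (σ , σ∈ , p) = noH (subdiv-from-star 1≤k (root σ (lookup ct))
            (roots-injective (no-cherries H₀ le #T>0) σ st (T⇒good Rr {σ} tσ)) lengths (raised σ st tσ) ≤-refl)
          where
          st = proj₂ (starL-sound true is σ∈)
          tσ = ⟦⟧-positive (T Rr σ) p

    star-sparse : StarSparse (suc (4 * E)) c₂ true (1 ∷ 1 ∷ []) →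
                  (∀ j → suc j ≤ 2 * k → ∀ b′ → LegSparse E₁ c′ b′ (suc j)) →
                  (∀ js → Vec.sum js < Vec.sum is → (∀ l → 1 ≤ lookup js l) → (∀ l → lookup js l ≤ 2 * k) → StarSparse E₁ c′ true js) →
                  StarSparse E cₛ true is
    star-sparse H₀ H₁ H₂ with E * starRich true is cₛ ≤? total true is
    ... | yes le = le
    ... | no nle = ⊥-elim (contradict H₀
        (dense Q Q≤D μ D>0 handshake 1≤is E rr (≰⇒> nle)
          (≤-trans (*-monoʳ-≤ (4 * E) (s≤s (*-mono-≤ is≤N̂ (s≤s is≤N̂)))) (≤-trans (m≤m+n _ _) Q≥)) ≤-refl
          (≤-trans (m≤n+m _ ((4 * E) * suc (N̂ * suc N̂))) Q≥) h₁ h₂)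
        (total>0 E cₛ true is (≰⇒> nle)))
      where
      E₁≥ : (4 * E) * suc (Vec.sum is * suc μ) ≤ E₁
      E₁≥ = *-monoʳ-≤ (4 * E) (s≤s (*-monoˡ-≤ (suc μ) is≤N̂))
      h₁ : ∀ l j → suc j ≤ lookup is l → ∀ b′ → LegSparse ((4 * E) * suc (Vec.sum is * suc μ)) c′ b′ (suc j)
      h₁ l j le b′ = LegSparse-mono {E′ = E₁} {c′} {c′} b′ (suc j) E₁≥ ≤-refl (H₁ j (≤-trans le (is≤2k l)) b′)
      h₂ : ∀ l j → suc j < lookup is l → StarSparse ((4 * E) * suc (Vec.sum is * suc μ)) c′ true (trunc l (suc j))
      h₂ l j lt = StarSparse-mono {E′ = E₁} {c′} {c′} true (trunc l (suc j)) E₁≥ ≤-refl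
        (H₂ (trunc l (suc j)) (sum-updateAt-< is l (_∸ suc j) (∸-monoʳ-< {lookup is l} (s≤s z≤n) (<⇒≤ lt)))
          (λ l′ → proj₁ (both l′)) (λ l′ → proj₂ (both l′)))
        where
        both : ∀ l′ → 1 ≤ lookup (trunc l (suc j)) l′ × lookup (trunc l (suc j)) l′ ≤ 2 * k
        both l′ with l′ Fin.≟ l
        ... | yes refl rewrite Vec.lookup∘updateAt l {f = _∸ suc j} is = m<n⇒0<n∸m lt , ≤-trans (m∸n≤m (lookup is l) (suc j)) (is≤2k l)
        ... | no ne    rewrite Vec.lookup∘updateAt′ l′ l {f = _∸ suc j} ne is = 1≤is l′ , is≤2k l′

module StarClaim (μ s t k : ℕ) (1≤k : 1 ≤ k) (1≤s : 1 ≤ s) where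
  open PathClaim μ s t k 1 1≤k

  -- Only centers in M occur: truncation keeps the center, and legs of even length then have their
  -- roots in M too, where there are `m ^ s` root tuples.
  StarsSparse : ℕ → ℕ → ℕ → ℕ → Set
  StarsSparse N E c Q₀ = ∀ {m n Q} {G : BipGraph m n} (S : Setting G μ Q) → Q₀ ≤ Q → ¬ ContainsSubdiv G s t k 1 →
    let open Sparse G S in ∀ (is : Vec ℕ s) → Vec.sum is ≤ N → (∀ l → 1 ≤ lookup is l) → (∀ l → lookup is l ≤ 2 * k) →
    StarSparse E c true is

  star-claim : ∀ N E → ∃ λ c → ∃ λ Q₀ → StarsSparse N E c Q₀
  star-claim zero E = 0 , 0 , λ S _ _ is le 1≤is _ → ⊥-elim (<⇒≱ (sum-positive 1≤s is 1≤is) le)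
  star-claim (suc N) E = cₛ , Qₛ + (Q₁ + (Qₚ + Q₂)) , claim
    where
    open StarStep μ s t k 1≤k E 0 0 (suc N) using (E₁)
    IH = star-claim N E₁
    c₁ = proj₁ IH
    Q₁ = proj₁ (proj₂ IH)
    legs = path-claim (2 * k ∸ 1) E₁
    cₚ = proj₁ legs
    Qₚ = proj₁ (proj₂ legs)
    forks = path-claim 1 (suc (4 * E))
    c₂ = proj₁ forks
    Q₂ = proj₁ (proj₂ forks)
    -- A single threshold must serve the shorter stars and the walks; the sum lies above both.
    open StarStep μ s t k 1≤k E (c₁ + cₚ) c₂ (suc N) using (cₛ; Qₛ; star-sparse)
    1≤2k-1 : ∀ {k} → 1 ≤ k → 1 ≤ 2 * k ∸ 1
    1≤2k-1 {suc k} _ = ≤-trans (s≤s z≤n) (m≤n+m (suc (k + 0)) k)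
    claim : StarsSparse (suc N) E cₛ (Qₛ + (Q₁ + (Qₚ + Q₂)))
    claim {G = G} S Q≥ noH is le 1≤is is≤ = star-sparse S (≤-trans (m≤m+n Qₛ _) Q≥) noH is le 1≤is is≤
      (proj₁ (proj₂ (proj₂ forks) S (≤-trans (m≤n+m Q₂ Qₚ) (≤-trans (m≤n+m _ Q₁) (≤-trans (m≤n+m _ Qₛ) Q≥))) noH 1 ≤-refl (1≤2k-1 1≤k) true) ≤-refl)
      (λ j le b → LegSparse-mono {E₁} {E₁} {c₁ + cₚ} {cₚ} b (suc j) ≤-refl (m≤n+m cₚ c₁)
        (proj₂ (proj₂ (proj₂ legs) S (≤-trans (m≤m+n Qₚ Q₂) (≤-trans (m≤n+m _ Q₁) (≤-trans (m≤n+m _ Qₛ) Q≥))) noH j (∸1-mono le) (∸1-mono le) b)))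
      (λ js lt 1≤js js≤ → StarSparse-mono {E = E₁} {E₁} {c₁ + cₚ} {c₁} true js ≤-refl (m≤m+n c₁ cₚ)
        (proj₂ (proj₂ IH) S (≤-trans (m≤m+n Q₁ _) (≤-trans (m≤n+m _ Qₛ) Q≥)) noH js (≤-pred (≤-trans lt le)) 1≤js js≤))
      where
      open Sparse G S
      ∸1-mono : ∀ {j k} → suc j ≤ k → j ≤ k ∸ 1
      ∸1-mono (s≤s le) = le

-- From sparseness to the number of edges.

sum-map : {A : Set} (f : A → ℕ) (xs : List A) → sum (map f xs) ≡ ∑ xs f
sum-map f []       = refl
sum-map f (x ∷ xs) = cong (f x +_) (sum-map f xs)

^-distribʳ-* : ∀ m n o → (m * n) ^ o ≡ m ^ o * n ^ o
^-distribʳ-* m n zero    = refl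
^-distribʳ-* m n (suc o) = trans (cong (m * n *_) (^-distribʳ-* m n o)) (interchange m n (m ^ o) (n ^ o))

0^ : ∀ {p} → 1 ≤ p → 0 ^ p ≡ 0
0^ (s≤s _) = refl

-- The second hypothesis says that `r` accounts for at most half of `X`, so `p` accounts for the
-- other half.
absorb : ∀ X M r p → X ≤ M * (r + p) → 2 * M * r ≤ X → X ≤ 2 * M * p
absorb X M r p h₁ h₂ = +-cancelˡ-≤ X _ _ (begin
  X + X                       ≤⟨ +-mono-≤ h₁ h₁ ⟩
  M * (r + p) + M * (r + p)   ≡⟨ lem M r p ⟩
  2 * M * r + 2 * M * p       ≤⟨ +-monoˡ-≤ (2 * M * p) h₂ ⟩
  X + 2 * M * p               ∎)
  where
  open ≤-Reasoning
  lem : ∀ M r p → M * (r + p) + M * (r + p) ≡ 2 * M * r + 2 * M * p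
  lem = solve-∀

⟦⟧+⟦not⟧ : ∀ p → ⟦ p ⟧ + ⟦ not p ⟧ ≡ 1
⟦⟧+⟦not⟧ true  = refl
⟦⟧+⟦not⟧ false = refl

-- A key that occurs on a poor item has fewer than `c` items in all.
poor-bound : {A K : Set} (_≟ₖ_ : (x y : K) → Dec (x ≡ y)) (xs : List A) (key : A → K) (ks : List K) (c : ℕ) →
  (∀ x → x ∈ xs → key x ∈ ks) →
  ∑ xs (λ x → ⟦ not (does (c ≤? ∑ xs (λ x′ → ⟦ does (key x′ ≟ₖ key x) ⟧))) ⟧) ≤ length ks * c
poor-bound {A} {K} _≟ₖ_ xs key ks c key∈ = begin
  ∑ xs (λ x → poor (key x))
    ≤⟨ ∑-mono∈ xs (λ x x∈ → ≤-trans (≤-reflexive (trans (sym (*-identityʳ _)) (cong (λ p → poor (key x) * ⟦ p ⟧) (sym (true-does (key x ≟ₖ key x) refl)))))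
         (∑-pick (λ κ → poor κ * ⟦ does (key x ≟ₖ κ) ⟧) (key∈ x x∈))) ⟩
  ∑ xs (λ x → ∑ ks (λ κ → poor κ * ⟦ does (key x ≟ₖ κ) ⟧))
    ≡⟨ trans (∑-swap xs ks _) (∑-cong ks λ κ → ∑-*ˡ xs (poor κ) _) ⟩
  ∑ ks (λ κ → poor κ * # κ)
    ≤⟨ ∑-bound ks c (λ κ _ → small κ (c ≤? # κ)) ⟩
  length ks * c ∎
  where
  open ≤-Reasoning
  # poor : K → ℕ
  # κ = ∑ xs (λ x′ → ⟦ does (key x′ ≟ₖ κ) ⟧)
  poor κ = ⟦ not (does (c ≤? # κ)) ⟧
  small : ∀ κ (d : Dec (c ≤ # κ)) → ⟦ not (does d) ⟧ * # κ ≤ c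
  small κ (yes _) = z≤n
  small κ (no ¬p) = ≤-trans (≤-reflexive (+-identityʳ _)) (<⇒≤ (≰⇒> ¬p))

module _ {m n : ℕ} (G : BipGraph m n) where
  open Graph G

  sz-M : sz true ≡ m
  sz-M = trans (length-map inj₁ (allFin m)) (length-tabulate {n = m} id)

  sz-N : sz false ≡ n
  sz-N = trans (length-map inj₂ (allFin n)) (length-tabulate {n = n} id)

  length-nb : ∀ u → length (nb u) ≡ ∑ (sideL (not (sd u))) (λ v → ⟦ adj v u ⟧)
  length-nb u = trans (sym (∑1 (nb u))) (trans (∑-filterᵇ (λ v → adj v u) (sideL (not (sd u))) (λ _ → 1)) (∑-cong (sideL (not (sd u))) λ v → *-identityʳ _))

  length-nb-M : ∀ a → length (nb (inj₁ a)) ≡ degM G a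
  length-nb-M a = trans (length-nb (inj₁ a)) (trans (∑-map inj₂ (allFin n) _) (sym (sum-map _ (allFin n))))

  length-nb-N : ∀ b → length (nb (inj₂ b)) ≡ degN G b
  length-nb-N b = trans (length-nb (inj₂ b)) (trans (∑-map inj₁ (allFin m) _) (sym (sum-map _ (allFin m))))

  edges≡ : ∀ b → edges G ≡ ∑ (sideL b) (λ u → length (nb u))
  edges≡ true = trans (sum-map (degM G) (allFin m)) (trans (∑-cong (allFin m) λ a → sym (length-nb-M a)) (sym (∑-map inj₁ (allFin m) _)))
  edges≡ false = trans (edges≡ true) (trans (∑-cong (sideL true) λ u → sym (∑1 (nb u)))
    (trans (nb-swap true (λ _ _ → 1)) (∑-cong (sideL false) λ u → ∑1 (nb u))))

  almost : ∀ μ → AlmostBiregular μ G → ∀ u v → sd u ≡ sd v → length (nb u) ≤ μ * length (nb v)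
  almost μ (reg , _) (inj₁ a) (inj₁ a′) _ rewrite length-nb-M a | length-nb-M a′ = reg a a′
  almost μ (_ , reg) (inj₂ b) (inj₂ b′) _ rewrite length-nb-N b | length-nb-N b′ = reg b b′

-- Adds to `Setting` the lower degree bounds, by which the budgets overestimate the true counts by a
-- constant factor only.
record Regular {m n : ℕ} (G : BipGraph m n) (μ Q : ℕ) : Set where
  open Graph G
  field
    setting : Setting G μ Q
  open Setting setting public
  field
    deg≥    : ∀ u → D (sd u) ≤ μ * length (nb u)
    edges≤  : ∀ b → edges G ≤ sz b * D b

-- `D` is `μ` times the degree of the first vertex of the side: it dominates all degrees there and
-- exceeds none by more than `μ * μ`. If it is at most `Q` on some side, the edges are few already.
regularize : ∀ {m n} (G : BipGraph (suc m) (suc n)) μ → AlmostBiregular μ G → ∀ Q →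
             (edges G ≤ suc m * Q ⊎ edges G ≤ suc n * Q) ⊎ Regular G (μ * μ) Q
regularize {m} {n} G μ ab Q with suc Q ≤? μ * length (Graph.nb G (inj₁ zero)) | suc Q ≤? μ * length (Graph.nb G (inj₂ zero))
... | no ¬p | _ = inj₁ (inj₁ (≤-trans (≤-reflexive (edges≡ G true)) (≤-trans
    (∑-bound (sideL true) Q λ u u∈ → ≤-trans (almost G μ ab u (inj₁ zero) (∈sideL⇒sd true u∈)) (≤-pred (≰⇒> ¬p)))
    (≤-reflexive (cong (_* Q) (sz-M G))))))
  where open Graph G
... | _ | no ¬p = inj₁ (inj₂ (≤-trans (≤-reflexive (edges≡ G false)) (≤-trans
    (∑-bound (sideL false) Q λ u u∈ → ≤-trans (almost G μ ab u (inj₂ zero) (∈sideL⇒sd false u∈)) (≤-pred (≰⇒> ¬p)))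
    (≤-reflexive (cong (_* Q) (sz-N G))))))
  where open Graph G
... | yes p | yes q = inj₂ record
  { setting = record { D = D ; deg≤ = deg≤ ; Q<D = λ { true → p ; false → q }
                     ; handshake = λ b b′ → ≤-trans (edges≥ b′) (*-monoʳ-≤ (μ * μ) (edges≤ b)) }
  ; deg≥ = deg≥ ; edges≤ = edges≤ }
  where
  open Graph G
  D : Bool → ℕ
  D true  = μ * length (nb (inj₁ zero))
  D false = μ * length (nb (inj₂ zero))
  deg≤ : ∀ u → length (nb u) ≤ D (sd u)
  deg≤ (inj₁ a) = almost G μ ab (inj₁ a) (inj₁ zero) refl
  deg≤ (inj₂ b) = almost G μ ab (inj₂ b) (inj₂ zero) refl
  deg≥ : ∀ u → D (sd u) ≤ μ * μ * length (nb u)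
  deg≥ (inj₁ a) = ≤-trans (*-monoʳ-≤ μ (almost G μ ab (inj₁ zero) (inj₁ a) refl)) (≤-reflexive (sym (*-assoc μ μ _)))
  deg≥ (inj₂ b) = ≤-trans (*-monoʳ-≤ μ (almost G μ ab (inj₂ zero) (inj₂ b) refl)) (≤-reflexive (sym (*-assoc μ μ _)))
  edges≤ : ∀ b → edges G ≤ sz b * D b
  edges≤ b = ≤-trans (≤-reflexive (edges≡ G b)) (∑-bound (sideL b) (D b) λ u u∈ → ≤-trans (deg≤ u) (≤-reflexive (cong D (∈sideL⇒sd b u∈))))
  edges≥ : ∀ b → sz b * D b ≤ μ * μ * edges G
  edges≥ b = begin
    sz b * D b                                           ≡⟨ sym (∑-const (sideL b) (D b)) ⟩
    ∑ (sideL b) (λ _ → D b)                              ≤⟨ ∑-mono∈ (sideL b) (λ u u∈ → subst (λ c → D c ≤ μ * μ * length (nb u)) (∈sideL⇒sd b u∈) (deg≥ u)) ⟩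
    ∑ (sideL b) (λ u → μ * μ * length (nb u))            ≡⟨ ∑-*ˡ (sideL b) (μ * μ) _ ⟩
    μ * μ * ∑ (sideL b) (λ u → length (nb u))            ≡⟨ cong (μ * μ *_) (sym (edges≡ G b)) ⟩
    μ * μ * edges G ∎
    where open ≤-Reasoning

module Conclusion {m n : ℕ} (G : BipGraph m n) {μ Q : ℕ} (reg : Regular G μ Q) where
  open Regular reg using (deg≥; edges≤; setting)
  open Sparse G setting

  -- Each step falls short of its budget by a factor of at most `μ`.
  legL-lower : ∀ z j → P (sd z) j ≤ μ ^ j * length (legL z j)
  legL-lower z zero    = ≤-refl
  legL-lower z (suc j) = begin
    P (sd z) j * d                                        ≤⟨ *-monoˡ-≤ d (legL-lower z j) ⟩
    μ ^ j * length (legL z j) * d                         ≡⟨ trans (*-assoc (μ ^ j) _ d) (cong (μ ^ j *_) (sym (∑-const (legL z j) d))) ⟩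
    μ ^ j * ∑ (legL z j) (λ _ → d)
      ≤⟨ *-monoʳ-≤ (μ ^ j) (∑-mono∈ (legL z j) λ f f∈ → subst (λ c → D c ≤ μ * length (nb (hd z f))) (Leg-sd (legL-sound j f∈)) (deg≥ (hd z f))) ⟩
    μ ^ j * ∑ (legL z j) (λ f → μ * length (nb (hd z f))) ≡⟨ cong (μ ^ j *_) (∑-*ˡ (legL z j) μ _) ⟩
    μ ^ j * (μ * ∑ (legL z j) (λ f → length (nb (hd z f))))
      ≡⟨ lem (μ ^ j) μ _ ⟩
    μ * μ ^ j * ∑ (legL z j) (λ f → length (nb (hd z f)))
      ≡⟨ cong (μ * μ ^ j *_) (trans (∑-cong (legL z j) λ f → sym (∑1 (nb (hd z f)))) (trans (sym (∑-legL-suc z j (λ _ → 1))) (∑1 (legL z (suc j))))) ⟩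
    μ * μ ^ j * length (legL z (suc j)) ∎
    where
    open ≤-Reasoning
    d = D (flip j (sd z))
    lem : ∀ a b c → a * (b * c) ≡ b * a * c
    lem = solve-∀

  legT-lower : ∀ {s} y (is : Vec ℕ s) → Pr (sd y) is ≤ μ ^ Vec.sum is * length (legT y is)
  legT-lower y []       = ≤-refl
  legT-lower y (i ∷ is) = begin
    P (sd y) i * Pr (sd y) is
      ≤⟨ *-mono-≤ (legL-lower y i) (legT-lower y is) ⟩
    μ ^ i * length (legL y i) * (μ ^ Vec.sum is * length (legT y is))
      ≡⟨ interchange (μ ^ i) (length (legL y i)) (μ ^ Vec.sum is) (length (legT y is)) ⟩
    μ ^ i * μ ^ Vec.sum is * (length (legL y i) * length (legT y is))
      ≡⟨ cong₂ _*_ (sym (^-distribˡ-+-* μ i (Vec.sum is)))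
           (sym (trans (sym (∑1 (legT y (i ∷ is)))) (trans (∑-legT-∷ y i is (λ _ → 1)) (trans (∑-const (legL y i) _) (cong (length (legL y i) *_) (∑1 (legT y is))))))) ⟩
    μ ^ (i + Vec.sum is) * length (legT y (i ∷ is)) ∎
    where
    open ≤-Reasoning

  flip-even : ∀ k b → flip (2 * k) b ≡ b
  flip-even zero    b = refl
  flip-even (suc k) b = trans (cong (λ j → flip (suc j) b) (+-suc k (k + 0))) (trans (not-involutive _) (flip-even k b))

  P-even : ∀ k → P true (2 * k) ≡ (D true * D false) ^ k
  P-even zero    = refl
  P-even (suc k) = trans (cong (P true ∘ suc) (+-suc k (k + 0)))
    (trans (cong₂ (λ b b′ → P true (2 * k) * D b * D b′) (flip-even k true) (cong not (flip-even k true)))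
      (trans (cong (λ x → x * D true * D false) (P-even k)) (lem ((D true * D false) ^ k) (D true) (D false))))
    where
    lem : ∀ p d d′ → p * d * d′ ≡ d * d′ * p
    lem = solve-∀

  -- Multiplying the edge bounds of the two sides gives e² ≤ |M| |N| `D true * D false`, and the
  -- `k`-th power of the degree product is the budget for walks of length 2k.
  edges-even : ∀ k → edges G ^ (2 * k) ≤ m ^ k * n ^ k * P true (2 * k)
  edges-even k = begin
    edges G ^ (2 * k)                                      ≡⟨ sym (^-*-assoc (edges G) 2 k) ⟩
    (edges G ^ 2) ^ k                                      ≡⟨ cong (λ x → (edges G * x) ^ k) (*-identityʳ (edges G)) ⟩
    (edges G * edges G) ^ k                                ≤⟨ ^-monoˡ-≤ k (*-mono-≤ (edges≤ true) (edges≤ false)) ⟩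
    (sz true * D true * (sz false * D false)) ^ k          ≡⟨ cong (_^ k) (interchange (sz true) (D true) (sz false) (D false)) ⟩
    (sz true * sz false * (D true * D false)) ^ k          ≡⟨ ^-distribʳ-* (sz true * sz false) (D true * D false) k ⟩
    (sz true * sz false) ^ k * (D true * D false) ^ k
      ≡⟨ cong₂ _*_ (trans (^-distribʳ-* (sz true) (sz false) k) (cong₂ (λ a b → a ^ k * b ^ k) (sz-M G) (sz-N G))) (sym (P-even k)) ⟩
    m ^ k * n ^ k * P true (2 * k) ∎
    where
    open ≤-Reasoning

  -- Poor walks carry at least half of the budget. Walks of even length from M end in M, so there
  -- are at most m² pairs of ends, with at most `c` poor walks each.
  leg-bound : ∀ c k → LegSparse (2 * μ ^ (2 * k)) c true (2 * k) → 1 ≤ m → P true (2 * k) ≤ 2 * μ ^ (2 * k) * c * m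
  leg-bound c k sp 1≤m = *-cancelˡ-≤ m ⦃ >-nonZero 1≤m ⦄ (begin
    m * P true j                       ≡⟨ cong (_* P true j) (sym (sz-M G)) ⟩
    sz true * P true j                 ≤⟨ absorb (sz true * P true j) M rich poor lower sp ⟩
    2 * M * poor                       ≤⟨ *-monoʳ-≤ (2 * M) poor≤ ⟩
    2 * M * (m * (m * c))              ≡⟨ lem (2 * M) m c ⟩
    m * (2 * M * c * m)                ∎)
    where
    open ≤-Reasoning
    j = 2 * k
    M = μ ^ j
    isRich : Vx → List Vx → Bool
    isRich z f = does (c ≤? #walks j z (hd z f))
    rich = legRich true j c
    poor = ∑ (sideL true) (λ z → ∑ (legL z j) (λ f → ⟦ not (isRich z f) ⟧))
    lem : ∀ a b c → a * (b * (b * c)) ≡ b * (a * c * b)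
    lem = solve-∀
    lower : sz true * P true j ≤ M * (rich + poor)
    lower = begin
      sz true * P true j                                  ≡⟨ sym (∑-const (sideL true) _) ⟩
      ∑ (sideL true) (λ _ → P true j)                     ≤⟨ ∑-mono∈ (sideL true) (λ z z∈ → subst (λ b → P b j ≤ M * length (legL z j)) (∈sideL⇒sd true z∈) (legL-lower z j)) ⟩
      ∑ (sideL true) (λ z → M * length (legL z j))        ≡⟨ ∑-*ˡ (sideL true) M _ ⟩
      M * ∑ (sideL true) (λ z → length (legL z j))
        ≡⟨ cong (M *_) (trans (∑-cong (sideL true) λ z → trans (sym (∑1 (legL z j)))
             (trans (∑-cong (legL z j) λ f → sym (⟦⟧+⟦not⟧ (isRich z f))) (∑-+ (legL z j) _ _))) (∑-+ (sideL true) _ _)) ⟩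
      M * (rich + poor) ∎
    poor≤ : poor ≤ m * (m * c)
    poor≤ = ≤-trans (∑-bound (sideL true) (sz true * c) λ z z∈ → poor-bound _≟_ (legL z j) (hd z) (sideL true) c
        (λ f f∈ → subst (λ b → hd z f ∈ sideL b) (trans (Leg-sd (legL-sound j f∈)) (trans (flip-even k (sd z)) (∈sideL⇒sd true z∈))) (∈sideL (hd z f))))
      (≤-reflexive (cong (λ x → x * (x * c)) (sz-M G)))

  tuples : ∀ s → List (Vec Vx s)
  tuples zero    = [] ∷ []
  tuples (suc s) = concatMap (λ v → map (v ∷_) (tuples s)) (sideL true)

  tuples-length : ∀ s → length (tuples s) ≡ m ^ s
  tuples-length zero    = refl
  tuples-length (suc s) = trans (length-concatMap (λ v → map (v ∷_) (tuples s)) (sideL true))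
    (trans (∑-cong (sideL true) λ v → trans (length-map (v ∷_) (tuples s)) (tuples-length s)) (trans (∑-const (sideL true) _) (cong (_* m ^ s) (sz-M G))))

  ∈-tuples : ∀ {s} (v̄ : Vec Vx s) → (∀ l → sd (lookup v̄ l) ≡ true) → v̄ ∈ tuples s
  ∈-tuples []      h = here refl
  ∈-tuples {suc s} (v ∷ v̄) h = ∈-concatMap-intro (λ v → map (v ∷_) (tuples s)) (subst (λ b → v ∈ sideL b) (h zero) (∈sideL v))
    (∈-map⁺ (v ∷_) (∈-tuples v̄ (h ∘ suc)))

  -- As in `leg-bound`, with the `m ^ s` tuples of roots in the place of the pairs of ends.
  star-bound : ∀ s c k → let is = Vec.replicate s (2 * k) in
    StarSparse (2 * μ ^ Vec.sum is) c true is → m * P true (2 * k) ^ s ≤ 2 * μ ^ Vec.sum is * c * m ^ s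
  star-bound s c k sp = begin
    m * P true (2 * k) ^ s             ≡⟨ cong₂ _*_ (sym (sz-M G)) (sym (Pr-replicate s)) ⟩
    total true is                      ≤⟨ absorb (total true is) M rich poor lower sp ⟩
    2 * M * poor                       ≤⟨ *-monoʳ-≤ (2 * M) poor≤ ⟩
    2 * M * (m ^ s * c)                ≡⟨ lem (2 * M) (m ^ s) c ⟩
    2 * M * c * m ^ s                  ∎
    where
    open ≤-Reasoning
    is = Vec.replicate s (2 * k)
    M = μ ^ Vec.sum is
    isRich : Star s → Bool
    isRich σ = does (c ≤? #roots true is (heads σ))
    rich = starRich true is c
    poor = ∑ (starL true is) (λ σ → ⟦ not (isRich σ) ⟧)
    lem : ∀ a b c → a * (b * c) ≡ a * c * b
    lem = solve-∀
    Pr-replicate : ∀ s → Pr true (Vec.replicate s (2 * k)) ≡ P true (2 * k) ^ s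
    Pr-replicate zero    = refl
    Pr-replicate (suc s) = cong (P true (2 * k) *_) (Pr-replicate s)
    lower : total true is ≤ M * (rich + poor)
    lower = begin
      total true is                                 ≡⟨ sym (∑-const (sideL true) _) ⟩
      ∑ (sideL true) (λ _ → Pr true is)             ≤⟨ ∑-mono∈ (sideL true) (λ y y∈ → subst (λ b → Pr b is ≤ M * length (legT y is)) (∈sideL⇒sd true y∈) (legT-lower y is)) ⟩
      ∑ (sideL true) (λ y → M * length (legT y is)) ≡⟨ ∑-*ˡ (sideL true) M _ ⟩
      M * ∑ (sideL true) (λ y → length (legT y is))
        ≡⟨ cong (M *_) (trans (∑-cong (sideL true) λ y → sym (∑1 (legT y is))) (trans (sym (∑-starL true is (λ _ → 1)))
             (trans (∑-cong (starL true is) λ σ → sym (⟦⟧+⟦not⟧ (isRich σ))) (∑-+ (starL true is) _ _)))) ⟩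
      M * (rich + poor) ∎
    poor≤ : poor ≤ m ^ s * c
    poor≤ = ≤-trans (poor-bound _≟ᵛ_ (starL true is) heads (tuples s) c λ σ σ∈ → ∈-tuples (heads σ) λ l → side σ (starL-sound true is σ∈) l)
      (≤-reflexive (cong (_* c) (tuples-length s)))
      where
      side : ∀ σ → sd (proj₁ σ) ≡ true × IsStar is σ → ∀ l → sd (lookup (heads σ) l) ≡ true
      side σ (e , st) l = trans (cong sd (at-heads σ l)) (trans (Leg-sd (st l))
        (trans (cong (λ i → flip i (sd (proj₁ σ))) (Vec.lookup-replicate l (2 * k))) (trans (flip-even k (sd (proj₁ σ))) e)))

small-case : ∀ {m n} e Q p x → m ≤ n → e ≤ m * Q ⊎ e ≤ n * Q → e ^ p ≤ Q ^ p * (x + m ^ p + n ^ p)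
small-case {m} {n} e Q p x m≤n h = begin
  e ^ p                            ≤⟨ ^-monoˡ-≤ p (e≤ h) ⟩
  (n * Q) ^ p                      ≡⟨ trans (^-distribʳ-* n Q p) (*-comm (n ^ p) (Q ^ p)) ⟩
  Q ^ p * n ^ p                    ≤⟨ *-monoʳ-≤ (Q ^ p) (m≤n+m (n ^ p) (x + m ^ p)) ⟩
  Q ^ p * (x + m ^ p + n ^ p)      ∎
  where
  open ≤-Reasoning
  e≤ : e ≤ m * Q ⊎ e ≤ n * Q → e ≤ n * Q
  e≤ (inj₁ h) = ≤-trans h (*-monoˡ-≤ Q m≤n)
  e≤ (inj₂ h) = h

part₁ : (μ k r s t : ℕ) → 1 ≤ k → Σ ℕ λ C → ((m n : ℕ) (G : BipGraph m n) → m ≤ n → AlmostBiregular μ G →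
        ¬ ContainsSubdiv G s t k r → edges G ^ (2 * k) ≤ C * (m ^ (k + 1) * n ^ k + m ^ (2 * k) + n ^ (2 * k)))
part₁ μ k r s t 1≤k = Q ^ (2 * k) + K , bound
  where
  μ₂ = μ * μ
  E = 2 * μ₂ ^ (2 * k)
  claim = PathClaim.path-claim μ₂ s t k r 1≤k (2 * k ∸ 1) E
  c = proj₁ claim
  Q = proj₁ (proj₂ claim)
  K = E * c
  bound : (m n : ℕ) (G : BipGraph m n) → m ≤ n → AlmostBiregular μ G →
          ¬ ContainsSubdiv G s t k r → edges G ^ (2 * k) ≤ (Q ^ (2 * k) + K) * (m ^ (k + 1) * n ^ k + m ^ (2 * k) + n ^ (2 * k))
  -- An empty M leaves no edges, and the exponent is positive. Elsewhere `m≤n` makes both sides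
  -- nonempty, as `regularize` demands.
  bound zero n G m≤n ab noH = ≤-trans (≤-reflexive (0^ (≤-trans 1≤k (m≤m+n k _)))) z≤n
  bound m@(suc _) n@(suc _) G m≤n ab noH with regularize G μ ab Q
  ... | inj₁ small = ≤-trans (small-case (edges G) Q (2 * k) (m ^ (k + 1) * n ^ k) m≤n small) (*-monoˡ-≤ _ (m≤m+n (Q ^ (2 * k)) K))
  ... | inj₂ reg = begin
    edges G ^ (2 * k)                          ≤⟨ edges-even k ⟩
    m ^ k * n ^ k * P true (2 * k)             ≤⟨ *-monoʳ-≤ (m ^ k * n ^ k) (leg-bound c k sparse (s≤s z≤n)) ⟩
    m ^ k * n ^ k * (K * m)                    ≡⟨ lem (m ^ k) (n ^ k) K m ⟩
    K * (m ^ k * (m * 1) * n ^ k)              ≡⟨ cong (λ x → K * (x * n ^ k)) (sym (^-distribˡ-+-* m k 1)) ⟩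
    K * (m ^ (k + 1) * n ^ k)                  ≤⟨ *-mono-≤ (m≤n+m K (Q ^ (2 * k))) (≤-trans (m≤m+n _ (m ^ (2 * k))) (m≤m+n _ (n ^ (2 * k)))) ⟩
    (Q ^ (2 * k) + K) * (m ^ (k + 1) * n ^ k + m ^ (2 * k) + n ^ (2 * k)) ∎
    where
    open ≤-Reasoning
    open Conclusion G reg
    open Regular reg using (setting)
    open Sparse G setting
    lem : ∀ a b c d → a * b * (c * d) ≡ c * (a * (d * 1) * b)
    lem = solve-∀
    sparse : LegSparse E c true (2 * k)
    sparse = subst (LegSparse E c true) (m+[n∸m]≡n (≤-trans 1≤k (m≤m+n k (k + 0)))) (proj₂ (proj₂ (proj₂ claim) setting ≤-refl noH (2 * k ∸ 1) ≤-refl ≤-refl true))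

part₂ : (μ k s t : ℕ) → 1 ≤ k → 1 ≤ s → Σ ℕ λ C → ((m n : ℕ) (G : BipGraph m n) → m ≤ n → AlmostBiregular μ G →
        ¬ ContainsSubdiv G s t k 1 →
        edges G ^ (2 * k * s) ≤ C * (m ^ (k * s + s ∸ 1) * n ^ (k * s) + m ^ (2 * k * s) + n ^ (2 * k * s)))
part₂ μ k s t 1≤k 1≤s = Q ^ (2 * k * s) + K , bound
  where
  μ₂ = μ * μ
  is = Vec.replicate s (2 * k)
  E = 2 * μ₂ ^ Vec.sum is
  claim = StarClaim.star-claim μ₂ s t k 1≤k 1≤s (Vec.sum is) E
  c = proj₁ claim
  Q = proj₁ (proj₂ claim)
  K = E * c
  X : ℕ → ℕ → ℕ
  X m n = m ^ (k * s + s ∸ 1) * n ^ (k * s)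
  bound : (m n : ℕ) (G : BipGraph m n) → m ≤ n → AlmostBiregular μ G → ¬ ContainsSubdiv G s t k 1 →
          edges G ^ (2 * k * s) ≤ (Q ^ (2 * k * s) + K) * (X m n + m ^ (2 * k * s) + n ^ (2 * k * s))
  bound zero n G m≤n ab noH = ≤-trans (≤-reflexive (0^ (*-mono-≤ (≤-trans 1≤k (m≤m+n k _)) 1≤s))) z≤n
  bound m@(suc _) n@(suc _) G m≤n ab noH with regularize G μ ab Q
  ... | inj₁ small = ≤-trans (small-case (edges G) Q (2 * k * s) (X m n) m≤n small) (*-monoˡ-≤ _ (m≤m+n (Q ^ (2 * k * s)) K))
  ... | inj₂ reg = begin
    edges G ^ (2 * k * s)                      ≡⟨ sym (^-*-assoc (edges G) (2 * k) s) ⟩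
    (edges G ^ (2 * k)) ^ s                    ≤⟨ ^-monoˡ-≤ s (edges-even k) ⟩
    (m ^ k * n ^ k * P true (2 * k)) ^ s
      ≡⟨ trans (^-distribʳ-* (m ^ k * n ^ k) (P true (2 * k)) s) (cong (_* P true (2 * k) ^ s)
           (trans (^-distribʳ-* (m ^ k) (n ^ k) s) (cong₂ _*_ (^-*-assoc m k s) (^-*-assoc n k s)))) ⟩
    m ^ (k * s) * n ^ (k * s) * P true (2 * k) ^ s
      ≤⟨ *-monoʳ-≤ (m ^ (k * s) * n ^ (k * s)) Ps≤ ⟩
    m ^ (k * s) * n ^ (k * s) * (K * m ^ (s ∸ 1))
      ≡⟨ lem (m ^ (k * s)) (n ^ (k * s)) K (m ^ (s ∸ 1)) ⟩
    K * (m ^ (k * s) * m ^ (s ∸ 1) * n ^ (k * s))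
      ≡⟨ cong (λ x → K * (x * n ^ (k * s))) (trans (sym (^-distribˡ-+-* m (k * s) (s ∸ 1))) (cong (m ^_) (sym (+-∸-assoc (k * s) 1≤s)))) ⟩
    K * X m n
      ≤⟨ *-mono-≤ (m≤n+m K (Q ^ (2 * k * s))) (≤-trans (m≤m+n _ (m ^ (2 * k * s))) (m≤m+n _ (n ^ (2 * k * s)))) ⟩
    (Q ^ (2 * k * s) + K) * (X m n + m ^ (2 * k * s) + n ^ (2 * k * s)) ∎
    where
    open ≤-Reasoning
    open Conclusion G reg
    open Regular reg using (setting)
    open Sparse G setting
    lem : ∀ a b c d → a * b * (c * d) ≡ c * (a * d * b)
    lem = solve-∀
    1≤2k : 1 ≤ 2 * k
    1≤2k = ≤-trans 1≤k (m≤m+n k _)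
    sparse : StarSparse E c true is
    sparse = proj₂ (proj₂ claim) setting ≤-refl noH is ≤-refl
      (λ l → ≤-trans 1≤2k (≤-reflexive (sym (Vec.lookup-replicate l (2 * k))))) (λ l → ≤-reflexive (Vec.lookup-replicate l (2 * k)))
    m^s : ∀ {s} → 1 ≤ s → m ^ s ≡ m * m ^ (s ∸ 1)
    m^s (s≤s _) = refl
    -- The stars are counted with their `m` centers, and cancelling this factor leaves
    -- `m ^ (s ∸ 1)`: the origin of the term -1/(2ks) in the exponent.
    Ps≤ : P true (2 * k) ^ s ≤ K * m ^ (s ∸ 1)
    Ps≤ = *-cancelˡ-≤ m (≤-trans (star-bound s c k sparse) (≤-reflexive (trans (cong (K *_) (m^s 1≤s)) (x∙yz≈y∙xz K m _))))

-- Raising the bounds to the powers 2k and 2ks clears the fractional exponents: 2k(1/2 + 1/2k) = k +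
-- 1 and 2ks(1/2 + 1/2k - 1/2ks) = ks + s - 1. A power of a sum of three terms and the sum of their
-- powers differ by a constant factor at most, so nothing is lost.
theorem3p12 : (μ k r s t : ℕ) → 1 ≤ k → 1 ≤ r → 2 ≤ s → 2 ≤ t → 2 ≤ μ →
    Σ ℕ λ C → Σ ℕ λ C' → 1 ≤ C × 1 ≤ C' ×
      ((m n : ℕ) (G : BipGraph m n) → m ≤ n → AlmostBiregular μ G →
        ¬ ContainsSubdiv G s t k r →
        edges G ^ (2 * k) ≤ C * (m ^ (k + 1) * n ^ k + m ^ (2 * k) + n ^ (2 * k)))
      ×
      ((m n : ℕ) (G : BipGraph m n) → m ≤ n → AlmostBiregular μ G →
        ¬ ContainsSubdiv G s t k 1 →
        edges G ^ (2 * k * s)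
          ≤ C' * (m ^ (k * s + s ∸ 1) * n ^ (k * s) + m ^ (2 * k * s) + n ^ (2 * k * s)))
theorem3p12 μ k r s t 1≤k 1≤r 2≤s 2≤t 2≤μ = suc C , suc C′ , s≤s z≤n , s≤s z≤n ,
  (λ m n G m≤n ab noH → ≤-trans (proj₂ p₁ m n G m≤n ab noH) (*-monoˡ-≤ (m ^ (k + 1) * n ^ k + m ^ (2 * k) + n ^ (2 * k)) (n≤1+n C))) ,
  (λ m n G m≤n ab noH → ≤-trans (proj₂ p₂ m n G m≤n ab noH)
    (*-monoˡ-≤ (m ^ (k * s + s ∸ 1) * n ^ (k * s) + m ^ (2 * k * s) + n ^ (2 * k * s)) (n≤1+n C′)))
  where
  p₁ = part₁ μ k r s t 1≤k
  C  = proj₁ p₁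
  p₂ = part₂ μ k s t 1≤k (≤-trans (n≤1+n 1) 2≤s)
  C′ = proj₁ p₂
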